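{- Let $\mathcal{C}$ be a covering of the plane by complete folding curves, satisfying the local isomorphism property, which is generated by a curve associated to the $\infty$-folding sequence $(a_k)_{k\in\mathbb{N}^*}$ with $a_{2^{4n}}=a_{2^{4n+1}}=+1$ and $a_{2^{4n+2}}=a_{2^{4n+3}}=-1$ for each $n\in\mathbb{N}$. Then $\mathcal{C}$ is locally isomorphic to a covering by $4$ curves.
   Context: Curves and coverings. Identify $\mathbb{R}^2$ with $\mathbb{C}$ and $\mathbb{Z}^2$ with $\mathbb{Z}+i\mathbb{Z}$. To a sequence $(a_k)_{1\le k\le n-1}$, $(a_k)_{k\in\mathbb{N}^*}$ or $(a_k)_{k\in\mathbb{Z}}$ with all $a_k=\pm1$ are associated the curves $(C_k)_{1\le k\le n}$, $(C_k)_{k\in\mathbb{N}^*}$, $(C_k)_{k\in\mathbb{Z}}$ whose segments are oriented intervals $C_k=[x_k,x_k+\varepsilon_k]$ with $x_k\in\mathbb{Z}+i\mathbb{Z}$, $\varepsilon_k\in\{1,-1,i,-i\}$, and, whenever $C_k,C_{k+1}$ exist, $x_k+\varepsilon_k=x_{k+1}$ and $\varepsilon_{k+1}=i^{a_k}\varepsilon_k$. Curves are rounded at the points $x_{k+1}$ so that they do not pass through them (so curves sharing no unit interval are disjoint). Curves indexed by $\mathbb{Z}$ are called complete and are considered up to a shift of the index. A covering (of the plane) is a set of complete curves such that each nonoriented interval $[z,z+\varepsilon]$ with $z\in\mathbb{Z}+i\mathbb{Z}$, $\varepsilon\in\{1,i\}$ is the support of exactly one segment of exactly one of the curves. Orientation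 convention: for each $z=x+iy\in\mathbb{Z}+i\mathbb{Z}$, depending on the parity of $x+y$, the segments with endpoint $z$ are $[z,z+1],[z,z-1],[z+i,z],[z-i,z]$, or they are $[z+1,z],[z-1,z],[z,z+i],[z,z-i]$. Folding sequences. For a finite sequence $S=(a_1,\dots,a_m)$ put $\overline{S}=(-a_m,\dots,-a_1)$. The $0$-folding sequence is empty, and the $(n+1)$-folding sequences are the sequences $(\overline{S},\varepsilon,S)$ with $S$ an $n$-folding sequence and $\varepsilon=\pm1$. An $\infty$-folding sequence is a sequence $S=(a_k)_{k\in\mathbb{N}^*}$ such that $(a_1,\dots,a_{2^n-1})$ is an $n$-folding sequence for every $n$; it is determined by the values $a_{2^n}$, $n\in\mathbb{N}$, which can be arbitrary. A complete folding sequence is a sequence $(a_k)_{k\in\mathbb{Z}}$ in $\{\pm1\}$ such that each finite block $(a_{k+1},\dots,a_{k+l})$ is a block of consecutive terms of an $n$-folding sequence for some $n$. $\infty$-folding curves and complete folding curves are the curves associated to such sequences. Local isomorphism. For sets of curves $\mathcal{B},\mathcal{C}$: $\mathcal{B}\cong\mathcal{C}$ means that $\mathcal{C}$ is the image of $\mathcal{B}$ under a translation; $\mathcal{B}<\mathcal{C}$ means that $\mathcal{B}\ne\mathcal{C}$, each curve of $\mathcal{B}$ is contained in (is a subcurve of) a curve of $\mathcal{C}$, and any consecutive segments of a curve of $\mathcal{C}$ which belong to curves of $\mathcal{B}$ are consecutive in one of them. A covering $\mathcal{C}$ satisfies the local isomorphism property if for each bounded set of curves (finitely many segments) $\mathcal{B}<\mathcal{C}$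 there is $r>0$ such that every disc of radius $r$ contains some $\mathcal{B}'<\mathcal{C}$ with $\mathcal{B}'\cong\mathcal{B}$. Coverings $\mathcal{C},\mathcal{D}$ are locally isomorphic if for each bounded $\mathcal{B}<\mathcal{C}$ there is $\mathcal{B}'<\mathcal{D}$ with $\mathcal{B}'\cong\mathcal{B}$, and conversely with $\mathcal{C}$ and $\mathcal{D}$ exchanged. Generation. A covering $\mathcal{C}$ by complete folding curves which satisfies the local isomorphism property is generated by an $\infty$-folding curve $D$ with initial point $x$ if, up to reversal of orientation, the four curves obtained from $D$ by the rotations of angles $0,\pi/2,\pi,3\pi/2$ around $x$ are subcurves of curves of $\mathcal{C}$ (they are then connected at $x$ into two complete curves of $\mathcal{C}$). -}

module Defs where

open import Data.Integer.Base as ℤ using (ℤ; +_; -_; ∣_∣; 0ℤ; 1ℤ; -1ℤ)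
open import Data.List.Base using (List; []; _∷_; _++_; map; reverse; applyUpTo; length)
open import Data.List.Membership.Propositional using (_∈_)
open import Data.List.Relation.Binary.Infix.Heterogeneous using (Infix)
open import Data.List.Relation.Unary.All using (All)
open import Data.List.Relation.Unary.Any using (Any)
open import Data.Nat.Base using (ℕ; zero; suc; _^_; _∸_; parity)
open import Data.Parity.Base using (Parity; _⁻¹)
open import Data.Product using (∃-syntax; ∃!; _×_; _,_)
open import Data.Rational.Base as ℚ using (ℚ; 0ℚ)
open import Data.Sign.Base as Sign using (Sign; opposite)
open import Data.Sum.Base using (_⊎_)
open import Function.Bundles using (_⇔_)
open import Relation.Binary.PropositionalEquality.Core using (_≡_)

-- (x , y) stands for x + iy.
ℤ[i] : Set
ℤ[i] = ℤ × ℤ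

infixl 6 _⊕_ _⊖_

_⊕_ : ℤ[i] → ℤ[i] → ℤ[i]
(x , y) ⊕ (x′ , y′) = (x ℤ.+ x′ , y ℤ.+ y′)

_⊖_ : ℤ[i] → ℤ[i] → ℤ[i]
(x , y) ⊖ (x′ , y′) = (x ℤ.- x′ , y ℤ.- y′)

data Unit : Set where
  one i -one -i : Unit

⟦_⟧ : Unit → ℤ[i]
⟦ one ⟧  = (1ℤ , 0ℤ)
⟦ i ⟧    = (0ℤ , 1ℤ)
⟦ -one ⟧ = (-1ℤ , 0ℤ)
⟦ -i ⟧   = (0ℤ , -1ℤ)

infixr 7 _·_ _∙_

_·_ : Unit → ℤ[i] → ℤ[i]
one  · z       = z
i    · (x , y) = (- y , x)
-one · (x , y) = (- x , - y)
-i   · (x , y) = (y , - x)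

i∙ : Unit → Unit
i∙ one  = i
i∙ i    = -one
i∙ -one = -i
i∙ -i   = one

_∙_ : Unit → Unit → Unit
one  ∙ ε = ε
i    ∙ ε = i∙ ε
-one ∙ ε = i∙ (i∙ ε)
-i   ∙ ε = i∙ (i∙ (i∙ ε))

i^_ : Sign → Unit
i^ Sign.+ = i
i^ Sign.- = -i

-- The oriented interval [start , start + dir].
record Segment : Set where
  constructor seg
  field
    start : ℤ[i]
    dir   : Unit

  end : ℤ[i]
  end = start ⊕ ⟦ dir ⟧

open Segment public

flip : Segment → Segment
flip s = seg (end s) (-one ∙ dir s)

translate : ℤ[i] → Segment → Segment
translate v (seg z ε) = seg (z ⊕ v) ε

-- The rotation z ↦ x + u (z - x).
rotate : ℤ[i] → Unit → Segment → Segment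
rotate x u (seg z ε) = seg (x ⊕ u · (z ⊖ x)) (u ∙ ε)

-- The segment C_{k+1} which follows C_k when a_k = a.
next : Sign → Segment → Segment
next a s = seg (end s) (i^ a ∙ dir s)

-- The rounding of the curves at their vertices does not appear: two curves
-- are compared only through the oriented segments that they share.

-- (C_k)_{1≤k≤n} is given by C_1 and (a_1 , … , a_{n-1}); thus n ≥ 1.
record FiniteCurve : Set where
  constructor finiteCurve
  field
    first : Segment
    turns : List Sign

segmentsFrom : Segment → List Sign → List Segment
segmentsFrom s []       = s ∷ []
segmentsFrom s (a ∷ as) = s ∷ segmentsFrom (next a s) as

segments : FiniteCurve → List Segment
segments b = segmentsFrom (FiniteCurve.first b) (FiniteCurve.turns b)

translateCurve : ℤ[i] → FiniteCurve → FiniteCurve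
translateCurve v (finiteCurve s as) = finiteCurve (translate v s) as

-- (C_k)_{k∈ℕ*}, where a_k is  turn k  for k ≥ 1; the value  turn 0  is not used.
record HalfCurve : Set where
  constructor halfCurve
  field
    first : Segment
    turn  : ℕ → Sign

  -- segmentAt m is C_{m+1}.
  segmentAt : ℕ → Segment
  segmentAt zero    = first
  segmentAt (suc m) = next (turn (suc m)) (segmentAt m)

  initialPoint : ℤ[i]
  initialPoint = start first

record CompleteCurve : Set where
  field
    turn      : ℤ → Sign
    segmentAt : ℤ → Segment
    connected : ∀ k → segmentAt (ℤ.suc k) ≡ next (turn k) (segmentAt k)

  -- The l consecutive segments starting with the one of index k.
  run : ℤ → ℕ → List Segment
  run k l = applyUpTo (λ j → segmentAt (k ℤ.+ + j)) l

bar : List Sign → List Sign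
bar S = reverse (map opposite S)

data Folding : ℕ → List Sign → Set where
  empty : Folding 0 []
  fold  : ∀ {n S} (ε : Sign) → Folding n S → Folding (suc n) (bar S ++ ε ∷ S)

-- As in HalfCurve, a 0 is not used.
IsInfiniteFolding : (ℕ → Sign) → Set
IsInfiniteFolding a = ∀ n → Folding n (applyUpTo (λ j → a (suc j)) (2 ^ n ∸ 1))

IsCompleteFolding : (ℤ → Sign) → Set
IsCompleteFolding a = ∀ (k : ℤ) (l : ℕ) → ∃[ n ] ∃[ S ]
  Folding n S × Infix _≡_ (applyUpTo (λ j → a (k ℤ.+ + suc j)) l) S

parityOf : ℤ[i] → Parity
parityOf (x , y) = parity ∣ x ℤ.+ y ∣

HorizontalOut : ℤ[i] → List Segment
HorizontalOut z = seg z one ∷ seg z -one ∷ seg (z ⊕ ⟦ i ⟧) -i ∷ seg (z ⊖ ⟦ i ⟧) i ∷ []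

HorizontalIn : ℤ[i] → List Segment
HorizontalIn z = seg (z ⊕ ⟦ one ⟧) -one ∷ seg (z ⊖ ⟦ one ⟧) one ∷ seg z i ∷ seg z -i ∷ []

-- A set of complete curves is a family indexed by a type, each curve being
-- represented by one of its parametrizations. By  covers  the curves of the
-- family are pairwise distinct, even up to a shift, so that the number of
-- curves is the cardinality of Index.
record Covering : Set₁ where
  field
    Index : Set
    curve : Index → CompleteCurve

  segmentOf : Index × ℤ → Segment
  segmentOf (c , k) = CompleteCurve.segmentAt (curve c) k

  SegmentWithEndpoint : ℤ[i] → Segment → Set
  SegmentWithEndpoint z s = (∃[ ck ] segmentOf ck ≡ s) × (start s ≡ z ⊎ end s ≡ z)

  field
    covers : ∀ (z : ℤ[i]) (ε : Unit) → ε ∈ one ∷ i ∷ [] →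
      ∃! _≡_ λ (ck : Index × ℤ) →
        segmentOf ck ≡ seg z ε ⊎ segmentOf ck ≡ flip (seg z ε)

    -- p is the parity of the points whose horizontal segments are outgoing;
    -- it is part of the covering since either parity is allowed.
    orientation : ∃[ p ] ∀ z →
      (parityOf z ≡ p → ∀ s → SegmentWithEndpoint z s ⇔ s ∈ HorizontalOut z) ×
      (parityOf z ≡ p ⁻¹ → ∀ s → SegmentWithEndpoint z s ⇔ s ∈ HorizontalIn z)

open Covering public using (Index; curve)

ByCompleteFoldingCurves : Covering → Set
ByCompleteFoldingCurves C = ∀ c → IsCompleteFolding (CompleteCurve.turn (curve C c))

-- A list which is considered up to the set of its elements.
BoundedSet : Set
BoundedSet = List FiniteCurve

-- For sets of curves in general, B < C also requires B ≠ C; this is automatic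
-- here, since the curves of B are finite while those of C are complete and
-- C is nonempty. In the second component the run is nonempty.
infix 4 _<_ _≅_

_<_ : BoundedSet → Covering → Set
B < C =
  All (λ b → ∃[ c ] ∃[ k ]
        CompleteCurve.run (curve C c) k (length (segments b)) ≡ segments b) B
  ×
  (∀ c k l → let r = CompleteCurve.run (curve C c) k (suc l) in
    All (λ s → Any (λ b → s ∈ segments b) B) r →
    Any (λ b → Infix _≡_ r (segments b)) B)

_≅_ : BoundedSet → BoundedSet → Set
B ≅ B′ = ∃[ v ] B′ ≡ map (translateCurve v) B

record Disc : Set where
  field
    centreX centreY radius : ℚ

ℤ→ℚ : ℤ → ℚ
ℤ→ℚ x = x ℚ./ 1

_∈Disc_ : ℤ[i] → Disc → Set
(x , y) ∈Disc d = dx ℚ.* dx ℚ.+ dy ℚ.* dy ℚ.≤ radius ℚ.* radius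
  where
  open Disc d
  dx = ℤ→ℚ x ℚ.- centreX
  dy = ℤ→ℚ y ℚ.- centreY

-- A disc is convex, so it contains a segment when it contains its endpoints.
_InDisc_ : BoundedSet → Disc → Set
B InDisc d = All (λ b → All (λ s → start s ∈Disc d × end s ∈Disc d) (segments b)) B

-- Restricting to rational radii and centres changes nothing: every disc of
-- radius r + 1 contains a disc of radius r with rational centre.
LocalIsomorphismProperty : Covering → Set
LocalIsomorphismProperty C = ∀ B → B < C →
  ∃[ r ] 0ℚ ℚ.< r × (∀ (d : Disc) → Disc.radius d ≡ r →
    ∃[ B′ ] B′ < C × B ≅ B′ × B′ InDisc d)

LocallyIsomorphic : Covering → Covering → Set
LocallyIsomorphic C D =
  (∀ B → B < C → ∃[ B′ ] B′ < D × B ≅ B′) ×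
  (∀ B → B < D → ∃[ B′ ] B′ < C × B ≅ B′)

SubcurveUpToReversal : (ℕ → Segment) → CompleteCurve → Set
SubcurveUpToReversal T γ =
  (∃[ k ] ∀ m → segmentAt (k ℤ.+ + m) ≡ T m) ⊎
  (∃[ k ] ∀ m → segmentAt (k ℤ.- + m) ≡ flip (T m))
  where open CompleteCurve γ

-- Each of the four curves may be reversed separately: by the orientation
-- convention the rotations of angles ±π/2 of a curve of C around its initial
-- point have the opposite orientation.
GeneratedBy : Covering → HalfCurve → Set
GeneratedBy C D = ∀ (u : Unit) → ∃[ c ]
  SubcurveUpToReversal (λ m → rotate initialPoint u (segmentAt m)) (curve C c)
  where open HalfCurve D

{-# OPTIONS --safe #-}
module Submission where

-- Place the origin at the initial point x of D. In a covering the two curves that pass through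
-- a vertex turn there in the same direction, so a covering amounts to an orientation and a sign
-- at each vertex. Here the sign σ z at z ≠ 0 depends only on z as a (1 + i)-adic integer: if
-- z = (1 + i)ⁿ w with w odd, it is given by n mod 4 and the parity of Re w, because replacing
-- consecutive pairs of segments by their sums yields a covering of the same kind on (1 + i)ℤ[i].
-- Consequently σ is locally constant away from 0 and invariant under odd integer factors.
--
-- Reading σ on the coset 3ℤ[i] + gi (g a unit) gives a covering E, morally the translate of C
-- by the (1 + i)-adic integer gi/3, which is therefore locally isomorphic to C. The passage from
-- a segment to the sum of the pair containing it is contracting, and brings every segment of E
-- to one of four segments, which stay distinct and never become adjacent; since two segments
-- are on the same curve exactly when their images eventually agree, E has four curves. The same
-- argument on ℤ[i] itself shows that the rotated copies of D visit every vertex z ≠ x, so that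
-- they determine C except for the sign at x.

open import Defs
open import Data.Empty using (⊥; ⊥-elim)
open import Data.Fin.Base using (Fin)
open import Data.Fin.Patterns using (0F; 1F; 2F; 3F)
import Data.Fin.Properties as Fin
open import Data.Fin.Properties using (any?; all?)
open import Data.Integer.Base as ℤ using (ℤ; +_; -[1+_]; -_; ∣_∣; 0ℤ; 1ℤ; -1ℤ)
open import Data.Integer.Divisibility.Signed using (_∣_; divides; _∣?_; ∣m∣n⇒∣m+n; ∣m∣n⇒∣m-n)
import Data.Integer.Properties as ℤₚ
open import Data.Integer.Tactic.RingSolver using (solve-∀)
open import Data.List.Base using (List; []; _∷_; _++_; map; applyUpTo; length; concatMap; _ʳ++_)
open import Data.List.Membership.Propositional using (_∈_; find; lose)
open import Data.List.Membership.Propositional.Properties using (∈-applyUpTo⁺; ∈-map⁻; ∈-concatMap⁺)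
open import Data.List.Properties using (map-applyUpTo; ʳ++-defn; length-map; length-++; length-reverse)
import Data.List.Relation.Binary.Infix.Heterogeneous as Infix
import Data.List.Relation.Binary.Infix.Heterogeneous.Properties as Infixₚ
open import Data.List.Relation.Unary.All as All using (All; []; _∷_)
import Data.List.Relation.Unary.All.Properties as Allₚ
open import Data.List.Relation.Unary.Any as Any using (Any; here; there)
import Data.List.Relation.Unary.Any.Properties as Anyₚ
open import Data.Nat.Base as ℕ using (ℕ; zero; suc; parity; ⌊_/2⌋; _+_; _*_; _^_; _∸_)
import Data.Nat.Properties as ℕₚ
import Data.Nat.Tactic.RingSolver as ℕ-Solver
open import Data.Parity.Base using (Parity; toSign; fromSign; _⁻¹)
import Data.Parity.Properties as ℙₚ
open import Data.Product using (Σ; ∃-syntax; ∃!; _×_; _,_; proj₁; proj₂)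
open import Data.Product.Properties using () renaming (≡-dec to ×-≡-dec)
open import Data.Sign.Base as Sign using (Sign; opposite)
import Data.Sign.Properties as Signₚ
open import Algebra.Properties.CommutativeSemigroup Signₚ.*-commutativeSemigroup
  using () renaming (interchange to *-interchange)
open import Data.Sum.Base using (_⊎_; inj₁; inj₂)
open import Data.Unit.Base using (⊤; tt)
open import Function.Base using (_∘_)
open import Function.Bundles using (_⇔_; mk⇔; _↔_; Equivalence)
open import Function.Construct.Identity using (↔-id)
open import Relation.Binary.Definitions using (DecidableEquality)
open import Relation.Binary.PropositionalEquality
open import Relation.Nullary using (¬_; Dec; yes; no; map′; _×-dec_; _⊎-dec_; _→-dec_; ¬?)
open import Relation.Nullary.Decidable using (toWitness; from-no; True)
open import Relation.Unary using (Decidable)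

-- The translation by gi/3 is chosen for two reasons. Since 3 is odd, multiplying by 3 changes no
-- sign and turns this translation into one by a Gaussian integer. Since (1 + i)⁴ = -4 is -1 modulo
-- 3, four divisions by 1 + i carry the coset of gi to that of -gi; so the sixteen pairs of a phase
-- and a unit describe all scales at once, and contraction leaves finitely many segments to examine
-- for each pair. The obstacle is the vertex x. No other sign of C determines the sign `t` there,
-- while the coset avoids 0, so that E has no vertex playing the role of x. A patch of C around x is
-- nevertheless found in E, because -gi/3 is a limit of Gaussian integers, and these can be chosen
-- so that the vertex of E that replaces x has sign + or so that it has sign -, as `t` requires.

parℕ : ℕ → Sign
parℕ n = toSign (parity n)

parℕ-+ : ∀ m n → parℕ (m ℕ.+ n) ≡ parℕ m Sign.* parℕ n
parℕ-+ m n = trans (cong toSign (ℙₚ.+-homo-+ m n)) (ℙₚ.+-homo-* (parity m) (parity n))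

parℕ-suc : ∀ n → parℕ (suc n) ≡ opposite (parℕ n)
parℕ-suc n = parℕ-+ 1 n

-- (-1)^x
par : ℤ → Sign
par x = parℕ ∣ x ∣

par-⊖ : ∀ m n → par (m ℤ.⊖ n) ≡ parℕ m Sign.* parℕ n
par-⊖ m zero = trans (cong par (ℤₚ.⊖-≥ {m} {zero} ℕ.z≤n)) (sym (Signₚ.*-identityʳ (parℕ m)))
par-⊖ zero (suc n) = trans (cong par (ℤₚ.⊖-< {zero} {suc n} (ℕ.s≤s ℕ.z≤n))) refl
par-⊖ (suc m) (suc n) = begin
  par (suc m ℤ.⊖ suc n)                      ≡⟨ cong par (ℤₚ.[1+m]⊖[1+n]≡m⊖n m n) ⟩
  par (m ℤ.⊖ n)                              ≡⟨ par-⊖ m n ⟩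
  parℕ m Sign.* parℕ n                       ≡⟨ opp-opp (parℕ m) (parℕ n) ⟩
  opposite (parℕ m) Sign.* opposite (parℕ n) ≡⟨ cong₂ Sign._*_ (parℕ-suc m) (parℕ-suc n) ⟨
  parℕ (suc m) Sign.* parℕ (suc n)           ∎
  where
  open ≡-Reasoning
  opp-opp : ∀ a b → a Sign.* b ≡ opposite a Sign.* opposite b
  opp-opp Sign.- Sign.- = refl
  opp-opp Sign.- Sign.+ = refl
  opp-opp Sign.+ Sign.- = refl
  opp-opp Sign.+ Sign.+ = refl

par-+ : ∀ x y → par (x ℤ.+ y) ≡ par x Sign.* par y
par-+ (+ m) (+ n) = parℕ-+ m n
par-+ (+ m) -[1+ n ] = par-⊖ m (suc n)
par-+ -[1+ m ] (+ n) = trans (par-⊖ n (suc m)) (Signₚ.*-comm (parℕ n) (parℕ (suc m)))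
par-+ -[1+ m ] -[1+ n ] =
  trans (cong parℕ (cong suc (sym (ℕₚ.+-suc m n)))) (parℕ-+ (suc m) (suc n))

par-neg : ∀ x → par (- x) ≡ par x
par-neg x = cong parℕ (ℤₚ.∣-i∣≡∣i∣ x)

par-double : ∀ x → par (x ℤ.+ x) ≡ Sign.+
par-double x = trans (par-+ x x) (Signₚ.s*s≡+ (par x))

par-odd* : ∀ j x → par ((1ℤ ℤ.+ (j ℤ.+ j)) ℤ.* x) ≡ par x
par-odd* j x = begin
  par ((1ℤ ℤ.+ (j ℤ.+ j)) ℤ.* x)              ≡⟨ cong par (expand j x) ⟩
  par (x ℤ.+ (j ℤ.* x ℤ.+ j ℤ.* x))           ≡⟨ par-+ x _ ⟩
  par x Sign.* par (j ℤ.* x ℤ.+ j ℤ.* x)      ≡⟨ cong (par x Sign.*_) (par-double (j ℤ.* x)) ⟩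
  par x Sign.* Sign.+                         ≡⟨ Signₚ.*-identityʳ (par x) ⟩
  par x ∎
  where
  open ≡-Reasoning
  expand : ∀ j x → (1ℤ ℤ.+ (j ℤ.+ j)) ℤ.* x ≡ x ℤ.+ (j ℤ.* x ℤ.+ j ℤ.* x)
  expand = solve-∀

halfℤ : ℤ → ℤ
halfℤ (+ n)    = + ⌊ n /2⌋
halfℤ -[1+ n ] = -[1+ ⌊ n /2⌋ ]

halfℤ-double : ∀ x → halfℤ (x ℤ.+ x) ≡ x
halfℤ-double (+ n)    = cong +_ (sym (ℕₚ.n≡⌊n+n/2⌋ n))
halfℤ-double -[1+ n ] = cong -[1+_] (⌊suc/2⌋ n)
  where
  ⌊suc/2⌋ : ∀ n → ⌊ suc (n ℕ.+ n) /2⌋ ≡ n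
  ⌊suc/2⌋ zero = refl
  ⌊suc/2⌋ (suc n) rewrite ℕₚ.+-suc n n = cong suc (⌊suc/2⌋ n)

evenℕ : ∀ n → parℕ n ≡ Sign.+ → ∃[ k ] n ≡ k ℕ.+ k
evenℕ zero _ = 0 , refl
evenℕ (suc (suc n)) p with k , eq ← evenℕ n p = suc k , cong suc (trans (cong suc eq) (sym (ℕₚ.+-suc k k)))

evenℤ : ∀ x → par x ≡ Sign.+ → ∃[ y ] x ≡ y ℤ.+ y
evenℤ (+ n) p with k , eq ← evenℕ n p = + k , cong +_ eq
evenℤ -[1+ n ] p with evenℕ (suc n) p
... | suc k , eq = -[1+ k ] , cong -[1+_] (trans (ℕₚ.suc-injective eq) (ℕₚ.+-suc k k))

-- Gaussian integers, parities and multiplication by 1 + i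

pair : ∀ {x x′ y y′ : ℤ} → x ≡ x′ → y ≡ y′ → (x , y) ≡ (x′ , y′)
pair = cong₂ _,_

0[i] : ℤ[i]
0[i] = 0ℤ , 0ℤ

-- Multiplication by 1 + i.
κ : ℤ[i] → ℤ[i]
κ (x , y) = x ℤ.- y , y ℤ.+ x

-- Division by 1 + i, that is z (1 - i) / 2, meaningful on even z: there y - a equals (y - x) / 2.
half : ℤ[i] → ℤ[i]
half (x , y) = let a = halfℤ (x ℤ.+ y) in a , y ℤ.- a

half-κ : ∀ w → half (κ w) ≡ w
half-κ (a , b) = pair eq (trans (cong (λ c → (b ℤ.+ a) ℤ.- c) eq) (l2 a b))
  where
  l1 : ∀ a b → (a ℤ.- b) ℤ.+ (b ℤ.+ a) ≡ a ℤ.+ a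
  l1 = solve-∀
  l2 : ∀ a b → (b ℤ.+ a) ℤ.- a ≡ b
  l2 = solve-∀
  eq = trans (cong halfℤ (l1 a b)) (halfℤ-double a)

κ-injective : ∀ {v w} → κ v ≡ κ w → v ≡ w
κ-injective {v} {w} eq = trans (sym (half-κ v)) (trans (cong half eq) (half-κ w))

ρ π τ : ℤ[i] → Sign
ρ z = par (proj₁ z)
π (x , y) = par (x ℤ.+ y)
τ z = opposite (ρ z)

π-split : ∀ z → π z ≡ par (proj₁ z) Sign.* par (proj₂ z)
π-split (x , y) = par-+ x y

ρ-⊕ : ∀ z w → ρ (z ⊕ w) ≡ ρ z Sign.* ρ w
ρ-⊕ z w = par-+ (proj₁ z) (proj₁ w)

π-⊕ : ∀ z w → π (z ⊕ w) ≡ π z Sign.* π w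
π-⊕ (x , y) (a , b) = begin
  π ((x , y) ⊕ (a , b))                          ≡⟨ π-split ((x , y) ⊕ (a , b)) ⟩
  par (x ℤ.+ a) Sign.* par (y ℤ.+ b)             ≡⟨ cong₂ Sign._*_ (par-+ x a) (par-+ y b) ⟩
  (par x Sign.* par a) Sign.* (par y Sign.* par b) ≡⟨ *-interchange (par x) (par a) (par y) (par b) ⟩
  (par x Sign.* par y) Sign.* (par a Sign.* par b) ≡⟨ cong₂ Sign._*_ (par-+ x y) (par-+ a b) ⟨
  π (x , y) Sign.* π (a , b) ∎
  where open ≡-Reasoning

π-⊖ : ∀ z w → π (z ⊖ w) ≡ π z Sign.* π w
π-⊖ z w@(a , b) = trans (π-⊕ z (- a , - b)) (cong (π z Sign.*_)
  (trans (π-split (- a , - b)) (trans (cong₂ Sign._*_ (par-neg a) (par-neg b)) (sym (π-split w)))))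

ρ-κ : ∀ w → ρ (κ w) ≡ π w
ρ-κ (a , b) = trans (par-+ a (- b)) (trans (cong (par a Sign.*_) (par-neg b)) (sym (par-+ a b)))

π-κ : ∀ w → π (κ w) ≡ Sign.+
π-κ (a , b) = trans (cong par (l1 a b)) (par-double a)
  where
  l1 : ∀ a b → (a ℤ.- b) ℤ.+ (b ℤ.+ a) ≡ a ℤ.+ a
  l1 = solve-∀

κ-half : ∀ z → π z ≡ Sign.+ → κ (half z) ≡ z
κ-half z@(x , y) p with a , eq ← evenℤ (x ℤ.+ y) p = trans (cong (λ h → κ (h , y ℤ.- h)) e) (pair
    (trans (l1 a y) (trans (cong (ℤ._- y) (sym eq)) (l2 x y))) (l3 a y))
  where
  e : halfℤ (x ℤ.+ y) ≡ a
  e = trans (cong halfℤ eq) (halfℤ-double a)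
  l1 : ∀ a y → a ℤ.- (y ℤ.- a) ≡ (a ℤ.+ a) ℤ.- y
  l1 = solve-∀
  l2 : ∀ x y → (x ℤ.+ y) ℤ.- y ≡ x
  l2 = solve-∀
  l3 : ∀ a y → (y ℤ.- a) ℤ.+ a ≡ y
  l3 = solve-∀

⊕-assoc : ∀ u v w → (u ⊕ v) ⊕ w ≡ u ⊕ (v ⊕ w)
⊕-assoc (a , b) (c , d) (e , f) = pair (ℤₚ.+-assoc a c e) (ℤₚ.+-assoc b d f)

⊕-comm : ∀ u v → u ⊕ v ≡ v ⊕ u
⊕-comm (a , b) (c , d) = pair (ℤₚ.+-comm a c) (ℤₚ.+-comm b d)

⊕-identityˡ : ∀ u → 0[i] ⊕ u ≡ u
⊕-identityˡ (a , b) = pair (ℤₚ.+-identityˡ a) (ℤₚ.+-identityˡ b)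

⊕-⊖ : ∀ u v → (u ⊕ v) ⊖ v ≡ u
⊕-⊖ (a , b) (c , d) = pair (l a c) (l b d)
  where
  l : ∀ a c → (a ℤ.+ c) ℤ.- c ≡ a
  l = solve-∀

⊖-⊕ : ∀ u v → (u ⊖ v) ⊕ v ≡ u
⊖-⊕ (a , b) (c , d) = pair (l a c) (l b d)
  where
  l : ∀ a c → (a ℤ.- c) ℤ.+ c ≡ a
  l = solve-∀

κ-⊕ : ∀ v w → κ (v ⊕ w) ≡ κ v ⊕ κ w
κ-⊕ (a , b) (c , d) = pair (l1 a b c d) (l2 a b c d)
  where
  l1 : ∀ a b c d → (a ℤ.+ c) ℤ.- (b ℤ.+ d) ≡ (a ℤ.- b) ℤ.+ (c ℤ.- d)
  l1 = solve-∀
  l2 : ∀ a b c d → (b ℤ.+ d) ℤ.+ (a ℤ.+ c) ≡ (b ℤ.+ a) ℤ.+ (d ℤ.+ c)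
  l2 = solve-∀

sq : ℤ[i] → ℤ
sq (x , y) = x ℤ.* x ℤ.+ y ℤ.* y

N : ℤ[i] → ℕ
N (x , y) = ∣ x ∣ ℕ.* ∣ x ∣ ℕ.+ ∣ y ∣ ℕ.* ∣ y ∣

+N : ∀ z → + N z ≡ sq z
+N (x , y) = trans (ℤₚ.pos-+ (∣ x ∣ ℕ.* ∣ x ∣) _) (cong₂ ℤ._+_ (l x) (l y))
  where
  l : ∀ x → + (∣ x ∣ ℕ.* ∣ x ∣) ≡ x ℤ.* x
  l (+ n)    = ℤₚ.pos-* n n
  l -[1+ n ] = refl

N-κ : ∀ w → N (κ w) ≡ N w ℕ.+ N w
N-κ w@(a , b) = ℤₚ.+-injective (trans (+N (κ w)) (trans (l a b) (sym (trans (ℤₚ.pos-+ (N w) (N w)) (cong₂ ℤ._+_ (+N w) (+N w))))))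
  where
  l : ∀ a b → (a ℤ.- b) ℤ.* (a ℤ.- b) ℤ.+ (b ℤ.+ a) ℤ.* (b ℤ.+ a) ≡ (a ℤ.* a ℤ.+ b ℤ.* b) ℤ.+ (a ℤ.* a ℤ.+ b ℤ.* b)
  l = solve-∀

N≡0 : ∀ z → N z ≡ 0 → z ≡ 0[i]
N≡0 (x , y) eq = pair (l x (ℕₚ.m+n≡0⇒m≡0 _ eq)) (l y (ℕₚ.m+n≡0⇒n≡0 (∣ x ∣ ℕ.* ∣ x ∣) eq))
  where
  l : ∀ x → ∣ x ∣ ℕ.* ∣ x ∣ ≡ 0 → x ≡ 0ℤ
  l (+ zero) _ = refl

-- Levels and the sign function

∀-unit : {P : Unit → Set} → P one → P i → P -one → P -i → ∀ e → P e
∀-unit p q r s one  = p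
∀-unit p q r s i    = q
∀-unit p q r s -one = r
∀-unit p q r s -i   = s

-- + on the horizontal directions.
hor : Unit → Sign
hor one  = Sign.+
hor i    = Sign.-
hor -one = Sign.+
hor -i   = Sign.-

data Phase : Set where
  p0 p1 p2 p3 : Phase

-- The exponent of 1 + i modulo 4, and a unit g that becomes -g every fourth step, since (1 + i)⁴ = -4.
Level : Set
Level = Phase × Unit

up : Level → Level
up (p0 , g) = p1 , g
up (p1 , g) = p2 , g
up (p2 , g) = p3 , g
up (p3 , g) = p0 , -one ∙ g

-- Since `h (up l)` is `c l` and the folding terms a_{2^n} must be `c l * h l`, these signs are the
-- partial products of +, +, -, -. They recur with period four because the full product is +.
phaseSign : Phase → Sign
phaseSign p0 = Sign.+
phaseSign p1 = Sign.+
phaseSign p2 = Sign.-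
phaseSign p3 = Sign.+

-- At level l the sign at an odd vertex z is c l * τ z, and the segments that leave
-- the even vertices are horizontal if and only if h l = +.
c h : Level → Sign
c (p , g)  = phaseSign p Sign.* hor g
h (p0 , g) = c (p3 , g)
h (p1 , g) = c (p0 , g)
h (p2 , g) = c (p1 , g)
h (p3 , g) = c (p2 , g)

h-up : ∀ l → h (up l) ≡ c l
h-up (p0 , g) = refl
h-up (p1 , g) = refl
h-up (p2 , g) = refl
h-up (p3 , one)  = refl
h-up (p3 , i)    = refl
h-up (p3 , -one) = refl
h-up (p3 , -i)   = refl

-- The value at 0, which no other value determines, is the parameter t.
σ-fuel : Sign → ℕ → Level → ℤ[i] → Sign
σ-step : Sign → ℕ → Level → ℤ[i] → Sign → Sign
σ-fuel t zero    l z = t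
σ-fuel t (suc n) l z = σ-step t n l z (π z)
σ-step t n l z Sign.+ = σ-fuel t n (up l) (half z)
σ-step t n l z Sign.- = c l Sign.* τ z

σ : Sign → Level → ℤ[i] → Sign
σ t l z = σ-fuel t (N z) l z

module _ (t : Sign) where
  σ-fuel-0 : ∀ n l → σ-fuel t n l 0[i] ≡ t
  σ-fuel-0 zero    l = refl
  σ-fuel-0 (suc n) l = σ-fuel-0 n (up l)

  N-half : ∀ z n → π z ≡ Sign.+ → N z ℕ.≤ suc n → N (half z) ℕ.≤ n
  N-half z n p N≤ with N (half z) | trans (cong N (sym (κ-half z p))) (N-κ (half z))
  ... | zero  | _  = ℕ.z≤n
  ... | suc k | eq = ℕₚ.≤-trans (ℕₚ.m≤n+m (suc k) k) (ℕ.s≤s⁻¹ (subst (ℕ._≤ suc n) eq N≤))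

  -- Division by 1 + i halves the norm, so fuel at least `N z` runs out only at 0, where the answer
  -- is `t` for every amount of fuel.
  σ-fuel-irrelevant : ∀ m n l z → N z ℕ.≤ m → N z ℕ.≤ n → σ-fuel t m l z ≡ σ-fuel t n l z
  σ-fuel-irrelevant zero n l z N≤m _ rewrite N≡0 z (ℕₚ.n≤0⇒n≡0 N≤m) = sym (σ-fuel-0 n l)
  σ-fuel-irrelevant (suc m) zero l z _ N≤n rewrite N≡0 z (ℕₚ.n≤0⇒n≡0 N≤n) = σ-fuel-0 (suc m) l
  σ-fuel-irrelevant (suc m) (suc n) l z N≤m N≤n with π z in p
  ... | Sign.- = refl
  ... | Sign.+ = σ-fuel-irrelevant m n (up l) (half z) (N-half z m p N≤m) (N-half z n p N≤n)

  σ-κ : ∀ l w → σ t l (κ w) ≡ σ t (up l) w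
  σ-κ l w = trans (σ-fuel-irrelevant (N (κ w)) (suc (N (κ w))) l (κ w) ℕₚ.≤-refl (ℕₚ.n≤1+n _)) (trans (eq (π (κ w)) (π-κ w))
     (σ-fuel-irrelevant (N (κ w)) (N w) (up l) w (subst (N w ℕ.≤_) (sym (N-κ w)) (ℕₚ.m≤m+n _ _)) ℕₚ.≤-refl))
    where
    eq : ∀ s → s ≡ Sign.+ → σ-step t (N (κ w)) l (κ w) s ≡ σ-fuel t (N (κ w)) (up l) w
    eq _ refl = cong (σ-fuel t (N (κ w)) (up l)) (half-κ w)

  σ-odd : ∀ l z → π z ≡ Sign.- → σ t l z ≡ c l Sign.* τ z
  σ-odd l z p = trans (σ-fuel-irrelevant (N z) (suc (N z)) l z ℕₚ.≤-refl (ℕₚ.n≤1+n _))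
    (cong (σ-step t (N z) l z) p)

-- Induction on the exponent of 1 + i in z, which is finite for z ≠ 0; the level advances with each
-- factor removed.
κ-induction : (P : Level → ℤ[i] → Set) →
  (∀ l z → π z ≡ Sign.- → P l z) → (∀ l w → w ≢ 0[i] → P (up l) w → P l (κ w)) →
  ∀ l z → z ≢ 0[i] → P l z
κ-induction P P-odd P-κ l z = go (N z) l z ℕₚ.≤-refl
  where
  go : ∀ n l z → N z ℕ.≤ n → z ≢ 0[i] → P l z
  go zero l z N≤ z≢0 = ⊥-elim (z≢0 (N≡0 z (ℕₚ.n≤0⇒n≡0 N≤)))
  go (suc n) l z N≤ z≢0 with π z in p
  ... | Sign.- = P-odd l z p
  ... | Sign.+ = subst (P l) (κ-half z p)
    (P-κ l (half z) half≢0 (go n (up l) (half z) (N-half Sign.+ z n p N≤) half≢0))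
    where
    half≢0 : half z ≢ 0[i]
    half≢0 eq = z≢0 (trans (sym (κ-half z p)) (cong κ eq))

select : Sign → Unit → Unit → Unit
select Sign.+ d e = d
select Sign.- d e = e

-- (1 + i) d = d + i d is the sum of the directions first a d and second a d, in the order such that
-- hor (first a d) = a; pick a e is the direction d with hor d = a for which e is d or i d.
first second pick : Sign → Unit → Unit
first  a d = select (a Sign.* hor d) d (i∙ d)
second a d = select (a Sign.* hor d) (i∙ d) d
pick   a e = select (a Sign.* hor e) e (-i ∙ e)

hor-turn : ∀ a d → hor (i^ a ∙ d) ≡ opposite (hor d)
hor-turn Sign.+ = ∀-unit refl refl refl refl
hor-turn Sign.- = ∀-unit refl refl refl refl

hor-pick : ∀ a e → hor (pick a e) ≡ a
hor-pick Sign.+ = ∀-unit refl refl refl refl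
hor-pick Sign.- = ∀-unit refl refl refl refl

hor-first : ∀ a d → hor (first a d) ≡ a
hor-first Sign.+ = ∀-unit refl refl refl refl
hor-first Sign.- = ∀-unit refl refl refl refl

turn-first : ∀ a d → i^ (hor d Sign.* a) ∙ first a d ≡ second a d
turn-first Sign.+ = ∀-unit refl refl refl refl
turn-first Sign.- = ∀-unit refl refl refl refl

unturn : ∀ s d → i^ (opposite s) ∙ (i^ s ∙ d) ≡ d
unturn Sign.+ = ∀-unit refl refl refl refl
unturn Sign.- = ∀-unit refl refl refl refl

unturn′ : ∀ s d → i^ s ∙ (i^ (opposite s) ∙ d) ≡ d
unturn′ Sign.+ d = unturn Sign.- d
unturn′ Sign.- d = unturn Sign.+ d

turn-second : ∀ s a d → i^ s ∙ second a d ≡ first a (i^ s ∙ d)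
turn-second Sign.+ Sign.+ = ∀-unit refl refl refl refl
turn-second Sign.+ Sign.- = ∀-unit refl refl refl refl
turn-second Sign.- Sign.+ = ∀-unit refl refl refl refl
turn-second Sign.- Sign.- = ∀-unit refl refl refl refl

pick-first : ∀ a d → pick (hor d) (first a d) ≡ d
pick-first Sign.+ = ∀-unit refl refl refl refl
pick-first Sign.- = ∀-unit refl refl refl refl

pick-second : ∀ a d → pick (hor d) (second a d) ≡ d
pick-second Sign.+ = ∀-unit refl refl refl refl
pick-second Sign.- = ∀-unit refl refl refl refl

first-pick : ∀ v e → first (hor e) (pick v e) ≡ e
first-pick Sign.+ = ∀-unit refl refl refl refl
first-pick Sign.- = ∀-unit refl refl refl refl

first-pick′ : ∀ v e → first (opposite (hor e)) (pick v e) ≡ i^ (opposite (v Sign.* opposite (hor e))) ∙ e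
first-pick′ Sign.+ = ∀-unit refl refl refl refl
first-pick′ Sign.- = ∀-unit refl refl refl refl

second-pick : ∀ v e → second (opposite (hor e)) (pick v e) ≡ e
second-pick Sign.+ = ∀-unit refl refl refl refl
second-pick Sign.- = ∀-unit refl refl refl refl

⟦i∙⟧ : ∀ d → ⟦ i∙ d ⟧ ≡ i · ⟦ d ⟧
⟦i∙⟧ = ∀-unit refl refl refl refl

ρ⟦⟧ : ∀ d → ρ ⟦ d ⟧ ≡ opposite (hor d)
ρ⟦⟧ = ∀-unit refl refl refl refl

π⟦⟧ : ∀ d → π ⟦ d ⟧ ≡ Sign.-
π⟦⟧ = ∀-unit refl refl refl refl

-- The substitution

infixr 7 _⊛_
_⊛_ : ℤ → ℤ[i] → ℤ[i]
m ⊛ (x , y) = m ℤ.* x , m ℤ.* y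

odd : ℤ → ℤ
odd j = 1ℤ ℤ.+ (j ℤ.+ j)

π-⊛ : ∀ j z → π (odd j ⊛ z) ≡ π z
π-⊛ j z = trans (π-split (odd j ⊛ z)) (trans (cong₂ Sign._*_ (par-odd* j (proj₁ z)) (par-odd* j (proj₂ z))) (sym (π-split z)))

Valid : Level → Segment → Set
Valid l s = hor (dir s) ≡ h l Sign.* π (start s)

opp-invol : ∀ a → opposite (opposite a) ≡ a
opp-invol = Signₚ.opposite-involutive

opp-* : ∀ a b → opposite a Sign.* b ≡ opposite (a Sign.* b)
opp-* Sign.+ b = refl
opp-* Sign.- b = sym (opp-invol b)

*-opp : ∀ a b → a Sign.* opposite b ≡ opposite (a Sign.* b)
*-opp Sign.+ b = refl
*-opp Sign.- b = refl

-- Segments have length `odd j`: 1 for C itself, 3 for the coset that carries E. An odd length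
-- leaves every parity argument unchanged, so both cases share one substitution.
module Substitution (t : Sign) (j : ℤ) where

  step : Unit → ℤ[i]
  step e = odd j ⊛ ⟦ e ⟧

  ρ-step : ∀ e → ρ (step e) ≡ opposite (hor e)
  ρ-step e = trans (par-odd* j (proj₁ ⟦ e ⟧)) (ρ⟦⟧ e)

  π-step : ∀ e → π (step e) ≡ Sign.-
  π-step e = trans (π-⊛ j ⟦ e ⟧) (π⟦⟧ e)

  π-⊕step : ∀ z e → π (z ⊕ step e) ≡ opposite (π z)
  π-⊕step z e = trans (π-⊕ z (step e)) (trans (cong (π z Sign.*_) (π-step e)) (Signₚ.*-comm (π z) Sign.-))

  π-⊖step : ∀ z e → π (z ⊖ step e) ≡ opposite (π z)
  π-⊖step z e = trans (π-⊖ z (step e)) (trans (cong (π z Sign.*_) (π-step e)) (Signₚ.*-comm (π z) Sign.-))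

  κ-step : ∀ d → step d ⊕ step (i∙ d) ≡ κ (step d)
  κ-step d rewrite ⟦i∙⟧ d = pair (l1 (odd j) (proj₁ ⟦ d ⟧) (proj₂ ⟦ d ⟧)) refl
    where
    l1 : ∀ m x y → m ℤ.* x ℤ.+ m ℤ.* (- y) ≡ m ℤ.* x ℤ.- m ℤ.* y
    l1 = solve-∀

  finish : Segment → ℤ[i]
  finish (seg z e) = z ⊕ step e

  nxt prv : Level → Segment → Segment
  nxt l s = seg (finish s) (i^ (σ t l (finish s)) ∙ dir s)
  prv l (seg z e) = let e′ = i^ (opposite (σ t l z)) ∙ e in seg (z ⊖ step e′) e′

  prv-nxt : ∀ l s → prv l (nxt l s) ≡ s
  prv-nxt l (seg z e) = trans (cong (λ u → seg ((z ⊕ step e) ⊖ step u) u) (unturn (σ t l (z ⊕ step e)) e))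
    (cong (λ w → seg w e) (⊕-⊖ z (step e)))

  nxt-injective : ∀ l {s s′} → nxt l s ≡ nxt l s′ → s ≡ s′
  nxt-injective l {s} {s′} eq = trans (sym (prv-nxt l s)) (trans (cong (prv l) eq) (prv-nxt l s′))

  valid-nxt : ∀ l s → Valid l s → Valid l (nxt l s)
  valid-nxt l (seg z e) v = begin
    hor (dir (nxt l (seg z e)))  ≡⟨ hor-turn (σ t l (z ⊕ step e)) e ⟩
    opposite (hor e)             ≡⟨ cong opposite v ⟩
    opposite (h l Sign.* π z)    ≡⟨ *-opp (h l) (π z) ⟨
    h l Sign.* opposite (π z)    ≡⟨ cong (h l Sign.*_) (π-⊕step z e) ⟨
    h l Sign.* π (z ⊕ step e)    ∎
    where open ≡-Reasoning

  -- T l s is the sum of the pair of consecutive segments that contains s, divided by 1 + i.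
  T : Level → Segment → Segment
  T-at : Level → Segment → Sign → Segment
  T l s = T-at l s (π (start s))
  T-at l (seg z e) Sign.+ = let w = half z in seg w (pick (c l Sign.* π w) e)
  -- An odd z is the middle of a pair, where the sign is `c l * τ z`; undoing this turn gives the
  -- direction of the first segment, and stepping back along it gives the even start of the pair.
  T-at l (seg z e) Sign.- =
    let w = half (z ⊖ step (i^ (opposite (c l Sign.* τ z)) ∙ e)) in seg w (pick (c l Sign.* π w) e)

  child₁ child₂ : Level → Segment → Segment
  child₁ l (seg w d) = seg (κ w) (first (h l) d)
  child₂ l (seg w d) = seg (κ w ⊕ step (first (h l) d)) (second (h l) d)

  child : Level → Sign → Segment → Segment
  child l Sign.+ = child₁ l
  child l Sign.- = child₂ l

  first+second : ∀ a d → step (first a d) ⊕ step (second a d) ≡ κ (step d)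
  first+second a d with a Sign.* hor d
  ... | Sign.+ = κ-step d
  ... | Sign.- = trans (⊕-comm (step (i∙ d)) (step d)) (κ-step d)

  π-middle : ∀ w e → π (κ w ⊕ step e) ≡ Sign.-
  π-middle w e = trans (π-⊕step (κ w) e) (cong opposite (π-κ w))

  τ-middle : ∀ w e → τ (κ w ⊕ step e) ≡ π w Sign.* hor e
  τ-middle w e = trans (cong opposite (trans (ρ-⊕ (κ w) (step e)) (cong₂ Sign._*_ (ρ-κ w) (ρ-step e))))
    (trans (cong opposite (*-opp (π w) (hor e))) (opp-invol (π w Sign.* hor e)))

  -- The heart of the substitution: with this turn, `turn-first` makes the two segments add up to 1
  -- + i times the segment from w. The middle is odd, and its `τ` is known because `ρ (κ w)` is
  -- `π w`.
  σ-middle : ∀ l w d → Valid (up l) (seg w d) → σ t l (κ w ⊕ step (first (h l) d)) ≡ hor d Sign.* h l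
  σ-middle l w d v = begin
    σ t l (κ w ⊕ step (first (h l) d))         ≡⟨ σ-odd t l (κ w ⊕ step (first (h l) d)) (π-middle w (first (h l) d)) ⟩
    c l Sign.* τ (κ w ⊕ step (first (h l) d))  ≡⟨ cong (c l Sign.*_) (τ-middle w (first (h l) d)) ⟩
    c l Sign.* (π w Sign.* hor (first (h l) d)) ≡⟨ Signₚ.*-assoc (c l) (π w) (hor (first (h l) d)) ⟨
    (c l Sign.* π w) Sign.* hor (first (h l) d) ≡⟨ cong₂ Sign._*_ (sym (trans v (cong (Sign._* π w) (h-up l)))) (hor-first (h l) d) ⟩
    hor d Sign.* h l ∎
    where open ≡-Reasoning

  nxt-child₁ : ∀ l s → Valid (up l) s → nxt l (child₁ l s) ≡ child₂ l s
  nxt-child₁ l (seg w d) v = cong (seg _) (trans (cong (λ a → i^ a ∙ first (h l) d) (σ-middle l w d v)) (turn-first (h l) d))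

  finish-child₂ : ∀ l s → finish (child₂ l s) ≡ κ (finish s)
  finish-child₂ l (seg w d) =
    trans (⊕-assoc (κ w) (step (first (h l) d)) (step (second (h l) d))) (trans (cong (κ w ⊕_) (first+second (h l) d)) (sym (κ-⊕ w (step d))))

  nxt-child₂ : ∀ l s → nxt l (child₂ l s) ≡ child₁ l (nxt (up l) s)
  nxt-child₂ l s@(seg w d) =
    trans (cong (λ y → seg y (i^ (σ t l y) ∙ second (h l) d)) (finish-child₂ l s))
      (cong (seg (κ (finish s))) (trans (cong (λ a → i^ a ∙ second (h l) d) (σ-κ t l (finish s)))
        (turn-second (σ t (up l) (finish s)) (h l) d)))

  valid-T : ∀ l s → Valid (up l) (T l s)
  valid-T l (seg z e) = go (π z)
    where
    picked : ∀ w → Valid (up l) (seg w (pick (c l Sign.* π w) e))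
    picked w = trans (hor-pick (c l Sign.* π w) e) (cong (Sign._* π w) (sym (h-up l)))
    go : ∀ a → Valid (up l) (T-at l (seg z e) a)
    go Sign.+ = picked (half z)
    go Sign.- = picked (half (z ⊖ step (i^ (opposite (c l Sign.* τ z)) ∙ e)))

  child-T : ∀ l s → Valid l s → child l (π (start s)) (T l s) ≡ s
  child-T l (seg z e) v with π z in p
  ... | Sign.+ = cong₂ seg (κ-half z p) (trans (cong (λ a → first a (pick r e)) (sym h≡)) (first-pick r e))
    where
    r = c l Sign.* π (half z)
    h≡ : hor e ≡ h l
    h≡ = trans v (Signₚ.*-identityʳ (h l))
  ... | Sign.- = cong₂ seg (trans (cong₂ (λ y u → y ⊕ step u) κw≡ first≡) (⊖-⊕ z (step e′)))
      (trans (cong (λ a → second a (pick r e)) h≡) (second-pick r e))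
    where
    open ≡-Reasoning
    e′ = i^ (opposite (c l Sign.* τ z)) ∙ e
    w  = half (z ⊖ step e′)
    r  = c l Sign.* π w
    κw≡ : κ w ≡ z ⊖ step e′
    κw≡ = κ-half (z ⊖ step e′) (trans (π-⊖step z e′) (cong opposite p))
    h≡ : h l ≡ opposite (hor e)
    h≡ = trans (sym (opp-invol (h l))) (cong opposite (sym (trans v (Signₚ.*-comm (h l) Sign.-))))
    τz≡ : τ z ≡ π w Sign.* opposite (hor e)
    τz≡ = begin
      τ z                           ≡⟨ cong τ (trans (cong (_⊕ step e′) κw≡) (⊖-⊕ z (step e′))) ⟨
      τ (κ w ⊕ step e′)             ≡⟨ τ-middle w e′ ⟩
      π w Sign.* hor e′             ≡⟨ cong (π w Sign.*_) (hor-turn (opposite (c l Sign.* τ z)) e) ⟩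
      π w Sign.* opposite (hor e)   ∎
    first≡ : first (h l) (pick r e) ≡ e′
    first≡ = begin
      first (h l) (pick r e)                    ≡⟨ cong (λ a → first a (pick r e)) h≡ ⟩
      first (opposite (hor e)) (pick r e)       ≡⟨ first-pick′ r e ⟩
      i^ (opposite (r Sign.* opposite (hor e))) ∙ e
        ≡⟨ cong (λ a → i^ (opposite a) ∙ e) (trans (Signₚ.*-assoc (c l) (π w) (opposite (hor e))) (cong (c l Sign.*_) (sym τz≡))) ⟩
      e′ ∎

  valid-π : ∀ l w d → Valid (up l) (seg w d) → c l Sign.* π w ≡ hor d
  valid-π l w d v = sym (trans v (cong (Sign._* π w) (h-up l)))

  T-child₁ : ∀ l s → Valid (up l) s → T l (child₁ l s) ≡ s
  T-child₁ l (seg w d) v = trans (cong (T-at l (child₁ l (seg w d))) (π-κ w))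
    (cong₂ seg (half-κ w) (trans (cong (λ a → pick a (first (h l) d))
       (trans (cong (λ y → c l Sign.* π y) (half-κ w)) (valid-π l w d v))) (pick-first (h l) d)))

  T-child₂ : ∀ l s → Valid (up l) s → T l (child₂ l s) ≡ s
  T-child₂ l (seg w d) v = trans (cong (T-at l (child₂ l (seg w d))) (π-middle w (first (h l) d)))
    (cong₂ seg w≡ (trans (cong (λ a → pick a (second (h l) d))
       (trans (cong (λ y → c l Sign.* π y) w≡) (valid-π l w d v))) (pick-second (h l) d)))
    where
    z = κ w ⊕ step (first (h l) d)
    e≡ : i^ (opposite (c l Sign.* τ z)) ∙ second (h l) d ≡ first (h l) d
    e≡ = trans (cong (λ a → i^ (opposite a) ∙ second (h l) d) (trans (sym (σ-odd t l z (π-middle w (first (h l) d)))) (σ-middle l w d v)))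
      (trans (cong (i^ (opposite (hor d Sign.* h l)) ∙_) (sym (turn-first (h l) d))) (unturn (hor d Sign.* h l) (first (h l) d)))
    w≡ : half (z ⊖ step (i^ (opposite (c l Sign.* τ z)) ∙ second (h l) d)) ≡ w
    w≡ = trans (cong (λ u → half (z ⊖ step u)) e≡) (trans (cong half (⊕-⊖ (κ w) (step (first (h l) d)))) (half-κ w))

  data View (l : Level) : Segment → Set where
    is-child₁ : ∀ s → Valid (up l) s → View l (child₁ l s)
    is-child₂ : ∀ s → Valid (up l) s → View l (child₂ l s)

  view : ∀ l s → Valid l s → View l s
  view l s v = subst (View l) (child-T l s v) (go (π (start s)))
    where
    go : ∀ a → View l (child l a (T l s))
    go Sign.+ = is-child₁ (T l s) (valid-T l s)
    go Sign.- = is-child₂ (T l s) (valid-T l s)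

  -- Two steps lead from a segment to the one in the same place of the following pair, so `T` turns
  -- them into one step.
  T-nxt-nxt : ∀ l s → Valid l s → T l (nxt l (nxt l s)) ≡ nxt (up l) (T l s)
  T-nxt-nxt l s v with view l s v
  ... | is-child₁ s′ v′ = begin
    T l (nxt l (nxt l (child₁ l s′))) ≡⟨ cong (λ y → T l (nxt l y)) (nxt-child₁ l s′ v′) ⟩
    T l (nxt l (child₂ l s′))         ≡⟨ cong (T l) (nxt-child₂ l s′) ⟩
    T l (child₁ l (nxt (up l) s′))    ≡⟨ T-child₁ l (nxt (up l) s′) (valid-nxt (up l) s′ v′) ⟩
    nxt (up l) s′                     ≡⟨ cong (nxt (up l)) (T-child₁ l s′ v′) ⟨
    nxt (up l) (T l (child₁ l s′))    ∎
    where open ≡-Reasoning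
  ... | is-child₂ s′ v′ = begin
    T l (nxt l (nxt l (child₂ l s′)))        ≡⟨ cong (λ y → T l (nxt l y)) (nxt-child₂ l s′) ⟩
    T l (nxt l (child₁ l (nxt (up l) s′)))   ≡⟨ cong (T l) (nxt-child₁ l (nxt (up l) s′) (valid-nxt (up l) s′ v′)) ⟩
    T l (child₂ l (nxt (up l) s′))           ≡⟨ T-child₂ l (nxt (up l) s′) (valid-nxt (up l) s′ v′) ⟩
    nxt (up l) s′                            ≡⟨ cong (nxt (up l)) (T-child₂ l s′ v′) ⟨
    nxt (up l) (T l (child₂ l s′))           ∎
    where open ≡-Reasoning

  T-nxt : ∀ l s → Valid l s → T l (nxt l s) ≡ T l s ⊎ T l (nxt l s) ≡ nxt (up l) (T l s)
  T-nxt l s v with view l s v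
  ... | is-child₁ s′ v′ = inj₁ (trans (cong (T l) (nxt-child₁ l s′ v′)) (trans (T-child₂ l s′ v′) (sym (T-child₁ l s′ v′))))
  ... | is-child₂ s′ v′ = inj₂ (trans (cong (T l) (nxt-child₂ l s′)) (trans (T-child₁ l (nxt (up l) s′) (valid-nxt (up l) s′ v′))
    (cong (nxt (up l)) (sym (T-child₂ l s′ v′)))))

  T-siblings : ∀ l s s′ → Valid l s → Valid l s′ → T l s ≡ T l s′ → s ≡ s′ ⊎ nxt l s ≡ s′ ⊎ nxt l s′ ≡ s
  T-siblings l s s′ v v′ eq with view l s v | view l s′ v′
  ... | is-child₁ r u | is-child₁ r′ u′ = inj₁ (cong (child₁ l) (trans (sym (T-child₁ l r u)) (trans eq (T-child₁ l r′ u′))))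
  ... | is-child₂ r u | is-child₂ r′ u′ = inj₁ (cong (child₂ l) (trans (sym (T-child₂ l r u)) (trans eq (T-child₂ l r′ u′))))
  ... | is-child₁ r u | is-child₂ r′ u′ = inj₂ (inj₁ (trans (nxt-child₁ l r u) (cong (child₂ l) (trans (sym (T-child₁ l r u)) (trans eq (T-child₂ l r′ u′))))))
  ... | is-child₂ r u | is-child₁ r′ u′ = inj₂ (inj₂ (trans (nxt-child₁ l r′ u′) (cong (child₂ l) (trans (sym (T-child₁ l r′ u′)) (trans (sym eq) (T-child₂ l r u))))))

-- Orbits and seeds

ℤ-induction : (P : ℤ → Set) → P 0ℤ → (∀ k → P k → P (ℤ.suc k)) → (∀ k → P (ℤ.suc k) → P k) → ∀ k → P k
ℤ-induction P p₀ P-suc P-pred = go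
  where
  go : ∀ k → P k
  go (+ zero)     = p₀
  go (+ suc n)    = P-suc (+ n) (go (+ n))
  go -[1+ zero ]  = P-pred -[1+ zero ] p₀
  go -[1+ suc n ] = P-pred -[1+ suc n ] (go -[1+ n ])

halve : ∀ n → ∃[ k ] (n ≡ k ℕ.+ k ⊎ n ≡ suc (k ℕ.+ k))
halve zero = 0 , inj₁ refl
halve (suc n) with halve n
... | k , inj₁ eq = k , inj₂ (cong suc eq)
... | k , inj₂ eq = suc k , inj₁ (trans (cong suc eq) (cong suc (sym (ℕₚ.+-suc k k))))

-- 3 |κ w - u|² + 6 |u|² = 4 |w|² + |κ w - 3u|²
parallelogram : ∀ w u → 4 ℕ.* N w ℕ.≤ 3 ℕ.* N (κ w ⊖ u) ℕ.+ 6 ℕ.* N u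
parallelogram w@(a , b) u@(x , y) = subst (4 ℕ.* N w ℕ.≤_) (ℤₚ.+-injective (begin
    + (4 ℕ.* N w ℕ.+ N rest)                           ≡⟨ ℤₚ.pos-+ (4 ℕ.* N w) (N rest) ⟩
    + (4 ℕ.* N w) ℤ.+ + N rest                         ≡⟨ cong₂ ℤ._+_ (*sq 4 w) (+N rest) ⟩
    + 4 ℤ.* sq w ℤ.+ sq rest                           ≡⟨ identity a b x y ⟩
    + 3 ℤ.* sq (κ w ⊖ u) ℤ.+ + 6 ℤ.* sq u              ≡⟨ cong₂ ℤ._+_ (*sq 3 (κ w ⊖ u)) (*sq 6 u) ⟨
    + (3 ℕ.* N (κ w ⊖ u)) ℤ.+ + (6 ℕ.* N u)            ≡⟨ ℤₚ.pos-+ (3 ℕ.* N (κ w ⊖ u)) (6 ℕ.* N u) ⟨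
    + (3 ℕ.* N (κ w ⊖ u) ℕ.+ 6 ℕ.* N u)                ∎))
  (ℕₚ.m≤m+n (4 ℕ.* N w) (N rest))
  where
  open ≡-Reasoning
  rest : ℤ[i]
  rest = κ w ⊖ (+ 3 ⊛ u)
  *sq : ∀ n z → + (n ℕ.* N z) ≡ + n ℤ.* sq z
  *sq n z = trans (ℤₚ.pos-* n (N z)) (cong (+ n ℤ.*_) (+N z))
  identity : ∀ a b x y →
    + 4 ℤ.* (a ℤ.* a ℤ.+ b ℤ.* b) ℤ.+
      ((a ℤ.- b ℤ.- + 3 ℤ.* x) ℤ.* (a ℤ.- b ℤ.- + 3 ℤ.* x) ℤ.+ (b ℤ.+ a ℤ.- + 3 ℤ.* y) ℤ.* (b ℤ.+ a ℤ.- + 3 ℤ.* y)) ≡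
    + 3 ℤ.* ((a ℤ.- b ℤ.- x) ℤ.* (a ℤ.- b ℤ.- x) ℤ.+ (b ℤ.+ a ℤ.- y) ℤ.* (b ℤ.+ a ℤ.- y)) ℤ.+ + 6 ℤ.* (x ℤ.* x ℤ.+ y ℤ.* y)
  identity = solve-∀

module Dynamics (t : Sign) (j : ℤ) where
  open Substitution t j public

  stepN : ℕ
  stepN = N (step one)

  N-step : ∀ u → N (step u) ≡ stepN
  N-step u = ℤₚ.+-injective (trans (+N (step u)) (trans (l u) (sym (+N (step one)))))
    where
    l₁ : ∀ m → m ℤ.* 0ℤ ℤ.* (m ℤ.* 0ℤ) ℤ.+ m ℤ.* 1ℤ ℤ.* (m ℤ.* 1ℤ) ≡ m ℤ.* 1ℤ ℤ.* (m ℤ.* 1ℤ) ℤ.+ m ℤ.* 0ℤ ℤ.* (m ℤ.* 0ℤ)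
    l₁ = solve-∀
    l₂ : ∀ m → m ℤ.* -1ℤ ℤ.* (m ℤ.* -1ℤ) ℤ.+ m ℤ.* 0ℤ ℤ.* (m ℤ.* 0ℤ) ≡ m ℤ.* 1ℤ ℤ.* (m ℤ.* 1ℤ) ℤ.+ m ℤ.* 0ℤ ℤ.* (m ℤ.* 0ℤ)
    l₂ = solve-∀
    l₃ : ∀ m → m ℤ.* 0ℤ ℤ.* (m ℤ.* 0ℤ) ℤ.+ m ℤ.* -1ℤ ℤ.* (m ℤ.* -1ℤ) ≡ m ℤ.* 1ℤ ℤ.* (m ℤ.* 1ℤ) ℤ.+ m ℤ.* 0ℤ ℤ.* (m ℤ.* 0ℤ)
    l₃ = solve-∀
    l : ∀ u → sq (step u) ≡ sq (step one)
    l = ∀-unit refl (l₁ (odd j)) (l₂ (odd j)) (l₃ (odd j))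

  -- Twice the midpoint.
  mid : Segment → ℤ[i]
  mid (seg z e) = (z ⊕ z) ⊕ step e

  step-opp : ∀ z e → (z ⊕ step e) ⊕ step (-one ∙ e) ≡ z
  step-opp z@(a , b) = ∀-unit (pair (l₁ a (odd j)) (l₀ b (odd j))) (pair (l₀ a (odd j)) (l₁ b (odd j)))
      (pair (l₂ a (odd j)) (l₀ b (odd j))) (pair (l₀ a (odd j)) (l₂ b (odd j)))
    where
    l₀ : ∀ a m → (a ℤ.+ m ℤ.* 0ℤ) ℤ.+ m ℤ.* 0ℤ ≡ a
    l₀ = solve-∀
    l₁ : ∀ a m → (a ℤ.+ m ℤ.* 1ℤ) ℤ.+ m ℤ.* -1ℤ ≡ a
    l₁ = solve-∀
    l₂ : ∀ a m → (a ℤ.+ m ℤ.* -1ℤ) ℤ.+ m ℤ.* 1ℤ ≡ a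
    l₂ = solve-∀

  κ-mid : ∀ w d → κ (mid (seg w d)) ≡ (κ w ⊕ κ w) ⊕ κ (step d)
  κ-mid w d = trans (κ-⊕ (w ⊕ w) (step d)) (cong (_⊕ κ (step d)) (κ-⊕ w w))

  -- The midpoint of the sum of a pair differs from the midpoint of either segment by half of the
  -- other one; as `mid` is doubled, the difference is a full step.
  mid-T : ∀ l s → Valid l s → ∃[ u ] κ (mid (T l s)) ≡ mid s ⊕ step u
  mid-T l s v with view l s v
  ... | is-child₁ s′@(seg w d) v′ = second (h l) d , (begin
      κ (mid (T l (child₁ l s′)))                      ≡⟨ cong (λ r → κ (mid r)) (T-child₁ l s′ v′) ⟩
      κ (mid s′)                                       ≡⟨ κ-mid w d ⟩
      (κ w ⊕ κ w) ⊕ κ (step d)                         ≡⟨ cong ((κ w ⊕ κ w) ⊕_) (first+second (h l) d) ⟨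
      (κ w ⊕ κ w) ⊕ (step (first (h l) d) ⊕ step (second (h l) d)) ≡⟨ ⊕-assoc (κ w ⊕ κ w) (step (first (h l) d)) (step (second (h l) d)) ⟨
      mid (child₁ l s′) ⊕ step (second (h l) d)        ∎)
    where open ≡-Reasoning
  ... | is-child₂ s′@(seg w d) v′ = -one ∙ f , (begin
      κ (mid (T l (child₂ l s′)))                        ≡⟨ cong (λ r → κ (mid r)) (T-child₂ l s′ v′) ⟩
      κ (mid s′)                                         ≡⟨ step-opp (κ (mid s′)) f ⟨
      (κ (mid s′) ⊕ F) ⊕ step (-one ∙ f)                 ≡⟨ cong (λ y → (y ⊕ F) ⊕ step (-one ∙ f)) (κ-mid w d) ⟩
      (((W ⊕ W) ⊕ κ (step d)) ⊕ F) ⊕ step (-one ∙ f)     ≡⟨ cong (λ y → (((W ⊕ W) ⊕ y) ⊕ F) ⊕ step (-one ∙ f)) (first+second (h l) d) ⟨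
      (((W ⊕ W) ⊕ (F ⊕ S)) ⊕ F) ⊕ step (-one ∙ f)        ≡⟨ cong (_⊕ step (-one ∙ f)) (shuffle W F S) ⟩
      mid (child₂ l s′) ⊕ step (-one ∙ f)                ∎)
    where
    open ≡-Reasoning
    f = first (h l) d
    W = κ w
    F = step f
    S = step (second (h l) d)
    l₁ : ∀ a b d → ((a ℤ.+ a) ℤ.+ (b ℤ.+ d)) ℤ.+ b ≡ ((a ℤ.+ b) ℤ.+ (a ℤ.+ b)) ℤ.+ d
    l₁ = solve-∀
    shuffle : ∀ W F S → ((W ⊕ W) ⊕ (F ⊕ S)) ⊕ F ≡ ((W ⊕ F) ⊕ (W ⊕ F)) ⊕ S
    shuffle (a , b) (x , y) (p , q) = pair (l₁ a x p) (l₁ b y q)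

  -- By `mid-T`, `parallelogram` applies with κ w - u = `mid s`. It bounds the new norm by 3/4 of
  -- the old one plus 6/4 of `stepN`, which is less than the old one above the threshold.
  T-contracts : ∀ l s → Valid l s → 6 ℕ.* stepN ℕ.< N (mid s) → N (mid (T l s)) ℕ.< N (mid s)
  T-contracts l s v big with u , eq ← mid-T l s v = ℕₚ.*-cancelˡ-< 4 _ _ (begin-strict
      4 ℕ.* N (mid (T l s))                     ≤⟨ parallelogram (mid (T l s)) (step u) ⟩
      3 ℕ.* N (κ (mid (T l s)) ⊖ step u) ℕ.+ 6 ℕ.* N (step u)
        ≡⟨ cong₂ (λ a b → 3 ℕ.* N a ℕ.+ 6 ℕ.* b) (trans (cong (_⊖ step u) eq) (⊕-⊖ (mid s) (step u))) (N-step u) ⟩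
      3 ℕ.* N (mid s) ℕ.+ 6 ℕ.* stepN           <⟨ ℕₚ.+-monoʳ-< (3 ℕ.* N (mid s)) big ⟩
      3 ℕ.* N (mid s) ℕ.+ N (mid s)             ≡⟨ ℕₚ.+-comm (3 ℕ.* N (mid s)) (N (mid s)) ⟩
      4 ℕ.* N (mid s)                           ∎)
    where open ℕₚ.≤-Reasoning

  record Orbit (l : Level) (γ : ℤ → Segment) : Set where
    field
      valid     : ∀ k → Valid l (γ k)
      connected : ∀ k → γ (ℤ.suc k) ≡ nxt l (γ k)
  open Orbit public

  parent : Level → (ℤ → Segment) → ℤ → Segment
  parent l γ k = T l (γ (k ℤ.+ k))

  suc-double : ∀ k → ℤ.suc k ℤ.+ ℤ.suc k ≡ ℤ.suc (ℤ.suc (k ℤ.+ k))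
  suc-double = l
    where
    l : ∀ k → (1ℤ ℤ.+ k) ℤ.+ (1ℤ ℤ.+ k) ≡ 1ℤ ℤ.+ (1ℤ ℤ.+ (k ℤ.+ k))
    l = solve-∀

  parent-orbit : ∀ {l γ} → Orbit l γ → Orbit (up l) (parent l γ)
  parent-orbit {l} {γ} o .valid k = valid-T l (γ (k ℤ.+ k))
  parent-orbit {l} {γ} o .connected k = begin
    T l (γ (ℤ.suc k ℤ.+ ℤ.suc k))           ≡⟨ cong (λ m → T l (γ m)) (suc-double k) ⟩
    T l (γ (ℤ.suc (ℤ.suc (k ℤ.+ k))))       ≡⟨ cong (T l) (o .connected _) ⟩
    T l (nxt l (γ (ℤ.suc (k ℤ.+ k))))       ≡⟨ cong (λ s → T l (nxt l s)) (o .connected _) ⟩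
    T l (nxt l (nxt l (γ (k ℤ.+ k))))       ≡⟨ T-nxt-nxt l (γ (k ℤ.+ k)) (o .valid _) ⟩
    nxt (up l) (T l (γ (k ℤ.+ k)))          ∎
    where open ≡-Reasoning

  nxt^ : Level → ℕ → Segment → Segment
  nxt^ l zero    s = s
  nxt^ l (suc n) s = nxt l (nxt^ l n s)

  valid-nxt^ : ∀ l n s → Valid l s → Valid l (nxt^ l n s)
  valid-nxt^ l zero    s v = v
  valid-nxt^ l (suc n) s v = valid-nxt l (nxt^ l n s) (valid-nxt^ l n s v)

  T-nxt^ : ∀ l n s → Valid l s → T l (nxt^ l (n ℕ.+ n) s) ≡ nxt^ (up l) n (T l s)
  T-nxt^ l zero    s v = refl
  T-nxt^ l (suc n) s v rewrite ℕₚ.+-suc n n =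
    trans (T-nxt-nxt l (nxt^ l (n ℕ.+ n) s) (valid-nxt^ l (n ℕ.+ n) s v)) (cong (nxt (up l)) (T-nxt^ l n s v))

  module Seeds {n : ℕ} (seed : Level → Fin n → Segment)
    (valid-seed : ∀ l a → Valid l (seed l a))
    (T-seed : ∀ l a → T l (seed l a) ≡ seed (up l) a) where

    -- `T` sends seeds to seeds and roughly halves the number of steps between them: 2k steps become
    -- k, and 2k + 1 become k or k + 1. A positive distance would therefore shrink to 1, which is
    -- excluded. The case a = b shows that no curve closes up.
    separated : (∀ l a b → nxt l (seed l a) ≢ seed l b) →
      ∀ m l a b → nxt^ l m (seed l a) ≡ seed l b → m ≡ 0
    separated not-adjacent m l a b = go m m l a b ℕₚ.≤-refl
      where
      T-iterate : ∀ l k a → T l (nxt^ l (k ℕ.+ k) (seed l a)) ≡ nxt^ (up l) k (seed (up l) a)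
      T-iterate l k a = trans (T-nxt^ l k (seed l a) (valid-seed l a)) (cong (nxt^ (up l) k) (T-seed l a))
      T-reach : ∀ l {m} a b r → m ≡ r → nxt^ l m (seed l a) ≡ seed l b → T l (nxt^ l r (seed l a)) ≡ seed (up l) b
      T-reach l a b r m≡r eq = trans (cong (T l) (trans (cong (λ q → nxt^ l q (seed l a)) (sym m≡r)) eq)) (T-seed l b)
      go : ∀ fuel m l a b → m ℕ.≤ fuel → nxt^ l m (seed l a) ≡ seed l b → m ≡ 0
      go fuel 0 l a b _ eq = refl
      go fuel 1 l a b _ eq = ⊥-elim (not-adjacent l a b eq)
      go (suc fuel) m@(suc (suc _)) l a b (ℕ.s≤s m≤) eq with halve m
      ... | zero , inj₂ ()
      ... | suc k , inj₁ m≡ with () ← go fuel (suc k) (up l) a b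
            (ℕₚ.≤-trans (ℕₚ.≤-trans (ℕₚ.m≤n+m (suc k) k) (ℕₚ.≤-reflexive (sym (ℕₚ.suc-injective m≡)))) m≤)
            (trans (sym (T-iterate l (suc k) a)) (T-reach l a b (suc k ℕ.+ suc k) m≡ eq))
      ... | suc k , inj₂ m≡ = ⊥-elim (odd-case (T-nxt l (nxt^ l (suc k ℕ.+ suc k) (seed l a))
            (valid-nxt^ l (suc k ℕ.+ suc k) (seed l a) (valid-seed l a))))
        where
        k< : suc (suc k) ℕ.≤ fuel
        k< = ℕₚ.≤-trans (ℕ.s≤s (ℕₚ.m≤n+m (suc k) k)) (ℕₚ.≤-trans (ℕₚ.≤-reflexive (sym (ℕₚ.suc-injective m≡))) m≤)
        reach = T-reach l a b (suc (suc k ℕ.+ suc k)) m≡ eq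
        odd-case : T l (nxt^ l (suc (suc k ℕ.+ suc k)) (seed l a)) ≡ T l (nxt^ l (suc k ℕ.+ suc k) (seed l a)) ⊎
          T l (nxt^ l (suc (suc k ℕ.+ suc k)) (seed l a)) ≡ nxt (up l) (T l (nxt^ l (suc k ℕ.+ suc k) (seed l a))) → ⊥
        odd-case (inj₁ same) with () ← go fuel (suc k) (up l) a b (ℕₚ.<⇒≤ k<)
          (trans (sym (T-iterate l (suc k) a)) (trans (sym same) reach))
        odd-case (inj₂ succ) with () ← go fuel (suc (suc k)) (up l) a b k<
          (trans (cong (nxt (up l)) (sym (T-iterate l (suc k) a))) (trans (sym succ) reach))

    -- The quantification over all orbits through the seed allows the statement to be applied to
    -- `parent` of an orbit, one level up.
    Connected : Level → Segment → Set
    Connected l s = ∃[ a ] ∀ {γ} → Orbit l γ → γ 0ℤ ≡ seed l a → ∃[ k ] γ k ≡ s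

    -- If the parent orbit passes through `T l s` at index k, then `γ (k + k)` and s have the same
    -- image under `T`, so they are equal or adjacent, by `T-siblings`.
    Connected-T : ∀ l s → Valid l s → Connected (up l) (T l s) → Connected l s
    Connected-T l s v (a , f) = a , λ {γ} o γ0≡ →
      let k , eq = f (parent-orbit o) (trans (cong (T l) γ0≡) (T-seed l a))
      in close {γ} o (k ℤ.+ k) (T-siblings l (γ (k ℤ.+ k)) s (o .valid _) v eq)
      where
      close : ∀ {γ} → Orbit l γ → ∀ m → γ m ≡ s ⊎ nxt l (γ m) ≡ s ⊎ nxt l s ≡ γ m → ∃[ k ] γ k ≡ s
      close o m (inj₁ eq) = m , eq
      close o m (inj₂ (inj₁ eq)) = ℤ.suc m , trans (o .connected m) eq
      close {γ} o m (inj₂ (inj₂ eq)) = ℤ.pred m , nxt-injective l (trans (sym (o .connected (ℤ.pred m)))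
        (trans (cong γ (ℤₚ.suc-pred m)) (sym eq)))

    -- The second alternative catches the segments ending at 0 when the seeds are `seed₁`: their
    -- images under `T` end at 0 again, hence never become segments starting there.
    Near : Level → Segment → Set
    Near l s = ∃[ a ] (s ≡ seed l a ⊎ nxt l s ≡ seed l a)

    Hits : ℕ → Level → Segment → Set
    Hits zero    l s = Near l s
    Hits (suc r) l s = Near l s ⊎ Hits r (up l) (T l s)

    Near⇒Connected : ∀ l s → Near l s → Connected l s
    Near⇒Connected l s (a , inj₁ eq) = a , λ o γ0≡ → 0ℤ , trans γ0≡ (sym eq)
    Near⇒Connected l s (a , inj₂ eq) = a , λ o γ0≡ → -1ℤ , nxt-injective l (trans (sym (o .connected -1ℤ)) (trans γ0≡ (sym eq)))

    Hits⇒Connected : ∀ r l s → Valid l s → Hits r l s → Connected l s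
    Hits⇒Connected zero    l s v near        = Near⇒Connected l s near
    Hits⇒Connected (suc r) l s v (inj₁ near) = Near⇒Connected l s near
    Hits⇒Connected (suc r) l s v (inj₂ hits) =
      Connected-T l s v (Hits⇒Connected r (up l) (T l s) (valid-T l s) hits)

    -- Descent on `N (mid s)`: `T-contracts` drives every segment into a bounded region, where
    -- finitely many checks remain.
    connected-all : (Coset : Level → ℤ[i] → Set) →
      (∀ l s → Valid l s → Coset l (start s) → Coset (up l) (start (T l s))) →
      ∀ r → (∀ l s → N (mid s) ℕ.≤ 6 ℕ.* stepN → Valid l s → Coset l (start s) → Hits r l s) →
      ∀ l s → Valid l s → Coset l (start s) → Connected l s
    connected-all Coset Coset-T r hits l s = go (N (mid s)) l s ℕₚ.≤-refl
      where
      go : ∀ fuel l s → N (mid s) ℕ.≤ fuel → Valid l s → Coset l (start s) → Connected l s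
      go fuel l s N≤ v co with N (mid s) ℕₚ.≤? 6 ℕ.* stepN
      ... | yes small = Hits⇒Connected r l s v (hits l s small v co)
      go zero l s N≤ v co | no big = ⊥-elim (big (ℕₚ.≤-trans N≤ ℕ.z≤n))
      go (suc fuel) l s N≤ v co | no big = Connected-T l s v
        (go fuel (up l) (T l s) (ℕ.s≤s⁻¹ (ℕₚ.≤-trans (T-contracts l s v (ℕₚ.≰⇒> big)) N≤)) (valid-T l s) (Coset-T l s v co))

-- Finite verifications

index : Unit → ℕ
index one  = 0
index i    = 1
index -one = 2
index -i   = 3

index-injective : ∀ e e′ → index e ≡ index e′ → e ≡ e′
index-injective one  one  _ = refl
index-injective i    i    _ = refl
index-injective -one -one _ = refl
index-injective -i   -i   _ = refl

_≟ᵘ_ : DecidableEquality Unit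
e ≟ᵘ e′ = map′ (index-injective e e′) (cong index) (index e ℕₚ.≟ index e′)

_≟ᵖ_ : DecidableEquality ℤ[i]
_≟ᵖ_ = ×-≡-dec ℤₚ._≟_ ℤₚ._≟_

_≟ˢ_ : DecidableEquality Segment
seg z e ≟ˢ seg z′ e′ = map′ (λ (p , q) → cong₂ seg p q) (λ eq → cong start eq , cong dir eq) (z ≟ᵖ z′ ×-dec e ≟ᵘ e′)

∀-unit? : {P : Unit → Set} → Decidable P → Dec (∀ e → P e)
∀-unit? P? = map′ (λ (p , q , r , s) → ∀-unit p q r s) (λ f → f one , f i , f -one , f -i)
  (P? one ×-dec P? i ×-dec P? -one ×-dec P? -i)

∀-phase : {P : Phase → Set} → P p0 → P p1 → P p2 → P p3 → ∀ p → P p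
∀-phase p q r s p0 = p
∀-phase p q r s p1 = q
∀-phase p q r s p2 = r
∀-phase p q r s p3 = s

∀-level? : {P : Level → Set} → Decidable P → Dec (∀ l → P l)
∀-level? P? = map′ (λ f l → f (proj₂ l) (proj₁ l)) (λ f g p → f (p , g)) (∀-unit? λ g →
  map′ (λ (p , q , r , s) → ∀-phase p q r s) (λ f → f p0 , f p1 , f p2 , f p3)
    (P? (p0 , g) ×-dec P? (p1 , g) ×-dec P? (p2 , g) ×-dec P? (p3 , g)))

∀-bounded? : {P : ℤ → Set} → ∀ n → Decidable P → Dec (∀ x → ∣ x ∣ ℕ.≤ n → P x)
∀-bounded? {P} zero P? = map′ (λ { p (+ zero) _ → p }) (λ f → f 0ℤ ℕ.z≤n) (P? 0ℤ)
∀-bounded? {P} (suc n) P? = map′ from to (P? (+ suc n) ×-dec P? -[1+ n ] ×-dec ∀-bounded? n P?)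
  where
  to : (∀ x → ∣ x ∣ ℕ.≤ suc n → P x) → P (+ suc n) × P -[1+ n ] × (∀ x → ∣ x ∣ ℕ.≤ n → P x)
  to f = f (+ suc n) ℕₚ.≤-refl , f -[1+ n ] ℕₚ.≤-refl , λ x x≤ → f x (ℕₚ.m≤n⇒m≤1+n x≤)
  from : P (+ suc n) × P -[1+ n ] × (∀ x → ∣ x ∣ ℕ.≤ n → P x) → ∀ x → ∣ x ∣ ℕ.≤ suc n → P x
  from (p , q , f) x x≤ with ℕₚ.m≤n⇒m<n∨m≡n x≤
  from (p , q , f) x x≤ | inj₁ x< = f x (ℕ.s≤s⁻¹ x<)
  from (p , q , f) (+ _) x≤ | inj₂ refl = p
  from (p , q , f) -[1+ _ ] x≤ | inj₂ refl = q

valid? : ∀ l s → Dec (Valid l s)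
valid? l s = hor (dir s) Signₚ.≟ (h l Sign.* π (start s))

root-bound : ∀ b x → ¬ (suc b ℕ.* suc b ℕ.≤ x ℕ.* x) → x ℕ.≤ b
root-bound b x f with x ℕₚ.≤? b
... | yes x≤b = x≤b
... | no x≰b = ⊥-elim (f (ℕₚ.*-mono-≤ (ℕₚ.≰⇒> x≰b) (ℕₚ.≰⇒> x≰b)))

half-bound : ∀ b x → x ℕ.+ x ℕ.≤ suc (b ℕ.+ b) → x ℕ.≤ b
half-bound b x x≤ with x ℕₚ.≤? b
... | yes x≤b = x≤b
... | no x≰b = ⊥-elim (ℕₚ.<⇒≱ (ℕₚ.≤-reflexive (cong suc (sym (ℕₚ.+-suc b b)))) (ℕₚ.≤-trans (ℕₚ.+-mono-≤ (ℕₚ.≰⇒> x≰b) (ℕₚ.≰⇒> x≰b)) x≤))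

∣x+x∣ : ∀ x → ∣ x ℤ.+ x ∣ ≡ ∣ x ∣ ℕ.+ ∣ x ∣
∣x+x∣ (+ n)    = refl
∣x+x∣ -[1+ n ] = cong suc (sym (ℕₚ.+-suc n n))

∣x∣-bound : ∀ x y → ∣ x ∣ ℕ.+ ∣ x ∣ ℕ.≤ ∣ (x ℤ.+ x) ℤ.+ y ∣ ℕ.+ ∣ y ∣
∣x∣-bound x y = subst (ℕ._≤ ∣ (x ℤ.+ x) ℤ.+ y ∣ ℕ.+ ∣ y ∣) (trans (cong ∣_∣ (l x y)) (∣x+x∣ x)) (ℤₚ.∣i-j∣≤∣i∣+∣j∣ ((x ℤ.+ x) ℤ.+ y) y)
  where
  l : ∀ x y → ((x ℤ.+ x) ℤ.+ y) ℤ.- y ≡ x ℤ.+ x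
  l = solve-∀

module Region (t : Sign) (j : ℤ) where
  open Dynamics t j

  -- Each coordinate of `mid s`, of the form 2x + y with y at most `∣ odd j ∣` in absolute value,
  -- has absolute value at most b. Hence 2∣x∣ ≤ b + ∣ odd j ∣ ≤ 2r + 1.
  region-bound : ∀ b r → 6 ℕ.* stepN ℕ.< suc b ℕ.* suc b → b ℕ.+ ∣ odd j ∣ ℕ.≤ suc (r ℕ.+ r) →
    ∀ s → N (mid s) ℕ.≤ 6 ℕ.* stepN → ∣ proj₁ (start s) ∣ ℕ.≤ r × ∣ proj₂ (start s) ∣ ℕ.≤ r
  region-bound b r b< r≥ (seg (x , y) e) N≤ =
    coordinate x _ (unit-bound (proj₁ ⟦ e ⟧) (∀-unit {λ e → ∣ proj₁ ⟦ e ⟧ ∣ ℕ.≤ 1} ℕₚ.≤-refl ℕ.z≤n ℕₚ.≤-refl ℕ.z≤n e)) (ℕₚ.≤-trans (ℕₚ.m≤m+n _ _) N≤) ,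
    coordinate y _ (unit-bound (proj₂ ⟦ e ⟧) (∀-unit {λ e → ∣ proj₂ ⟦ e ⟧ ∣ ℕ.≤ 1} ℕ.z≤n ℕₚ.≤-refl ℕ.z≤n ℕₚ.≤-refl e)) (ℕₚ.≤-trans (ℕₚ.m≤n+m _ _) N≤)
    where
    unit-bound : ∀ a → ∣ a ∣ ℕ.≤ 1 → ∣ odd j ℤ.* a ∣ ℕ.≤ ∣ odd j ∣
    unit-bound a a≤ = ℕₚ.≤-trans (ℕₚ.≤-reflexive (ℤₚ.abs-* (odd j) a)) (ℕₚ.≤-trans (ℕₚ.*-monoʳ-≤ ∣ odd j ∣ a≤) (ℕₚ.≤-reflexive (ℕₚ.*-identityʳ _)))
    coordinate : ∀ x y → ∣ y ∣ ℕ.≤ ∣ odd j ∣ →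
      ∣ (x ℤ.+ x) ℤ.+ y ∣ ℕ.* ∣ (x ℤ.+ x) ℤ.+ y ∣ ℕ.≤ 6 ℕ.* stepN → ∣ x ∣ ℕ.≤ r
    coordinate x y y≤ sq≤ = half-bound r ∣ x ∣ (ℕₚ.≤-trans (∣x∣-bound x y) (ℕₚ.≤-trans
      (ℕₚ.+-mono-≤ (root-bound b ∣ (x ℤ.+ x) ℤ.+ y ∣ λ sq≥ → ℕₚ.<⇒≱ b< (ℕₚ.≤-trans sq≥ sq≤)) y≤) r≥))

  module _ {n : ℕ} (seed : Level → Fin n → Segment)
    (valid-seed : ∀ l a → Valid l (seed l a))
    (T-seed : ∀ l a → T l (seed l a) ≡ seed (up l) a) where
    open Seeds seed valid-seed T-seed

    near? : ∀ l s → Dec (Near l s)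
    near? l s = any? λ a → (s ≟ˢ seed l a) ⊎-dec (nxt l s ≟ˢ seed l a)

    hits? : ∀ r l s → Dec (Hits r l s)
    hits? zero    l s = near? l s
    hits? (suc r) l s = near? l s ⊎-dec hits? r (up l) (T l s)

    RegionHits : (Level → ℤ[i] → Set) → ℕ → ℕ → Set
    RegionHits Coset b r = ∀ l x → ∣ x ∣ ℕ.≤ b → ∀ y → ∣ y ∣ ℕ.≤ b →
        Coset l (x , y) → ∀ e → Valid l (seg (x , y) e) → Hits r l (seg (x , y) e)

    region-hits? : {Coset : Level → ℤ[i] → Set} (coset? : ∀ l z → Dec (Coset l z)) → ∀ b r → Dec (RegionHits Coset b r)
    region-hits? coset? b r = ∀-level? λ l → ∀-bounded? b λ x → ∀-bounded? b λ y →
      coset? l (x , y) →-dec ∀-unit? λ e → valid? l (seg (x , y) e) →-dec hits? r l (seg (x , y) e)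

-- Directions leaving 0 must satisfy `hor = h l`, which differs from `hor g` only in phase `p3`. The
-- quarter turn is by -i because `pick` replaces e by -i e there; the next division does so again
-- and gives -g, in agreement with `up`.
ray : Phase → Unit
ray p3 = -i
ray _  = one

-- seed₁ and seed₃ are the families of T-periodic segments towards which T contracts, for steps of
-- length 1 (where the incoming segments, preceding seed₁, are omitted) and 3, found numerically.
seed₁ : Level → Fin 2 → Segment
seed₁ (p , g) 0F = seg 0[i] (g ∙ ray p)
seed₁ (p , g) 1F = seg 0[i] (-one ∙ (g ∙ ray p))

base : Phase → Fin 4 → Segment
base p0 0F = seg (+ 0 , + 1) -i
base p0 1F = seg (+ 0 , - + 2) one
base p0 2F = seg (- + 3 , - + 2) i
base p0 3F = seg (+ 3 , + 1) -one
base p1 0F = seg (- + 1 , + 2) -i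
base p1 1F = seg (- + 1 , - + 1) one
base p1 2F = seg (- + 4 , + 2) one
base p1 3F = seg (+ 2 , - + 1) i
base p2 0F = seg (+ 2 , + 0) -one
base p2 1F = seg (- + 1 , + 0) -i
base p2 2F = seg (- + 1 , + 3) one
base p2 3F = seg (+ 2 , - + 3) i
base p3 0F = seg (+ 1 , - + 1) i
base p3 1F = seg (- + 2 , + 2) -i
base p3 2F = seg (+ 1 , + 2) one
base p3 3F = seg (- + 2 , - + 1) one

seed₃ : Level → Fin 4 → Segment
seed₃ (p , g) a = seg (g · start (base p a)) (g ∙ dir (base p a))

-- The classes of i / (1 + i)ⁿ modulo 3, where -1 + i is the inverse of 1 + i. The fourth division
-- gives -i, a sign that `up` moves into g.
residue : Phase → ℤ[i]
residue p0 = + 0 , + 1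
residue p1 = - + 1 , - + 1
residue p2 = - + 1 , + 0
residue p3 = + 1 , - + 1

Coset₃ : Level → ℤ[i] → Set
Coset₃ (p , g) (x , y) = (+ 3 ∣ (x ℤ.- proj₁ (g · residue p))) × (+ 3 ∣ (y ℤ.- proj₂ (g · residue p)))

coset₃? : ∀ l z → Dec (Coset₃ l z)
coset₃? (p , g) (x , y) = (+ 3 ∣? _) ×-dec (+ 3 ∣? _)

module _ (t : Sign) where
  open Dynamics t 0ℤ using () renaming (T to T₁)
  valid-seed₁ : ∀ l a → Valid l (seed₁ l a)
  valid-seed₁ = toWitness {a? = ∀-level? λ l → all? λ a → valid? l (seed₁ l a)} tt
  T-seed₁ : ∀ l a → T₁ l (seed₁ l a) ≡ seed₁ (up l) a
  T-seed₁ = toWitness {a? = ∀-level? λ l → all? λ a → T₁ l (seed₁ l a) ≟ˢ seed₁ (up l) a} tt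
  open Dynamics t 1ℤ using () renaming (T to T₃)
  valid-seed₃ : ∀ l a → Valid l (seed₃ l a)
  valid-seed₃ = toWitness {a? = ∀-level? λ l → all? λ a → valid? l (seed₃ l a)} tt
  T-seed₃ : ∀ l a → T₃ l (seed₃ l a) ≡ seed₃ (up l) a
  T-seed₃ = toWitness {a? = ∀-level? λ l → all? λ a → T₃ l (seed₃ l a) ≟ˢ seed₃ (up l) a} tt

-- Here and in the region checks `nxt` evaluates `σ`; running the decision procedure for each value
-- of `t` makes the computation closed.
not-adjacent₃ : ∀ t l a b → Dynamics.nxt t 1ℤ l (seed₃ l a) ≢ seed₃ l b
not-adjacent₃ Sign.+ = toWitness {a? = ∀-level? λ l → all? λ a → all? λ b → ¬? (Dynamics.nxt Sign.+ 1ℤ l (seed₃ l a) ≟ˢ seed₃ l b)} tt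
not-adjacent₃ Sign.- = toWitness {a? = ∀-level? λ l → all? λ a → all? λ b → ¬? (Dynamics.nxt Sign.- 1ℤ l (seed₃ l a) ≟ˢ seed₃ l b)} tt

Coset₁ : Level → ℤ[i] → Set
Coset₁ _ _ = ⊤

module Region₁ (t : Sign) = Region t 0ℤ
module Region₃ (t : Sign) = Region t 1ℤ

-- The first number is the coordinate bound supplied by `region-bound`, the second a number of
-- applications of `T` within which every segment of the region meets a seed or the predecessor of
-- one. For steps of length 3 these become 5 and 8.
region₁ : ∀ t → Region₁.RegionHits t seed₁ (valid-seed₁ t) (T-seed₁ t) Coset₁ 1 6
region₁ Sign.+ = toWitness {a? = Region₁.region-hits? Sign.+ seed₁ (valid-seed₁ Sign.+) (T-seed₁ Sign.+) (λ _ _ → yes tt) 1 6} tt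
region₁ Sign.- = toWitness {a? = Region₁.region-hits? Sign.- seed₁ (valid-seed₁ Sign.-) (T-seed₁ Sign.-) (λ _ _ → yes tt) 1 6} tt

region₃ : ∀ t → Region₃.RegionHits t seed₃ (valid-seed₃ t) (T-seed₃ t) Coset₃ 5 8
region₃ Sign.+ = toWitness {a? = Region₃.region-hits? Sign.+ seed₃ (valid-seed₃ Sign.+) (T-seed₃ Sign.+) coset₃? 5 8} tt
region₃ Sign.- = toWitness {a? = Region₃.region-hits? Sign.- seed₃ (valid-seed₃ Sign.-) (T-seed₃ Sign.-) coset₃? 5 8} tt

-- 1 + i is invertible modulo 3: multiplying by 1 - i gives twice the wanted difference, which is
-- then subtracted from three times it.
coset-κ : ∀ l w → Coset₃ l (κ w) → Coset₃ (up l) w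
coset-κ l@(p , g) (a , b) (D₁ , D₂) =
    subst (+ 3 ∣_) (l₁ a b r r′ s s′) (∣m∣n⇒∣m-n (multiple (a ℤ.- r′)) (∣m∣n⇒∣m-n (∣m∣n⇒∣m+n D₁ D₂) (∣m∣n⇒∣m+n E₁ E₂))) ,
    subst (+ 3 ∣_) (l₂ a b r r′ s s′) (∣m∣n⇒∣m-n (multiple (b ℤ.- s′)) (∣m∣n⇒∣m-n (∣m∣n⇒∣m-n D₂ D₁) (∣m∣n⇒∣m-n E₂ E₁)))
  where
  centre : Level → ℤ[i]
  centre (p , g) = g · residue p
  r  = proj₁ (centre l)
  s  = proj₂ (centre l)
  r′ = proj₁ (centre (up l))
  s′ = proj₂ (centre (up l))
  multiple : ∀ x → + 3 ∣ (+ 3 ℤ.* x)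
  multiple x = divides x (ℤₚ.*-comm (+ 3) x)
  consistent : ∀ l → (+ 3 ∣ (proj₁ (κ (centre (up l))) ℤ.- proj₁ (centre l))) × (+ 3 ∣ (proj₂ (κ (centre (up l))) ℤ.- proj₂ (centre l)))
  consistent = toWitness {a? = ∀-level? λ l → (+ 3 ∣? _) ×-dec (+ 3 ∣? _)} tt
  E₁ = proj₁ (consistent l)
  E₂ = proj₂ (consistent l)
  l₁ : ∀ a b r r′ s s′ → + 3 ℤ.* (a ℤ.- r′) ℤ.- (((a ℤ.- b) ℤ.- r) ℤ.+ ((b ℤ.+ a) ℤ.- s) ℤ.- (((r′ ℤ.- s′) ℤ.- r) ℤ.+ ((s′ ℤ.+ r′) ℤ.- s))) ≡ a ℤ.- r′
  l₁ = solve-∀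
  l₂ : ∀ a b r r′ s s′ → + 3 ℤ.* (b ℤ.- s′) ℤ.- (((b ℤ.+ a) ℤ.- s) ℤ.- ((a ℤ.- b) ℤ.- r) ℤ.- (((s′ ℤ.+ r′) ℤ.- s) ℤ.- ((r′ ℤ.- s′) ℤ.- r))) ≡ b ℤ.- s′
  l₂ = solve-∀

coset-⊖3 : ∀ l z u → Coset₃ l (z ⊕ (+ 3 ⊛ u)) → Coset₃ l z
coset-⊖3 (p , g) (x , y) (a , b) (D₁ , D₂) = drop x a _ D₁ , drop y b _ D₂
  where
  l₁ : ∀ x a r → ((x ℤ.+ + 3 ℤ.* a) ℤ.- r) ℤ.- + 3 ℤ.* a ≡ x ℤ.- r
  l₁ = solve-∀
  drop : ∀ x a r → + 3 ∣ ((x ℤ.+ + 3 ℤ.* a) ℤ.- r) → + 3 ∣ (x ℤ.- r)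
  drop x a r D = subst (+ 3 ∣_) (l₁ x a r) (∣m∣n⇒∣m-n D (divides a (ℤₚ.*-comm (+ 3) a)))

coset-T : ∀ t l s → Valid l s → Coset₃ l (start s) → Coset₃ (up l) (start (Dynamics.T t 1ℤ l s))
coset-T t l s v co with Dynamics.view t 1ℤ l s v
... | Dynamics.is-child₁ s′ v′ = subst (λ r → Coset₃ (up l) (start r)) (sym (Dynamics.T-child₁ t 1ℤ l s′ v′)) (coset-κ l (start s′) co)
... | Dynamics.is-child₂ s′ v′ = subst (λ r → Coset₃ (up l) (start r)) (sym (Dynamics.T-child₂ t 1ℤ l s′ v′))
  (coset-κ l (start s′) (coset-⊖3 l (κ (start s′)) ⟦ first (h l) (dir s′) ⟧ co))

from≤ : ∀ {m n} → True (m ℕₚ.≤? n) → m ℕ.≤ n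
from≤ = toWitness

module _ (t : Sign) where
  module D₁ = Dynamics t 0ℤ
  module D₃ = Dynamics t 1ℤ
  module S₁ = D₁.Seeds seed₁ (valid-seed₁ t) (T-seed₁ t)
  module S₃ = D₃.Seeds seed₃ (valid-seed₃ t) (T-seed₃ t)

  connected₁ : ∀ l s → Valid l s → S₁.Connected l s
  connected₁ l s v = S₁.connected-all Coset₁ (λ _ _ _ _ → tt) 6 near l s v tt
    where
    near : ∀ l s → N (D₁.mid s) ℕ.≤ 6 ℕ.* D₁.stepN → Valid l s → ⊤ → S₁.Hits 6 l s
    -- With `stepN` = 1: 6 < 3² gives b = 2, and 2 + 1 ≤ 2·1 + 1 gives r = 1.
    near l s@(seg (x , y) e) N≤ v co = let x≤ , y≤ = Region₁.region-bound t 2 1 (from≤ tt) (from≤ tt) s N≤ in region₁ t l x x≤ y y≤ co e v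

  connected₃ : ∀ l s → Valid l s → Coset₃ l (start s) → S₃.Connected l s
  connected₃ = S₃.connected-all Coset₃ (coset-T t) 8 near
    where
    near : ∀ l s → N (D₃.mid s) ℕ.≤ 6 ℕ.* D₃.stepN → Valid l s → Coset₃ l (start s) → S₃.Hits 8 l s
    -- With `stepN` = 9: 54 < 8² gives b = 7, and 7 + 3 ≤ 2·5 + 1 gives r = 5.
    near l s@(seg (x , y) e) N≤ v co = let x≤ , y≤ = Region₃.region-bound t 7 5 (from≤ tt) (from≤ tt) s N≤ in region₃ t l x x≤ y y≤ co e v

  separated₃ : ∀ m l a b → D₃.nxt^ l m (seed₃ l a) ≡ seed₃ l b → m ≡ 0
  separated₃ = S₃.separated (not-adjacent₃ t)

seed₃-injective : ∀ l a b → seed₃ l a ≡ seed₃ l b → a ≡ b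
seed₃-injective = toWitness {a? = ∀-level? λ l → all? λ a → all? λ b → (seed₃ l a ≟ˢ seed₃ l b) →-dec (a Fin.≟ b)} tt

-- Translation of bounded sets

Oriented : Sign → Segment → Set
Oriented q s = hor (dir s) ≡ q Sign.* π (start s)

-- All that local isomorphism depends on. Once two coverings are described, comparing them is a
-- matter of comparing signs at translated vertices; neither the number of curves nor their
-- parametrizations matter.
record Described (C : Covering) (q : Sign) (f : ℤ[i] → Sign) : Set where
  open CompleteCurve
  field
    oriented : ∀ c k → Oriented q (segmentAt (curve C c) k)
    complete : ∀ s → Oriented q s → ∃[ c ] ∃[ k ] segmentAt (curve C c) k ≡ s
    turning  : ∀ c k → turn (curve C c) k ≡ f (end (segmentAt (curve C c) k))

⊕-swap : ∀ u v w → (u ⊕ v) ⊕ w ≡ (u ⊕ w) ⊕ v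
⊕-swap u v w = trans (⊕-assoc u v w) (trans (cong (u ⊕_) (⊕-comm v w)) (sym (⊕-assoc u w v)))

end-translate : ∀ v s → end (translate v s) ≡ end s ⊕ v
end-translate v (seg z e) = ⊕-swap z v ⟦ e ⟧

next-translate : ∀ a v s → next a (translate v s) ≡ translate v (next a s)
next-translate a v s = cong (λ z → seg z (i^ a ∙ dir s)) (end-translate v s)

translate-injective : ∀ v s s′ → translate v s ≡ translate v s′ → s ≡ s′
translate-injective v (seg z e) (seg z′ e′) eq =
  cong₂ seg (trans (sym (⊕-⊖ z v)) (trans (cong (λ s → start s ⊖ v) eq) (⊕-⊖ z′ v))) (cong dir eq)

segmentsFrom-translate : ∀ v s as → segmentsFrom (translate v s) as ≡ map (translate v) (segmentsFrom s as)
segmentsFrom-translate v s []       = refl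
segmentsFrom-translate v s (a ∷ as) = cong (translate v s ∷_)
  (trans (cong (λ r → segmentsFrom r as) (next-translate a v s)) (segmentsFrom-translate v (next a s) as))

segments-translate : ∀ v b → segments (translateCurve v b) ≡ map (translate v) (segments b)
segments-translate v (finiteCurve s as) = segmentsFrom-translate v s as

applyUpTo-cong : ∀ {A : Set} {f g : ℕ → A} n → (∀ {j} → j ℕ.< n → f j ≡ g j) → applyUpTo f n ≡ applyUpTo g n
applyUpTo-cong zero    eq = refl
applyUpTo-cong (suc n) eq = cong₂ _∷_ (eq (ℕ.s≤s ℕ.z≤n)) (applyUpTo-cong n (λ j< → eq (ℕ.s≤s j<)))

oriented-translate : ∀ q q′ v → q′ Sign.* π v ≡ q → ∀ s → q Sign.* π (start s) ≡ q′ Sign.* π (start (translate v s))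
oriented-translate q q′ v eq (seg z e) = begin
  q Sign.* π z                      ≡⟨ cong (Sign._* π z) eq ⟨
  (q′ Sign.* π v) Sign.* π z        ≡⟨ Signₚ.*-assoc q′ (π v) (π z) ⟩
  q′ Sign.* (π v Sign.* π z)        ≡⟨ cong (q′ Sign.*_) (Signₚ.*-comm (π v) (π z)) ⟩
  q′ Sign.* (π z Sign.* π v)        ≡⟨ cong (q′ Sign.*_) (π-⊕ z v) ⟨
  q′ Sign.* π (z ⊕ v)               ∎
  where open ≡-Reasoning

+suc : ∀ k j → k ℤ.+ + suc j ≡ ℤ.suc (k ℤ.+ + j)
+suc k j = trans (cong (λ m → k ℤ.+ m) (ℤₚ.pos-+ 1 j)) (l k (+ j))
  where
  l : ∀ k j → k ℤ.+ (1ℤ ℤ.+ j) ≡ 1ℤ ℤ.+ (k ℤ.+ j)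
  l = solve-∀

segmentAt-suc : ∀ γ k j → let open CompleteCurve γ in
  segmentAt (k ℤ.+ + suc j) ≡ next (turn (k ℤ.+ + j)) (segmentAt (k ℤ.+ + j))
segmentAt-suc γ k j = trans (cong (CompleteCurve.segmentAt γ) (+suc k j)) (CompleteCurve.connected γ (k ℤ.+ + j))

module Transport {C E q q′ f f′} (C-desc : Described C q f) (E-desc : Described E q′ f′)
  (v : ℤ[i]) (q≡ : q′ Sign.* π v ≡ q) where

  open CompleteCurve
  open Described

  -- The hypothesis on signs may assume that the curves are still parallel at index j. In
  -- `consecutive′` it is the segment of E that is known to come from B, and this equation carries
  -- the information back to C.
  parallel : ∀ c k c′ k′ n → segmentAt (curve E c′) k′ ≡ translate v (segmentAt (curve C c) k) →
    (∀ j → j ℕ.< n → let s = segmentAt (curve C c) (k ℤ.+ + j) in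
      segmentAt (curve E c′) (k′ ℤ.+ + j) ≡ translate v s → f′ (end s ⊕ v) ≡ f (end s)) →
    ∀ j → j ℕ.< n → segmentAt (curve E c′) (k′ ℤ.+ + j) ≡ translate v (segmentAt (curve C c) (k ℤ.+ + j))
  parallel c k c′ k′ n eq agree zero j<n = subst₂ (λ a b → segmentAt (curve E c′) a ≡ translate v (segmentAt (curve C c) b))
    (sym (ℤₚ.+-identityʳ k′)) (sym (ℤₚ.+-identityʳ k)) eq
  parallel c k c′ k′ n eq agree (suc j) j<n = begin
    segmentAt γ′ (k′ ℤ.+ + suc j)                              ≡⟨ segmentAt-suc γ′ k′ j ⟩
    next (turn γ′ (k′ ℤ.+ + j)) (segmentAt γ′ (k′ ℤ.+ + j))    ≡⟨ cong₂ next turn≡ previous ⟩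
    next (turn γ (k ℤ.+ + j)) (translate v s)                  ≡⟨ next-translate (turn γ (k ℤ.+ + j)) v s ⟩
    translate v (next (turn γ (k ℤ.+ + j)) s)                  ≡⟨ cong (translate v) (segmentAt-suc γ k j) ⟨
    translate v (segmentAt γ (k ℤ.+ + suc j))                  ∎
    where
    open ≡-Reasoning
    γ  = curve C c
    γ′ = curve E c′
    s  = segmentAt γ (k ℤ.+ + j)
    previous = parallel c k c′ k′ n eq agree j (ℕₚ.<⇒≤ j<n)
    turn≡ : turn γ′ (k′ ℤ.+ + j) ≡ turn γ (k ℤ.+ + j)
    turn≡ = begin
      turn γ′ (k′ ℤ.+ + j)                       ≡⟨ E-desc .turning c′ (k′ ℤ.+ + j) ⟩
      f′ (end (segmentAt γ′ (k′ ℤ.+ + j)))       ≡⟨ cong (λ r → f′ (end r)) previous ⟩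
      f′ (end (translate v s))                   ≡⟨ cong f′ (end-translate v s) ⟩
      f′ (end s ⊕ v)                             ≡⟨ agree j (ℕₚ.<⇒≤ j<n) previous ⟩
      f (end s)                                  ≡⟨ C-desc .turning c (k ℤ.+ + j) ⟨
      turn γ (k ℤ.+ + j)                         ∎

  -- A curve is determined by one segment and the signs at its vertices. So runs of C inside B
  -- reappear in E, and a run of E inside the translate of B is pulled back to C, where it has to be
  -- consecutive.
  translated : ∀ B → B < C → (∀ b → b ∈ B → ∀ s → s ∈ segments b → f′ (end s ⊕ v) ≡ f (end s)) →
    map (translateCurve v) B < E
  translated B (inside , consecutive) agree = Allₚ.map⁺ (All.tabulate inside′) , consecutive′
    where
    run-translate : ∀ c k c′ k′ n →
      (∀ j → j ℕ.< n → segmentAt (curve E c′) (k′ ℤ.+ + j) ≡ translate v (segmentAt (curve C c) (k ℤ.+ + j))) →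
      run (curve E c′) k′ n ≡ map (translate v) (run (curve C c) k n)
    run-translate c k c′ k′ n eq = trans (applyUpTo-cong n (λ {j} → eq j)) (sym (map-applyUpTo (λ j → segmentAt (curve C c) (k ℤ.+ + j)) (translate v) n))

    inside′ : ∀ {b} → b ∈ B → ∃[ c ] ∃[ k ]
      run (curve E c) k (length (segments (translateCurve v b))) ≡ segments (translateCurve v b)
    inside′ {b} b∈B with c , k , run≡ ← All.lookup inside b∈B
      with c′ , k′ , eq ← E-desc .complete (translate v (segmentAt (curve C c) k))
        (trans (C-desc .oriented c k) (oriented-translate q q′ v q≡ (segmentAt (curve C c) k))) = c′ , k′ , (begin
      run (curve E c′) k′ (length (segments (translateCurve v b))) ≡⟨ cong (run (curve E c′) k′) n≡ ⟩
      run (curve E c′) k′ n                                        ≡⟨ run-translate c k c′ k′ n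
          (parallel c k c′ k′ n eq λ j j<n _ → agree b b∈B _ (subst (_ ∈_) run≡ (∈-applyUpTo⁺ (λ j → segmentAt (curve C c) (k ℤ.+ + j)) j<n))) ⟩
      map (translate v) (run (curve C c) k n)                      ≡⟨ cong (map (translate v)) run≡ ⟩
      map (translate v) (segments b)                               ≡⟨ segments-translate v b ⟨
      segments (translateCurve v b)                                ∎)
      where
      open ≡-Reasoning
      n = length (segments b)
      n≡ : length (segments (translateCurve v b)) ≡ n
      n≡ = trans (cong length (segments-translate v b)) (length-map (translate v) (segments b))

    consecutive′ : ∀ c k l → let r = run (curve E c) k (suc l) in
      All (λ s → Any (λ b → s ∈ segments b) (map (translateCurve v) B)) r →
      Any (λ b → Infix.Infix _≡_ r (segments b)) (map (translateCurve v) B)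
    consecutive′ c k l covered = Anyₚ.map⁺ (Any.map (λ {b} infix-of → subst₂ (Infix.Infix _≡_)
        (sym (run-translate c₀ k₀ c k (suc l) lifted)) (sym (segments-translate v b))
        (Infixₚ.map⁺ (translate v) (translate v) (Infix.map (cong (translate v)) infix-of)))
      (consecutive c₀ k₀ l (Allₚ.applyUpTo⁺₁ (λ j → segmentAt (curve C c₀) (k₀ ℤ.+ + j)) (suc l) λ {j} j< → covered₀ j j<)))
      where
      source : ∀ j → j ℕ.< suc l → ∃[ s ] segmentAt (curve E c) (k ℤ.+ + j) ≡ translate v s × ∃[ b ] b ∈ B × s ∈ segments b
      source j j< with b , b∈B , s∈b ← find (Anyₚ.map⁻ (Allₚ.applyUpTo⁻ (λ j → segmentAt (curve E c) (k ℤ.+ + j)) (suc l) covered j<))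
        with s , s∈ , eq ← ∈-map⁻ (translate v) (subst (_ ∈_) (segments-translate v b) s∈b) = s , eq , b , b∈B , s∈

      s₀ = proj₁ (source 0 (ℕ.s≤s ℕ.z≤n))
      s₀≡ : segmentAt (curve E c) k ≡ translate v s₀
      s₀≡ = trans (cong (segmentAt (curve E c)) (sym (ℤₚ.+-identityʳ k))) (proj₁ (proj₂ (source 0 (ℕ.s≤s ℕ.z≤n))))

      preimage : ∃[ c₀ ] ∃[ k₀ ] segmentAt (curve C c₀) k₀ ≡ s₀
      preimage = C-desc .complete s₀ (trans (subst (Oriented q′) s₀≡ (E-desc .oriented c k)) (sym (oriented-translate q q′ v q≡ s₀)))
      c₀ = proj₁ preimage
      k₀ = proj₁ (proj₂ preimage)

      lifted : ∀ j → j ℕ.< suc l → segmentAt (curve E c) (k ℤ.+ + j) ≡ translate v (segmentAt (curve C c₀) (k₀ ℤ.+ + j))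
      lifted = parallel c₀ k₀ c k (suc l) (trans s₀≡ (cong (translate v) (sym (proj₂ (proj₂ preimage)))))
        λ j j< eq → let s , s≡ , b , b∈B , s∈b = source j j<
          in subst (λ r → f′ (end r ⊕ v) ≡ f (end r)) (translate-injective v s (segmentAt (curve C c₀) (k₀ ℤ.+ + j)) (trans (sym s≡) eq)) (agree b b∈B s s∈b)

      covered₀ : ∀ j → j ℕ.< suc l → Any (λ b → segmentAt (curve C c₀) (k₀ ℤ.+ + j) ∈ segments b) B
      covered₀ j j< = let s , s≡ , b , b∈B , s∈b = source j j<
        in lose b∈B (subst (_∈ segments b) (translate-injective v s (segmentAt (curve C c₀) (k₀ ℤ.+ + j)) (trans (sym s≡) (lifted j j<))) s∈b)

-- The covering by four curves

π-end : ∀ s → π (end s) ≡ opposite (π (start s))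
π-end (seg z e) = trans (π-⊕ z ⟦ e ⟧) (trans (cong (π z Sign.*_) (π⟦⟧ e)) (Signₚ.*-comm (π z) Sign.-))

hor-opp : ∀ e → hor (-one ∙ e) ≡ hor e
hor-opp = ∀-unit refl refl refl refl

opp≢ : ∀ a → opposite a ≢ a
opp≢ Sign.+ ()
opp≢ Sign.- ()

sign-cases : ∀ a b → a ≡ b ⊎ a ≡ opposite b
sign-cases Sign.+ Sign.+ = inj₁ refl
sign-cases Sign.+ Sign.- = inj₂ refl
sign-cases Sign.- Sign.+ = inj₂ refl
sign-cases Sign.- Sign.- = inj₁ refl

oriented-flip : ∀ {q} s → hor (dir s) ≡ opposite (q Sign.* π (start s)) → Oriented q (flip s)
oriented-flip {q} s eq = trans (hor-opp (dir s)) (trans eq (trans (sym (*-opp q (π (start s)))) (cong (q Sign.*_) (sym (π-end s)))))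

¬oriented-flip : ∀ {q} s → Oriented q s → ¬ Oriented q (flip s)
¬oriented-flip {q} s o o′ = opp≢ (q Sign.* π (start s)) (begin
  opposite (q Sign.* π (start s))   ≡⟨ *-opp q (π (start s)) ⟨
  q Sign.* opposite (π (start s))   ≡⟨ cong (q Sign.*_) (π-end s) ⟨
  q Sign.* π (end s)                ≡⟨ o′ ⟨
  hor (-one ∙ dir s)                ≡⟨ hor-opp (dir s) ⟩
  hor (dir s)                       ≡⟨ o ⟩
  q Sign.* π (start s)              ∎)
  where open ≡-Reasoning

hor-end : ∀ q s → Oriented q s → hor (dir s) ≡ opposite (q Sign.* π (end s))
hor-end q s o = trans o (trans (cong (q Sign.*_) (sym (trans (cong opposite (π-end s)) (opp-invol (π (start s)))))) (*-opp q (π (end s))))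

oriented-arriving : ∀ q z e → hor e ≡ opposite (q Sign.* π z) → Oriented q (seg (z ⊖ ⟦ e ⟧) e)
oriented-arriving q z e eq = trans eq (trans (sym (*-opp q (π z))) (cong (q Sign.*_)
  (trans (Signₚ.*-comm Sign.- (π z)) (trans (cong (π z Sign.*_) (sym (π⟦⟧ e))) (sym (π-⊖ z ⟦ e ⟧))))))

at-start : ∀ {s z} → start s ≡ z → s ≡ seg z (dir s)
at-start refl = refl

at-end : ∀ {s z} → end s ≡ z → s ≡ seg (z ⊖ ⟦ dir s ⟧) (dir s)
at-end {seg z e} refl = cong (λ w → seg w e) (sym (⊕-⊖ z ⟦ e ⟧))

*-opp-self : ∀ q {a b} → a ≡ opposite q → b ≡ Sign.- → b ≡ q Sign.* a
*-opp-self Sign.+ refl refl = refl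
*-opp-self Sign.- refl refl = refl

module BuildCovering (Index : Set) (curve : Index → CompleteCurve) (q : Sign)
  (oriented : ∀ a k → Oriented q (CompleteCurve.segmentAt (curve a) k))
  (complete : ∀ s → Oriented q s → ∃[ a ] ∃[ k ] CompleteCurve.segmentAt (curve a) k ≡ s)
  (unique : ∀ a k b m → CompleteCurve.segmentAt (curve a) k ≡ CompleteCurve.segmentAt (curve b) m → (a , k) ≡ (b , m)) where

  segmentOf : Index × ℤ → Segment
  segmentOf (a , k) = CompleteCurve.segmentAt (curve a) k

  -- Exactly one of the two orientations of a unit interval satisfies `Oriented q`, which reduces
  -- the claim to `complete` and `unique`.
  covers : ∀ (z : ℤ[i]) (ε : Unit) → ε ∈ one ∷ i ∷ [] →
    ∃! _≡_ λ (ak : Index × ℤ) → segmentOf ak ≡ seg z ε ⊎ segmentOf ak ≡ flip (seg z ε)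
  covers z ε _ with sign-cases (hor ε) (q Sign.* π z)
  ... | inj₁ o = let a , k , eq = complete (seg z ε) o in (a , k) , inj₁ eq , uniq a k eq
    where
    uniq : ∀ a k → segmentOf (a , k) ≡ seg z ε → ∀ {bm} → segmentOf bm ≡ seg z ε ⊎ segmentOf bm ≡ flip (seg z ε) → (a , k) ≡ bm
    uniq a k eq {b , m} (inj₁ eq′) = unique a k b m (trans eq (sym eq′))
    uniq a k eq {b , m} (inj₂ eq′) = ⊥-elim (¬oriented-flip {q} (seg z ε) o (subst (Oriented q) eq′ (oriented b m)))
  ... | inj₂ o = let a , k , eq = complete (flip (seg z ε)) o′ in (a , k) , inj₂ eq , uniq a k eq
    where
    o′ : Oriented q (flip (seg z ε))
    o′ = oriented-flip {q} (seg z ε) o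
    uniq : ∀ a k → segmentOf (a , k) ≡ flip (seg z ε) → ∀ {bm} → segmentOf bm ≡ seg z ε ⊎ segmentOf bm ≡ flip (seg z ε) → (a , k) ≡ bm
    uniq a k eq {b , m} (inj₁ eq′) = ⊥-elim (¬oriented-flip {q} (seg z ε) (subst (Oriented q) eq′ (oriented b m)) o′)
    uniq a k eq {b , m} (inj₂ eq′) = unique a k b m (trans eq (sym eq′))

  SegmentWithEndpoint : ℤ[i] → Segment → Set
  SegmentWithEndpoint z s = (∃[ ak ] segmentOf ak ≡ s) × (start s ≡ z ⊎ end s ≡ z)

  oriented-of : ∀ {s} → ∃[ ak ] segmentOf ak ≡ s → Oriented q s
  oriented-of ((a , k) , eq) = subst (Oriented q) eq (oriented a k)

  incident-start : ∀ {z e} → Oriented q (seg z e) → SegmentWithEndpoint z (seg z e)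
  incident-start o with a , k , eq ← complete _ o = ((a , k) , eq) , inj₁ refl

  incident-end : ∀ z e → hor e ≡ opposite (q Sign.* π z) → SegmentWithEndpoint z (seg (z ⊖ ⟦ e ⟧) e)
  incident-end z e o with a , k , eq ← complete (seg (z ⊖ ⟦ e ⟧) e) (oriented-arriving q z e o) =
    ((a , k) , eq) , inj₂ (⊖-⊕ z ⟦ e ⟧)

  out : ∀ z → π z ≡ q → ∀ s → SegmentWithEndpoint z s ⇔ s ∈ HorizontalOut z
  out z refl s = mk⇔ to from
    where
    +≡ : q Sign.* π z ≡ Sign.+
    +≡ = Signₚ.s*s≡+ q
    leaving : ∀ e → hor e ≡ Sign.+ → seg z e ∈ HorizontalOut z
    leaving one  _ = here refl
    leaving -one _ = there (here refl)
    arriving : ∀ e → hor e ≡ Sign.- → seg (z ⊖ ⟦ e ⟧) e ∈ HorizontalOut z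
    arriving -i _ = there (there (here refl))
    arriving i  _ = there (there (there (here refl)))
    to : SegmentWithEndpoint z s → s ∈ HorizontalOut z
    to (ak , inj₁ s≡) = subst (_∈ HorizontalOut z) (sym (at-start s≡))
      (leaving (dir s) (trans (oriented-of ak) (trans (cong (λ w → q Sign.* π w) s≡) +≡)))
    to (ak , inj₂ e≡) = subst (_∈ HorizontalOut z) (sym (at-end e≡))
      (arriving (dir s) (trans (subst (λ w → hor (dir s) ≡ opposite (q Sign.* π w)) e≡ (hor-end q s (oriented-of ak))) (cong opposite +≡)))
    from : s ∈ HorizontalOut z → SegmentWithEndpoint z s
    from (here refl)                         = incident-start (sym +≡)
    from (there (here refl))                 = incident-start (sym +≡)
    from (there (there (here refl)))         = incident-end z -i (cong opposite (sym +≡))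
    from (there (there (there (here refl)))) = incident-end z i (cong opposite (sym +≡))

  into : ∀ z → π z ≡ opposite q → ∀ s → SegmentWithEndpoint z s ⇔ s ∈ HorizontalIn z
  into z π≡ s = mk⇔ to from
    where
    -≡ : q Sign.* π z ≡ Sign.-
    -≡ = sym (*-opp-self q π≡ refl)
    leaving : ∀ e → hor e ≡ Sign.- → seg z e ∈ HorizontalIn z
    leaving i  _ = there (there (here refl))
    leaving -i _ = there (there (there (here refl)))
    arriving : ∀ e → hor e ≡ Sign.+ → seg (z ⊖ ⟦ e ⟧) e ∈ HorizontalIn z
    arriving -one _ = here refl
    arriving one  _ = there (here refl)
    to : SegmentWithEndpoint z s → s ∈ HorizontalIn z
    to (ak , inj₁ s≡) = subst (_∈ HorizontalIn z) (sym (at-start s≡))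
      (leaving (dir s) (trans (oriented-of ak) (trans (cong (λ w → q Sign.* π w) s≡) -≡)))
    to (ak , inj₂ e≡) = subst (_∈ HorizontalIn z) (sym (at-end e≡))
      (arriving (dir s) (trans (subst (λ w → hor (dir s) ≡ opposite (q Sign.* π w)) e≡ (hor-end q s (oriented-of ak))) (cong opposite -≡)))
    from : s ∈ HorizontalIn z → SegmentWithEndpoint z s
    from (here refl)                         = incident-end z -one (cong opposite (sym -≡))
    from (there (here refl))                 = incident-end z one (cong opposite (sym -≡))
    from (there (there (here refl)))         = incident-start (sym -≡)
    from (there (there (there (here refl)))) = incident-start (sym -≡)

  covering : Covering
  covering = record
    { Index = Index ; curve = curve ; covers = covers
    ; orientation = fromSign q , λ z →
        (λ eq → out z (trans (cong toSign eq) toSign-fromSign)) ,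
        (λ eq → into z (trans (cong toSign eq) (trans (ℙₚ.⁻¹-homo-opposite (fromSign q)) (cong opposite toSign-fromSign)))) }
    where
    toSign-fromSign : toSign (fromSign q) ≡ q
    toSign-fromSign = ℙₚ.toSign-inverseˡ refl

-- Curves that follow a sign function

module Walk (f : ℤ[i] → Sign) where
  forward backward : Segment → Segment
  forward s = next (f (end s)) s
  backward (seg z e) = let e′ = i^ (opposite (f z)) ∙ e in seg (z ⊖ ⟦ e′ ⟧) e′

  forward-backward : ∀ s → forward (backward s) ≡ s
  forward-backward (seg z e) = trans (cong (λ y → seg y (i^ (f y) ∙ e′)) (⊖-⊕ z ⟦ e′ ⟧)) (cong (seg z) (unturn′ (f z) e))
    where e′ = i^ (opposite (f z)) ∙ e

  walk : Segment → ℤ → Segment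
  walk s (+ zero)     = s
  walk s (+ suc n)    = forward (walk s (+ n))
  walk s -[1+ zero ]  = backward s
  walk s -[1+ suc n ] = backward (walk s -[1+ n ])

  walk-suc : ∀ s k → walk s (ℤ.suc k) ≡ forward (walk s k)
  walk-suc s (+ n)        = refl
  walk-suc s -[1+ zero ]  = sym (forward-backward s)
  walk-suc s -[1+ suc n ] = sym (forward-backward (walk s -[1+ n ]))

  walkCurve : Segment → CompleteCurve
  walkCurve s = record { turn = λ k → f (end (walk s k)) ; segmentAt = walk s ; connected = walk-suc s }

-- Plane coverings are placed in the coordinates of `σ` by `ι`: with j = 0 and A = -x for C, and
-- with j = 1 and A = gi for E. Directions are kept, and unit segments become steps of length
-- `odd j`.
module Embedding (t : Sign) (j : ℤ) (l : Level) (A : ℤ[i]) where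
  open Dynamics t j public

  ι : ℤ[i] → ℤ[i]
  ι z = (odd j ⊛ z) ⊕ A

  embed : Segment → Segment
  embed (seg z e) = seg (ι z) e

  sign : ℤ[i] → Sign
  sign z = σ t l (ι z)

  open Walk sign public

  ι-⊕ : ∀ z e → ι (z ⊕ ⟦ e ⟧) ≡ ι z ⊕ step e
  ι-⊕ (x , y) e = pair (distrib (odd j) x (proj₁ ⟦ e ⟧) (proj₁ A)) (distrib (odd j) y (proj₂ ⟦ e ⟧) (proj₂ A))
    where
    distrib : ∀ m x a b → m ℤ.* (x ℤ.+ a) ℤ.+ b ≡ (m ℤ.* x ℤ.+ b) ℤ.+ m ℤ.* a
    distrib = solve-∀

  ι-injective : .{{_ : ℤ.NonZero (odd j)}} → ∀ z w → ι z ≡ ι w → z ≡ w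
  ι-injective z w eq = pair (ℤₚ.*-cancelˡ-≡ (odd j) (proj₁ z) (proj₁ w) (cong proj₁ eq′)) (ℤₚ.*-cancelˡ-≡ (odd j) (proj₂ z) (proj₂ w) (cong proj₂ eq′))
    where
    eq′ : odd j ⊛ z ≡ odd j ⊛ w
    eq′ = trans (sym (⊕-⊖ (odd j ⊛ z) A)) (trans (cong (_⊖ A) eq) (⊕-⊖ (odd j ⊛ w) A))

  embed-injective : .{{_ : ℤ.NonZero (odd j)}} → ∀ s s′ → embed s ≡ embed s′ → s ≡ s′
  embed-injective (seg z e) (seg w d) eq = cong₂ seg (ι-injective z w (cong start eq)) (cong dir eq)

  embed-forward : ∀ s → embed (forward s) ≡ nxt l (embed s)
  embed-forward (seg z e) = cong₂ (λ y a → seg y (i^ a ∙ e)) (ι-⊕ z e) (cong (σ t l) (ι-⊕ z e))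

  orientation : Sign
  orientation = h l Sign.* π A

  orientation-ι : ∀ z → h l Sign.* π (ι z) ≡ orientation Sign.* π z
  orientation-ι z = begin
    h l Sign.* π (ι z)                        ≡⟨ cong (h l Sign.*_) (π-⊕ (odd j ⊛ z) A) ⟩
    h l Sign.* (π (odd j ⊛ z) Sign.* π A)     ≡⟨ cong (λ a → h l Sign.* (a Sign.* π A)) (π-⊛ j z) ⟩
    h l Sign.* (π z Sign.* π A)               ≡⟨ cong (h l Sign.*_) (Signₚ.*-comm (π z) (π A)) ⟩
    h l Sign.* (π A Sign.* π z)               ≡⟨ Signₚ.*-assoc (h l) (π A) (π z) ⟨
    orientation Sign.* π z                    ∎
    where open ≡-Reasoning

  oriented⇒valid : ∀ s → Oriented orientation s → Valid l (embed s)
  oriented⇒valid s o = trans o (sym (orientation-ι (start s)))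

  valid⇒oriented : ∀ s → Valid l (embed s) → Oriented orientation s
  valid⇒oriented s v = trans v (orientation-ι (start s))

  valid-prv : ∀ s → Valid l (nxt l s) → Valid l s
  valid-prv (seg z e) v = begin
    hor e                                  ≡⟨ opp-invol (hor e) ⟨
    opposite (opposite (hor e))            ≡⟨ cong opposite (hor-turn (σ t l (z ⊕ step e)) e) ⟨
    opposite (hor (i^ (σ t l (z ⊕ step e)) ∙ e)) ≡⟨ cong opposite v ⟩
    opposite (h l Sign.* π (z ⊕ step e))   ≡⟨ *-opp (h l) (π (z ⊕ step e)) ⟨
    h l Sign.* opposite (π (z ⊕ step e))   ≡⟨ cong (λ a → h l Sign.* opposite a) (π-⊕step z e) ⟩
    h l Sign.* opposite (opposite (π z))   ≡⟨ cong (h l Sign.*_) (opp-invol (π z)) ⟩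
    h l Sign.* π z                         ∎
    where open ≡-Reasoning

  embed-orbit : (δ : ℤ → Segment) → (∀ k → δ (ℤ.suc k) ≡ forward (δ k)) → Valid l (embed (δ 0ℤ)) → Orbit l (λ k → embed (δ k))
  embed-orbit δ δ-suc v₀ = record { valid = valids ; connected = connecteds }
    where
    connecteds : ∀ k → embed (δ (ℤ.suc k)) ≡ nxt l (embed (δ k))
    connecteds k = trans (cong embed (δ-suc k)) (embed-forward (δ k))
    valids : ∀ k → Valid l (embed (δ k))
    valids = ℤ-induction (λ k → Valid l (embed (δ k))) v₀
      (λ k v → subst (Valid l) (sym (connecteds k)) (valid-nxt l (embed (δ k)) v))
      (λ k v → valid-prv (embed (δ k)) (subst (Valid l) (connecteds k) v))

module OrbitLemmas (t : Sign) (j : ℤ) where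
  open Dynamics t j

  orbit-unique : ∀ {l γ δ} → Orbit l γ → Orbit l δ → ∀ k m → γ k ≡ δ m → ∀ r → γ (r ℤ.+ k) ≡ δ (r ℤ.+ m)
  orbit-unique {l} {γ} {δ} o o′ k m eq = ℤ-induction (λ r → γ (r ℤ.+ k) ≡ δ (r ℤ.+ m))
    (subst₂ (λ a b → γ a ≡ δ b) (sym (ℤₚ.+-identityˡ k)) (sym (ℤₚ.+-identityˡ m)) eq)
    (λ r eq → trans (shift o r k) (trans (cong (nxt l) eq) (sym (shift o′ r m))))
    (λ r eq → nxt-injective l (trans (sym (shift o r k)) (trans eq (shift o′ r m))))
    where
    shift : ∀ {γ} → Orbit l γ → ∀ r k → γ (ℤ.suc r ℤ.+ k) ≡ nxt l (γ (r ℤ.+ k))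
    shift {γ} o r k = trans (cong γ (ℤₚ.+-assoc 1ℤ r k)) (o .connected (r ℤ.+ k))

  orbit-nxt^ : ∀ {l γ} → Orbit l γ → ∀ n → γ (+ n) ≡ nxt^ l n (γ 0ℤ)
  orbit-nxt^ o zero    = refl
  orbit-nxt^ {l} o (suc n) = trans (o .connected (+ n)) (cong (nxt l) (orbit-nxt^ o n))

-- The starts of `base p0` pulled back along z ↦ 3z + i, then rotated by g; for instance -3 - 2i = 3
-- (-1 - i) + i.
seed₃-preimage : Unit → Fin 4 → Segment
seed₃-preimage g 0F = seg (g · (0ℤ , 0ℤ)) (g ∙ -i)
seed₃-preimage g 1F = seg (g · (0ℤ , -1ℤ)) (g ∙ one)
seed₃-preimage g 2F = seg (g · (-1ℤ , -1ℤ)) (g ∙ i)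
seed₃-preimage g 3F = seg (g · (1ℤ , 0ℤ)) (g ∙ -one)

embed-seed₃-preimage : ∀ t g a → Embedding.embed t 1ℤ (p0 , g) (g · (0ℤ , 1ℤ)) (seed₃-preimage g a) ≡ seed₃ (p0 , g) a
embed-seed₃-preimage t = toWitness {a? = ∀-unit? λ g → all? λ a →
  Embedding.embed t 1ℤ (p0 , g) (g · (0ℤ , 1ℤ)) (seed₃-preimage g a) ≟ˢ seed₃ (p0 , g) a} tt

module FourCurves (t : Sign) (g : Unit) where
  l₀ : Level
  l₀ = p0 , g

  open Embedding t 1ℤ l₀ (g · (0ℤ , 1ℤ))
  open OrbitLemmas t 1ℤ

  seedE : Fin 4 → Segment
  seedE = seed₃-preimage g

  embed-seedE : ∀ a → embed (seedE a) ≡ seed₃ l₀ a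
  embed-seedE = embed-seed₃-preimage t g

  orbitE : ∀ a → Orbit l₀ (λ k → embed (walk (seedE a) k))
  orbitE a = embed-orbit (walk (seedE a)) (walk-suc (seedE a)) (subst (Valid l₀) (sym (embed-seedE a)) (valid-seed₃ t l₀ a))

  coset-ι : ∀ z → Coset₃ l₀ (ι z)
  coset-ι (x , y) = multiple x (proj₁ A) , multiple y (proj₂ A)
    where
    A = g · (0ℤ , 1ℤ)
    multiple : ∀ x r → + 3 ∣ ((+ 3 ℤ.* x ℤ.+ r) ℤ.- r)
    multiple x r = divides x (lem x r)
      where
      lem : ∀ x r → (+ 3 ℤ.* x ℤ.+ r) ℤ.- r ≡ x ℤ.* + 3
      lem = solve-∀

  completeE : ∀ s → Oriented orientation s → ∃[ a ] ∃[ k ] walk (seedE a) k ≡ s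
  completeE s o =
    let a , reach = connected₃ t l₀ (embed s) (oriented⇒valid s o) (coset-ι (start s))
        k , eq    = reach (orbitE a) (embed-seedE a)
    in a , k , embed-injective (walk (seedE a) k) s eq

  -- Shifting both walks by the same amount makes one of them start at its seed. The other seed is
  -- then k - m steps away, or m - k with the roles exchanged, and `separated₃` makes this distance
  -- 0.
  uniqueE : ∀ a k b m → walk (seedE a) k ≡ walk (seedE b) m → (a , k) ≡ (b , m)
  uniqueE a k b m eq = from-difference (k ℤ.- m) refl
    where
    ahead : ∀ a k b m n → walk (seedE a) k ≡ walk (seedE b) m → k ℤ.- m ≡ + n → n ≡ 0 × a ≡ b
    ahead a k b m n eq k-m = n≡0 , seed₃-injective l₀ a b (trans (cong (λ r → D₃.nxt^ t l₀ r (seed₃ l₀ a)) (sym n≡0)) reach)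
      where
      eq′ : embed (walk (seedE a) (- m ℤ.+ k)) ≡ embed (walk (seedE b) (- m ℤ.+ m))
      eq′ = orbit-unique (orbitE a) (orbitE b) k m (cong embed eq) (- m)
      l₁ : ∀ k m → - m ℤ.+ k ≡ k ℤ.- m
      l₁ = solve-∀
      reach : nxt^ l₀ n (seed₃ l₀ a) ≡ seed₃ l₀ b
      reach = begin
        nxt^ l₀ n (seed₃ l₀ a)                   ≡⟨ cong (nxt^ l₀ n) (embed-seedE a) ⟨
        nxt^ l₀ n (embed (seedE a))              ≡⟨ orbit-nxt^ (orbitE a) n ⟨
        embed (walk (seedE a) (+ n))             ≡⟨ cong (λ r → embed (walk (seedE a) r)) (trans (l₁ k m) k-m) ⟨
        embed (walk (seedE a) (- m ℤ.+ k))       ≡⟨ eq′ ⟩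
        embed (walk (seedE b) (- m ℤ.+ m))       ≡⟨ cong (λ r → embed (walk (seedE b) r)) (ℤₚ.+-inverseˡ m) ⟩
        embed (seedE b)                          ≡⟨ embed-seedE b ⟩
        seed₃ l₀ b                               ∎
        where open ≡-Reasoning
      n≡0 : n ≡ 0
      n≡0 = separated₃ t n l₀ a b reach
    l₂ : ∀ k m → m ℤ.- k ≡ - (k ℤ.- m)
    l₂ = solve-∀
    from-difference : ∀ d → k ℤ.- m ≡ d → (a , k) ≡ (b , m)
    from-difference (+ n) k-m = let n≡0 , a≡b = ahead a k b m n eq k-m
      in cong₂ _,_ a≡b (ℤₚ.i-j≡0⇒i≡j k m (trans k-m (cong +_ n≡0)))
    from-difference -[1+ n ] k-m = ⊥-elim (ℕₚ.1+n≢0 (proj₁ (ahead b m a k (suc n) (sym eq) (trans (l₂ k m) (cong -_ k-m)))))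

  open BuildCovering (Fin 4) (λ a → walkCurve (seedE a)) orientation
    (λ a k → valid⇒oriented (walk (seedE a) k) (orbitE a .valid k)) completeE uniqueE public using (covering)

  described : Described covering orientation sign
  described = record
    { oriented = λ a k → valid⇒oriented (walk (seedE a) k) (orbitE a .valid k)
    ; complete = completeE
    ; turning  = λ a k → refl }

-- Folding sequences

-- Lookup with the junk value + beyond the end of the list.
at : List Sign → ℕ → Sign
at []       _       = Sign.+
at (a ∷ as) zero    = a
at (a ∷ as) (suc k) = at as k

at-applyUpTo : ∀ f n k → k ℕ.< n → at (applyUpTo f n) k ≡ f k
at-applyUpTo f (suc n) zero    _         = refl
at-applyUpTo f (suc n) (suc k) (ℕ.s≤s k<) = at-applyUpTo (f ∘ suc) n k k<

at-map : ∀ S k → k ℕ.< length S → at (map opposite S) k ≡ opposite (at S k)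
at-map (a ∷ S) zero    _          = refl
at-map (a ∷ S) (suc k) (ℕ.s≤s k<) = at-map S k k<

at-ʳ++-right : ∀ xs ys k → at (xs ʳ++ ys) (length xs ℕ.+ k) ≡ at ys k
at-ʳ++-right []       ys k = refl
at-ʳ++-right (x ∷ xs) ys k = trans (cong (at (xs ʳ++ (x ∷ ys))) (sym (ℕₚ.+-suc (length xs) k))) (at-ʳ++-right xs (x ∷ ys) (suc k))

at-ʳ++-left : ∀ xs ys m k → m ℕ.+ suc k ≡ length xs → at (xs ʳ++ ys) m ≡ at xs k
at-ʳ++-left []       ys m k       eq with () ← trans (sym (ℕₚ.+-suc m k)) eq
at-ʳ++-left (x ∷ xs) ys m zero    eq = trans (cong (at (xs ʳ++ (x ∷ ys))) m≡) (at-ʳ++-right xs (x ∷ ys) 0)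
  where
  m≡ : m ≡ length xs ℕ.+ 0
  m≡ = trans (ℕₚ.suc-injective (trans (ℕₚ.+-comm 1 m) eq)) (sym (ℕₚ.+-identityʳ (length xs)))
at-ʳ++-left (x ∷ xs) ys m (suc k) eq = at-ʳ++-left xs (x ∷ ys) m k (ℕₚ.suc-injective (trans (sym (ℕₚ.+-suc m (suc k))) eq))

length-folding : ∀ {n S} → Folding n S → suc (length S) ≡ 2 ^ n
length-folding empty = refl
length-folding {suc n} (fold {S = S} ε F) = begin
  suc (length (bar S ++ ε ∷ S))                  ≡⟨ cong suc (length-++ (bar S)) ⟩
  suc (length (bar S) ℕ.+ suc (length S))        ≡⟨ cong (λ r → suc (r ℕ.+ suc (length S))) (trans (length-reverse (map opposite S)) (length-map opposite S)) ⟩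
  suc (length S) ℕ.+ suc (length S)              ≡⟨ cong (λ r → r ℕ.+ r) (length-folding F) ⟩
  2 ^ n ℕ.+ 2 ^ n                                ≡⟨ cong (2 ^ n ℕ.+_) (ℕₚ.+-identityʳ (2 ^ n)) ⟨
  2 ^ suc n                                      ∎
  where open ≡-Reasoning

folding-antisymmetric : ∀ {n L} → Folding (suc n) L → ∀ m k → suc (m ℕ.+ suc k) ≡ 2 ^ n → at L m ≡ opposite (at L (2 ^ n ℕ.+ k))
folding-antisymmetric {n} (fold {S = S} ε F) m k eq = begin
  at (bar S ++ ε ∷ S) m                          ≡⟨ cong (λ L → at L m) (ʳ++-defn (map opposite S)) ⟨
  at (map opposite S ʳ++ (ε ∷ S)) m              ≡⟨ at-ʳ++-left (map opposite S) (ε ∷ S) m k (trans m+k≡ (sym len)) ⟩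
  at (map opposite S) k                          ≡⟨ at-map S k (subst (k ℕ.<_) m+k≡ (ℕₚ.m≤n+m (suc k) m)) ⟩
  opposite (at S k)                              ≡⟨ cong opposite (at-ʳ++-right (map opposite S) (ε ∷ S) (suc k)) ⟨
  opposite (at (map opposite S ʳ++ (ε ∷ S)) (length (map opposite S) ℕ.+ suc k)) ≡⟨ cong (λ r → opposite (at (map opposite S ʳ++ (ε ∷ S)) r)) position ⟩
  opposite (at (map opposite S ʳ++ (ε ∷ S)) (2 ^ n ℕ.+ k)) ≡⟨ cong (λ L → opposite (at L (2 ^ n ℕ.+ k))) (ʳ++-defn (map opposite S)) ⟩
  opposite (at (bar S ++ ε ∷ S) (2 ^ n ℕ.+ k))   ∎
  where
  open ≡-Reasoning
  len : length (map opposite S) ≡ length S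
  len = length-map opposite S
  m+k≡ : m ℕ.+ suc k ≡ length S
  m+k≡ = ℕₚ.suc-injective (trans eq (sym (length-folding F)))
  position : length (map opposite S) ℕ.+ suc k ≡ 2 ^ n ℕ.+ k
  position = trans (ℕₚ.+-suc _ k) (cong (ℕ._+ k) (trans (cong suc len) (length-folding F)))

-- The folding rule without lists: a_m = -a_{2^{n+1} - m} for 0 < m < 2^n, with m = x + 1. The
-- complement y + 1 to 2^n replaces subtraction.
Antisymmetric : (ℕ → Sign) → Set
Antisymmetric a = ∀ n x y → suc x ℕ.+ suc y ≡ 2 ^ n → a (suc x) ≡ opposite (a (2 ^ n ℕ.+ suc y))

infiniteFolding⇒antisymmetric : ∀ a → IsInfiniteFolding a → Antisymmetric a
infiniteFolding⇒antisymmetric a F n x y eq = begin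
  a (suc x)                                         ≡⟨ at-applyUpTo a⁺ len x (bound x (ℕₚ.≤-trans (ℕₚ.m≤m+n (suc (suc x)) (2 ^ n ℕ.+ y)) (ℕₚ.≤-reflexive total))) ⟨
  at (applyUpTo a⁺ len) x                           ≡⟨ folding-antisymmetric (F (suc n)) x y eq ⟩
  opposite (at (applyUpTo a⁺ len) (2 ^ n ℕ.+ y))    ≡⟨ cong opposite (at-applyUpTo a⁺ len (2 ^ n ℕ.+ y) (bound (2 ^ n ℕ.+ y) (ℕₚ.≤-trans (ℕₚ.m≤n+m (suc (suc (2 ^ n ℕ.+ y))) x) (ℕₚ.≤-reflexive total′)))) ⟩
  opposite (a (suc (2 ^ n ℕ.+ y)))                  ≡⟨ cong (opposite ∘ a) (ℕₚ.+-suc (2 ^ n) y) ⟨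
  opposite (a (2 ^ n ℕ.+ suc y))                    ∎
  where
  open ≡-Reasoning
  a⁺ : ℕ → Sign
  a⁺ k = a (suc k)
  len = 2 ^ suc n ∸ 1
  total′ : x ℕ.+ suc (suc (2 ^ n ℕ.+ y)) ≡ 2 ^ suc n
  total′ = trans (l x (2 ^ n) y) (trans (cong (2 ^ n ℕ.+_) eq) (cong (2 ^ n ℕ.+_) (sym (ℕₚ.+-identityʳ (2 ^ n)))))
    where
    l : ∀ x p y → x ℕ.+ suc (suc (p ℕ.+ y)) ≡ p ℕ.+ (suc x ℕ.+ suc y)
    l = ℕ-Solver.solve-∀
  total : suc (suc x) ℕ.+ (2 ^ n ℕ.+ y) ≡ 2 ^ suc n
  total = trans (sym (trans (ℕₚ.+-suc x _) (cong suc (ℕₚ.+-suc x _)))) total′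
  bound : ∀ m → suc (suc m) ℕ.≤ 2 ^ suc n → m ℕ.< len
  bound m m≤ = ℕₚ.∸-monoˡ-≤ 1 m≤

-- The terms of odd index alternate, because the reflection of 2m + 1 in 2^{n+1} is 2r + 1 with r
-- and m of opposite parity. The induction is on the power of two that bounds m.
antisymmetric-odd : ∀ a → Antisymmetric a → ∀ m → a (suc (m ℕ.+ m)) ≡ parℕ m Sign.* a 1
antisymmetric-odd a anti m = go m m (ℕₚ.<-trans (ℕₚ.n<1+n m) (1+m<2^1+m m))
  where
  open ≡-Reasoning
  1+m<2^1+m : ∀ m → suc m ℕ.< 2 ^ suc m
  1+m<2^1+m zero    = ℕₚ.≤-refl
  1+m<2^1+m (suc m) = ℕₚ.≤-trans (ℕ.s≤s (1+m<2^1+m m)) (ℕₚ.+-mono-≤ {1} (ℕₚ.m^n>0 2 (suc m)) (ℕₚ.m≤m+n (2 ^ suc m) 0))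
  go : ∀ n m → m ℕ.< 2 ^ suc n → a (suc (m ℕ.+ m)) ≡ parℕ m Sign.* a 1
  go-above : ∀ n m′ r → r ℕ.+ suc m′ ≡ 2 ^ n → r ℕ.< 2 ^ n → a (suc ((2 ^ n ℕ.+ m′) ℕ.+ (2 ^ n ℕ.+ m′))) ≡ parℕ (2 ^ n ℕ.+ m′) Sign.* a 1
  go-below : ∀ n m → m ℕ.< 2 ^ n → a (suc (m ℕ.+ m)) ≡ parℕ m Sign.* a 1
  go-below zero    zero    _         = refl
  go-below zero    (suc m) (ℕ.s≤s ())
  go-below (suc n) m       m<        = go n m m<
  go-above n m′ r eq r< = begin
    a (suc ((2 ^ n ℕ.+ m′) ℕ.+ (2 ^ n ℕ.+ m′)))       ≡⟨ cong a (l₁ (2 ^ n) m′) ⟩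
    a (2 ^ suc n ℕ.+ suc (m′ ℕ.+ m′))                 ≡⟨ opp-invol _ ⟨
    opposite (opposite (a (2 ^ suc n ℕ.+ suc (m′ ℕ.+ m′)))) ≡⟨ cong opposite (anti (suc n) (r ℕ.+ r) (m′ ℕ.+ m′) (trans (l₂ r m′) (cong (λ p → p ℕ.+ (p ℕ.+ 0)) eq))) ⟨
    opposite (a (suc (r ℕ.+ r)))                      ≡⟨ cong opposite (go-below n r r<) ⟩
    opposite (parℕ r Sign.* a 1)                      ≡⟨ opp-* (parℕ r) (a 1) ⟨
    opposite (parℕ r) Sign.* a 1                      ≡⟨ cong (Sign._* a 1) parity≡ ⟨
    parℕ (2 ^ n ℕ.+ m′) Sign.* a 1                    ∎
    where
    l₁ : ∀ p m → suc ((p ℕ.+ m) ℕ.+ (p ℕ.+ m)) ≡ (p ℕ.+ (p ℕ.+ 0)) ℕ.+ suc (m ℕ.+ m)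
    l₁ = ℕ-Solver.solve-∀
    l₂ : ∀ r m → suc (r ℕ.+ r) ℕ.+ suc (m ℕ.+ m) ≡ (r ℕ.+ suc m) ℕ.+ ((r ℕ.+ suc m) ℕ.+ 0)
    l₂ = ℕ-Solver.solve-∀
    l₃ : ∀ r m → (r ℕ.+ suc m) ℕ.+ m ≡ suc r ℕ.+ (m ℕ.+ m)
    l₃ = ℕ-Solver.solve-∀
    parity≡ : parℕ (2 ^ n ℕ.+ m′) ≡ opposite (parℕ r)
    parity≡ = begin
      parℕ (2 ^ n ℕ.+ m′)                   ≡⟨ cong (λ p → parℕ (p ℕ.+ m′)) eq ⟨
      parℕ ((r ℕ.+ suc m′) ℕ.+ m′)          ≡⟨ cong parℕ (l₃ r m′) ⟩
      parℕ (suc r ℕ.+ (m′ ℕ.+ m′))          ≡⟨ parℕ-+ (suc r) (m′ ℕ.+ m′) ⟩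
      parℕ (suc r) Sign.* parℕ (m′ ℕ.+ m′)  ≡⟨ cong₂ Sign._*_ (parℕ-suc r) (trans (parℕ-+ m′ m′) (Signₚ.s*s≡+ (parℕ m′))) ⟩
      opposite (parℕ r) Sign.* Sign.+       ≡⟨ Signₚ.*-identityʳ _ ⟩
      opposite (parℕ r)                     ∎
  go n m m< with m ℕₚ.<? 2 ^ n
  ... | yes m<′ = go-below n m m<′
  ... | no m≮ = subst (λ m → a (suc (m ℕ.+ m)) ≡ parℕ m Sign.* a 1) (ℕₚ.m+[n∸m]≡n m≥)
      -- The reflected index: 2r + 1 and 2m′ + 1 add up to 2^{n+1} exactly when r + m′ + 1 = 2^n.
      (go-above n m′ (2 ^ n ∸ suc m′) (ℕₚ.m∸n+n≡m m′<) (ℕₚ.∸-monoʳ-< {2 ^ n} ℕ.z<s m′<))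
    where
    m≥ = ℕₚ.≮⇒≥ m≮
    m′ = m ∸ 2 ^ n
    m′< : m′ ℕ.< 2 ^ n
    m′< = ℕₚ.+-cancelˡ-< (2 ^ n) m′ (2 ^ n) (subst₂ ℕ._<_ (sym (ℕₚ.m+[n∸m]≡n m≥)) (cong (2 ^ n ℕ.+_) (ℕₚ.+-identityʳ (2 ^ n))) m<)

double : (ℕ → Sign) → ℕ → Sign
double a k = a (k ℕ.+ k)

antisymmetric-double : ∀ a → Antisymmetric a → Antisymmetric (double a)
antisymmetric-double a anti n x y eq = begin
  a (suc x ℕ.+ suc x)                               ≡⟨ anti (suc n) (x ℕ.+ suc x) (y ℕ.+ suc y) (trans (l₁ x y) (cong (λ p → p ℕ.+ (p ℕ.+ 0)) eq)) ⟩
  opposite (a (2 ^ suc n ℕ.+ (suc y ℕ.+ suc y)))    ≡⟨ cong (opposite ∘ a) (l₂ (2 ^ n) y) ⟩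
  opposite (double a (2 ^ n ℕ.+ suc y))             ∎
  where
  open ≡-Reasoning
  l₁ : ∀ x y → (suc x ℕ.+ suc x) ℕ.+ (suc y ℕ.+ suc y) ≡ (suc x ℕ.+ suc y) ℕ.+ ((suc x ℕ.+ suc y) ℕ.+ 0)
  l₁ = ℕ-Solver.solve-∀
  l₂ : ∀ p y → (p ℕ.+ (p ℕ.+ 0)) ℕ.+ (suc y ℕ.+ suc y) ≡ (p ℕ.+ suc y) ℕ.+ (p ℕ.+ suc y)
  l₂ = ℕ-Solver.solve-∀

-- The turns along a complete curve whose two halves, both read away from the origin, turn like D:
-- reading one of them backwards negates its turns. The value at 0 is the meaningless `a 0`, which
-- is why `turns` excludes it.
extend : (ℕ → Sign) → ℤ → Sign
extend a (+ n)    = a n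
extend a -[1+ n ] = opposite (a (suc n))

extend-odd : ∀ a → Antisymmetric a → ∀ j → extend a (ℤ.suc (j ℤ.+ j)) ≡ par j Sign.* a 1
extend-odd a anti (+ n) = antisymmetric-odd a anti n
extend-odd a anti -[1+ n ] = trans (cong opposite (antisymmetric-odd a anti n))
  (trans (sym (opp-* (parℕ n) (a 1))) (cong (Sign._* a 1) (sym (parℕ-suc n))))

extend-double : ∀ a j → extend (double a) j ≡ extend a (j ℤ.+ j)
extend-double a (+ n)    = refl
extend-double a -[1+ n ] = cong (opposite ∘ a ∘ suc) (ℕₚ.+-suc n n)

halveℤ : ∀ k → ∃[ j ] (k ≡ j ℤ.+ j ⊎ k ≡ ℤ.suc (j ℤ.+ j))
halveℤ (+ n) with halve n
... | j , inj₁ refl = + j , inj₁ refl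
... | j , inj₂ refl = + j , inj₂ refl
halveℤ -[1+ n ] with halve n
... | j , inj₁ refl = -[1+ j ] , inj₂ refl
... | j , inj₂ refl = -[1+ j ] , inj₁ refl

-- The turn at the middle of the pair that leaves 0: `σ-middle` with w = 0, where `hor d` is
-- `h (up l)`, that is `c l`.
lead : Level → Sign
lead l = c l Sign.* h l

up^ : ℕ → Level → Level
up^ zero    l = l
up^ (suc r) l = up^ r (up l)

Fits : Level → (ℕ → Sign) → Set
Fits l a = ∀ r → a (2 ^ r) ≡ lead (up^ r l)

fits-double : ∀ l a → Fits l a → Fits (up l) (double a)
fits-double l a fits r = trans (cong (λ p → a (2 ^ r ℕ.+ p)) (sym (ℕₚ.+-identityʳ (2 ^ r)))) (fits (suc r))

module OrbitTurns (t : Sign) where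
  open Dynamics t 0ℤ

  π-orbit : ∀ {l γ} → Orbit l γ → ∀ k → π (start (γ k)) ≡ par k Sign.* π (start (γ 0ℤ))
  π-orbit {l} {γ} o = ℤ-induction (λ k → π (start (γ k)) ≡ par k Sign.* π (start (γ 0ℤ))) refl
      (λ k eq → trans (π-suc k) (trans (cong opposite eq) (sym (flipped k))))
      (λ k eq → trans (sym (opp-invol _)) (trans (cong opposite (trans (sym (π-suc k)) (trans eq (flipped k)))) (opp-invol _)))
    where
    π-suc : ∀ k → π (start (γ (ℤ.suc k))) ≡ opposite (π (start (γ k)))
    π-suc k = trans (cong (λ s → π (start s)) (o .connected k)) (π-⊕step (start (γ k)) (dir (γ k)))
    flipped : ∀ k → par (ℤ.suc k) Sign.* π (start (γ 0ℤ)) ≡ opposite (par k Sign.* π (start (γ 0ℤ)))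
    flipped k = trans (cong (Sign._* π (start (γ 0ℤ))) (par-+ 1ℤ k)) (opp-* (par k) _)

  module FromOrigin {l γ} (o : Orbit l γ) (γ0≡ : start (γ 0ℤ) ≡ 0[i]) where

    π-origin : ∀ k → π (start (γ k)) ≡ par k
    π-origin k = trans (π-orbit o k) (trans (cong (λ z → par k Sign.* π z) γ0≡) (Signₚ.*-identityʳ (par k)))

    even-segment : ∀ j → child₁ l (parent l γ j) ≡ γ (j ℤ.+ j)
    even-segment j = trans (cong (λ a → child l a (parent l γ j)) (sym (trans (π-origin (j ℤ.+ j)) (par-double j))))
      (child-T l (γ (j ℤ.+ j)) (o .valid (j ℤ.+ j)))

    odd-segment : ∀ j → child₂ l (parent l γ j) ≡ γ (ℤ.suc (j ℤ.+ j))
    odd-segment j = trans (sym (nxt-child₁ l (parent l γ j) (valid-T l (γ (j ℤ.+ j)))))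
      (trans (cong (nxt l) (even-segment j)) (sym (o .connected (j ℤ.+ j))))

    parent-origin : start (parent l γ 0ℤ) ≡ 0[i]
    parent-origin = κ-injective (trans (cong start (even-segment 0ℤ)) γ0≡)

  -- Vertices of odd index are middles of pairs, whose signs alternate as the odd terms of a folding
  -- sequence do. Those of even index are vertices of the parent orbit one level up, whose sequence
  -- is `double a`.
  turns : ∀ a l γ → Antisymmetric a → Fits l a → Orbit l γ → start (γ 0ℤ) ≡ 0[i] →
    ∀ k → k ≢ 0ℤ → σ t l (start (γ k)) ≡ extend a k
  turns a l γ anti fits o γ0≡ k = go ∣ k ∣ a l γ anti fits o γ0≡ k ℕₚ.≤-refl
    where
    open ≡-Reasoning
    even-case : ∀ a l γ → Orbit l γ → start (γ 0ℤ) ≡ 0[i] → ∀ j →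
      σ t (up l) (start (parent l γ j)) ≡ extend (double a) j → σ t l (start (γ (j ℤ.+ j))) ≡ extend a (j ℤ.+ j)
    even-case a l γ o γ0≡ j eq = begin
      σ t l (start (γ (j ℤ.+ j)))              ≡⟨ cong (λ s → σ t l (start s)) (FromOrigin.even-segment o γ0≡ j) ⟨
      σ t l (κ (start (parent l γ j)))         ≡⟨ σ-κ t l (start (parent l γ j)) ⟩
      σ t (up l) (start (parent l γ j))        ≡⟨ eq ⟩
      extend (double a) j                      ≡⟨ extend-double a j ⟩
      extend a (j ℤ.+ j)                       ∎
    odd-case : ∀ a l γ → Antisymmetric a → Fits l a → Orbit l γ → start (γ 0ℤ) ≡ 0[i] → ∀ j →
      σ t l (start (γ (ℤ.suc (j ℤ.+ j)))) ≡ extend a (ℤ.suc (j ℤ.+ j))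
    odd-case a l γ anti fits o γ0≡ j = begin
      σ t l (start (γ (ℤ.suc (j ℤ.+ j))))      ≡⟨ cong (λ s → σ t l (start s)) (FromOrigin.odd-segment o γ0≡ j) ⟨
      σ t l (start (child₂ l s′))              ≡⟨ σ-middle l (start s′) (dir s′) valid′ ⟩
      hor (dir s′) Sign.* h l                  ≡⟨ cong (Sign._* h l) (trans valid′ (cong₂ Sign._*_ (h-up l) π′)) ⟩
      (c l Sign.* par j) Sign.* h l            ≡⟨ cong (Sign._* h l) (Signₚ.*-comm (c l) (par j)) ⟩
      (par j Sign.* c l) Sign.* h l            ≡⟨ Signₚ.*-assoc (par j) (c l) (h l) ⟩
      par j Sign.* lead l                      ≡⟨ cong (par j Sign.*_) (fits 0) ⟨
      par j Sign.* a 1                         ≡⟨ extend-odd a anti j ⟨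
      extend a (ℤ.suc (j ℤ.+ j))               ∎
      where
      s′ = parent l γ j
      valid′ = valid-T l (γ (j ℤ.+ j))
      π′ : π (start s′) ≡ par j
      π′ = FromOrigin.π-origin (parent-orbit o) (FromOrigin.parent-origin o γ0≡) j
    go : ∀ fuel a l γ → Antisymmetric a → Fits l a → Orbit l γ → start (γ 0ℤ) ≡ 0[i] →
      ∀ k → ∣ k ∣ ℕ.≤ fuel → k ≢ 0ℤ → σ t l (start (γ k)) ≡ extend a k
    go zero a l γ anti fits o γ0≡ k k≤ k≢0 = ⊥-elim (k≢0 (ℤₚ.∣i∣≡0⇒i≡0 (ℕₚ.n≤0⇒n≡0 k≤)))
    go (suc fuel) a l γ anti fits o γ0≡ k k≤ k≢0 with halveℤ k
    ... | j , inj₂ refl = odd-case a l γ anti fits o γ0≡ j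
    ... | j , inj₁ refl = even-case a l γ o γ0≡ j
        (go fuel (double a) (up l) (parent l γ) (antisymmetric-double a anti) (fits-double l a fits) (parent-orbit o)
          (FromOrigin.parent-origin o γ0≡) j (bound j j≢0 k≤) j≢0)
      where
      j≢0 : j ≢ 0ℤ
      j≢0 refl = k≢0 refl
      bound : ∀ j → j ≢ 0ℤ → ∣ j ℤ.+ j ∣ ℕ.≤ suc fuel → ∣ j ∣ ℕ.≤ fuel
      bound (+ zero)    j≢0 _  = ⊥-elim (j≢0 refl)
      bound (+ suc n)   _   j≤ = ℕₚ.≤-trans (ℕₚ.m≤n+m (suc n) n) (ℕ.s≤s⁻¹ j≤)
      bound -[1+ n ]    _   j≤ = ℕₚ.≤-trans (ℕ.s≤s (ℕₚ.m≤m+n n n)) (ℕ.s≤s⁻¹ j≤)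

up^-fits : ∀ a → (∀ n → (a (2 ^ (4 ℕ.* n)) ≡ Sign.+) × (a (2 ^ (4 ℕ.* n ℕ.+ 1)) ≡ Sign.+) ×
  (a (2 ^ (4 ℕ.* n ℕ.+ 2)) ≡ Sign.-) × (a (2 ^ (4 ℕ.* n ℕ.+ 3)) ≡ Sign.-)) → ∀ g → Fits (p0 , g) a
up^-fits a hyp g r = go r 0 g
  where
  go : ∀ r n g → a (2 ^ (4 ℕ.* n ℕ.+ r)) ≡ lead (up^ r (p0 , g))
  go 0 n g = trans (cong (λ m → a (2 ^ m)) (ℕₚ.+-identityʳ (4 ℕ.* n))) (trans (proj₁ (hyp n)) (∀-unit {λ g → Sign.+ ≡ lead (p0 , g)} refl refl refl refl g))
  go 1 n g = trans (proj₁ (proj₂ (hyp n))) (∀-unit {λ g → Sign.+ ≡ lead (p1 , g)} refl refl refl refl g)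
  go 2 n g = trans (proj₁ (proj₂ (proj₂ (hyp n)))) (∀-unit {λ g → Sign.- ≡ lead (p2 , g)} refl refl refl refl g)
  go 3 n g = trans (proj₂ (proj₂ (proj₂ (hyp n)))) (∀-unit {λ g → Sign.- ≡ lead (p3 , g)} refl refl refl refl g)
  go (suc (suc (suc (suc r)))) n g = trans (cong (λ m → a (2 ^ m)) (l n r)) (go r (suc n) (-one ∙ g))
    where
    l : ∀ n r → 4 ℕ.* n ℕ.+ (4 ℕ.+ r) ≡ 4 ℕ.* suc n ℕ.+ r
    l = ℕ-Solver.solve-∀

-- Coverings generated by a curve

turn-cancel : ∀ a b e → i^ a ∙ e ≡ i^ b ∙ e → a ≡ b
turn-cancel Sign.+ Sign.+ e _ = refl
turn-cancel Sign.- Sign.- e _ = refl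
turn-cancel Sign.+ Sign.- e = ∀-unit {λ e → i^ Sign.+ ∙ e ≡ i^ Sign.- ∙ e → Sign.+ ≡ Sign.-} (λ ()) (λ ()) (λ ()) (λ ()) e
turn-cancel Sign.- Sign.+ e = ∀-unit {λ e → i^ Sign.- ∙ e ≡ i^ Sign.+ ∙ e → Sign.- ≡ Sign.+} (λ ()) (λ ()) (λ ()) (λ ()) e

hor≡ : ∀ d e → hor d ≡ hor e → d ≡ e ⊎ d ≡ -one ∙ e
hor≡ one  one  _ = inj₁ refl
hor≡ one  -one _ = inj₂ refl
hor≡ -one one  _ = inj₂ refl
hor≡ -one -one _ = inj₁ refl
hor≡ i    i    _ = inj₁ refl
hor≡ i    -i   _ = inj₂ refl
hor≡ -i   i    _ = inj₂ refl
hor≡ -i   -i   _ = inj₁ refl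

turn-opposite : ∀ a e → i^ (opposite a) ∙ (-one ∙ e) ≡ i^ a ∙ e
turn-opposite Sign.+ = ∀-unit refl refl refl refl
turn-opposite Sign.- = ∀-unit refl refl refl refl

axis : Sign → Unit
axis Sign.+ = one
axis Sign.- = i

hor-axis : ∀ a → hor (axis a) ≡ a
hor-axis Sign.+ = refl
hor-axis Sign.- = refl

module CoveringFacts (C : Covering) where
  open CompleteCurve
  open Covering C using (segmentOf; covers; orientation)

  p : Parity
  p = proj₁ orientation

  q : Sign
  q = toSign p

  parity-cases : ∀ z → parityOf z ≡ p ⊎ parityOf z ≡ p ⁻¹
  parity-cases z with sign-cases (π z) q
  ... | inj₁ eq = inj₁ (ℙₚ.toSign-injective eq)
  ... | inj₂ eq = inj₂ (ℙₚ.toSign-injective (trans eq (sym (ℙₚ.⁻¹-homo-opposite p))))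

  π≢ : ∀ z e → z ⊕ ⟦ e ⟧ ≢ z
  π≢ z e eq = opp≢ (π z) (trans (sym (π-end (seg z e))) (cong π eq))

  hor-out : ∀ z e → seg z e ∈ HorizontalOut z → hor e ≡ Sign.+
  hor-out z e (here refl) = refl
  hor-out z e (there (here refl)) = refl
  hor-out z e (there (there (here eq))) = ⊥-elim (π≢ z i (sym (cong start eq)))
  hor-out z e (there (there (there (here eq)))) = ⊥-elim (π≢ z -i (sym (cong start eq)))

  hor-in : ∀ z e → seg z e ∈ HorizontalIn z → hor e ≡ Sign.-
  hor-in z e (here eq) = ⊥-elim (π≢ z one (sym (cong start eq)))
  hor-in z e (there (here eq)) = ⊥-elim (π≢ z -one (sym (cong start eq)))
  hor-in z e (there (there (here refl))) = refl
  hor-in z e (there (there (there (here refl)))) = refl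

  out-hor : ∀ z e → hor e ≡ Sign.+ → seg z e ∈ HorizontalOut z
  out-hor z one  _ = here refl
  out-hor z -one _ = there (here refl)

  in-hor : ∀ z e → hor e ≡ Sign.- → seg z e ∈ HorizontalIn z
  in-hor z i  _ = there (there (here refl))
  in-hor z -i _ = there (there (there (here refl)))

  q*π+ : ∀ z → parityOf z ≡ p → q Sign.* π z ≡ Sign.+
  q*π+ z eq = trans (cong (λ r → q Sign.* toSign r) eq) (Signₚ.s*s≡+ q)

  q*π- : ∀ z → parityOf z ≡ p ⁻¹ → q Sign.* π z ≡ Sign.-
  q*π- z eq = sym (*-opp-self q (trans (cong toSign eq) (ℙₚ.⁻¹-homo-opposite p)) refl)

  oriented : ∀ c k → Oriented q (segmentAt (curve C c) k)
  oriented c k = go (parity-cases (start s))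
    where
    s = segmentAt (curve C c) k
    go : parityOf (start s) ≡ p ⊎ parityOf (start s) ≡ p ⁻¹ → Oriented q s
    go (inj₁ eq) = trans (hor-out (start s) (dir s) (Equivalence.to (proj₁ (proj₂ orientation (start s)) eq s) (((c , k) , refl) , inj₁ refl)))
      (sym (q*π+ (start s) eq))
    go (inj₂ eq) = trans (hor-in (start s) (dir s) (Equivalence.to (proj₂ (proj₂ orientation (start s)) eq s) (((c , k) , refl) , inj₁ refl)))
      (sym (q*π- (start s) eq))

  complete : ∀ s → Oriented q s → ∃[ c ] ∃[ k ] segmentAt (curve C c) k ≡ s
  complete s@(seg z e) o = go (parity-cases z)
    where
    go : parityOf z ≡ p ⊎ parityOf z ≡ p ⁻¹ → ∃[ c ] ∃[ k ] segmentAt (curve C c) k ≡ s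
    go (inj₁ eq) = let ((c , k) , eq′) , _ = Equivalence.from (proj₁ (proj₂ orientation z) eq s) (out-hor z e (trans o (q*π+ z eq)))
      in c , k , eq′
    go (inj₂ eq) = let ((c , k) , eq′) , _ = Equivalence.from (proj₂ (proj₂ orientation z) eq s) (in-hor z e (trans o (q*π- z eq)))
      in c , k , eq′

  unique : ∀ ck ck′ → segmentOf ck ≡ segmentOf ck′ → ck ≡ ck′
  unique ck ck′ eq = go (segmentOf ck′) refl
    where
    same : ∀ z ε → ε ∈ one ∷ i ∷ [] → (segmentOf ck′ ≡ seg z ε ⊎ segmentOf ck′ ≡ flip (seg z ε)) → ck ≡ ck′
    same z ε ε∈ cover = let _ , _ , uniq = covers z ε ε∈
      in trans (sym (uniq (subst (λ s → s ≡ seg z ε ⊎ s ≡ flip (seg z ε)) (sym eq) cover))) (uniq cover)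
    flipped : ∀ z e → seg z (-one ∙ e) ≡ flip (seg (z ⊖ ⟦ e ⟧) e)
    flipped z e = cong (λ w → seg w (-one ∙ e)) (sym (⊖-⊕ z ⟦ e ⟧))
    go : ∀ s → segmentOf ck′ ≡ s → ck ≡ ck′
    go (seg z one)  s≡ = same z one (here refl) (inj₁ s≡)
    go (seg z i)    s≡ = same z i (there (here refl)) (inj₁ s≡)
    go (seg z -one) s≡ = same (z ⊖ ⟦ one ⟧) one (here refl) (inj₂ (trans s≡ (flipped z one)))
    go (seg z -i)   s≡ = same (z ⊖ ⟦ i ⟧) i (there (here refl)) (inj₂ (trans s≡ (flipped z i)))

  suc-injective : ∀ {k m} → ℤ.suc k ≡ ℤ.suc m → k ≡ m
  suc-injective {k} {m} eq = trans (sym (ℤₚ.pred-suc k)) (trans (cong ℤ.pred eq) (ℤₚ.pred-suc m))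

  -- Two different segments arriving at a vertex have opposite directions. If they turned
  -- differently, they would leave along the same segment, against uniqueness.
  same-turn : ∀ c k c′ k′ → end (segmentAt (curve C c) k) ≡ end (segmentAt (curve C c′) k′) → turn (curve C c) k ≡ turn (curve C c′) k′
  same-turn c k c′ k′ eq = go (hor≡ (dir s′) (dir s) (trans (hor-end q s′ (oriented c′ k′)) (trans (cong (λ z → opposite (q Sign.* π z)) (sym eq)) (sym (hor-end q s (oriented c k))))))
      (sign-cases a′ a)
    where
    s  = segmentAt (curve C c) k
    s′ = segmentAt (curve C c′) k′
    a  = turn (curve C c) k
    a′ = turn (curve C c′) k′
    from-index : (c , k) ≡ (c′ , k′) → a ≡ a′
    from-index = cong (λ (c , k) → turn (curve C c) k)
    go : dir s′ ≡ dir s ⊎ dir s′ ≡ -one ∙ dir s → a′ ≡ a ⊎ a′ ≡ opposite a → a ≡ a′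
    go _ (inj₁ a≡) = sym a≡
    go (inj₁ d≡) (inj₂ _) = from-index (unique (c , k) (c′ , k′) (trans (at-end {s} eq)
      (trans (cong (λ d → seg (end s′ ⊖ ⟦ d ⟧) d) (sym d≡)) (sym (at-end {s′} refl)))))
    go (inj₂ d≡) (inj₂ a≡) = from-index (pred-index (unique (c , ℤ.suc k) (c′ , ℤ.suc k′) (begin
        segmentAt (curve C c) (ℤ.suc k)    ≡⟨ connected (curve C c) k ⟩
        seg (end s) (i^ a ∙ dir s)         ≡⟨ cong₂ seg eq (sym (turn-opposite a (dir s))) ⟩
        seg (end s′) (i^ (opposite a) ∙ (-one ∙ dir s)) ≡⟨ cong₂ (λ b d → seg (end s′) (i^ b ∙ d)) a≡ d≡ ⟨
        seg (end s′) (i^ a′ ∙ dir s′)      ≡⟨ connected (curve C c′) k′ ⟨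
        segmentAt (curve C c′) (ℤ.suc k′)  ∎)))
      where
      open ≡-Reasoning
      pred-index : (c , ℤ.suc k) ≡ (c′ , ℤ.suc k′) → (c , k) ≡ (c′ , k′)
      pred-index eq = cong₂ _,_ (cong proj₁ eq) (suc-injective (cong proj₂ eq))

-- Rotations about the initial point

·-⊕ : ∀ u z w → u · (z ⊕ w) ≡ (u · z) ⊕ (u · w)
·-⊕ one  z w = refl
·-⊕ i    (a , b) (x , y) = pair (ℤₚ.neg-distrib-+ b y) refl
·-⊕ -one (a , b) (x , y) = pair (ℤₚ.neg-distrib-+ a x) (ℤₚ.neg-distrib-+ b y)
·-⊕ -i   (a , b) (x , y) = pair refl (ℤₚ.neg-distrib-+ a x)

⟦∙⟧ : ∀ u e → u · ⟦ e ⟧ ≡ ⟦ u ∙ e ⟧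
⟦∙⟧ = ∀-unit (∀-unit refl refl refl refl) (∀-unit refl refl refl refl) (∀-unit refl refl refl refl) (∀-unit refl refl refl refl)

turn-∙ : ∀ a u e → u ∙ (i^ a ∙ e) ≡ i^ a ∙ (u ∙ e)
turn-∙ Sign.+ = ∀-unit (∀-unit refl refl refl refl) (∀-unit refl refl refl refl) (∀-unit refl refl refl refl) (∀-unit refl refl refl refl)
turn-∙ Sign.- = ∀-unit (∀-unit refl refl refl refl) (∀-unit refl refl refl refl) (∀-unit refl refl refl refl) (∀-unit refl refl refl refl)

rotate-end : ∀ x u s → start (rotate x u (next Sign.+ s)) ≡ end (rotate x u s)
rotate-end x u (seg z e) = begin
  x ⊕ u · ((z ⊕ ⟦ e ⟧) ⊖ x)             ≡⟨ cong (λ w → x ⊕ u · w) (⊕-swap z ⟦ e ⟧ (neg x)) ⟩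
  x ⊕ u · ((z ⊖ x) ⊕ ⟦ e ⟧)             ≡⟨ cong (x ⊕_) (·-⊕ u (z ⊖ x) ⟦ e ⟧) ⟩
  x ⊕ ((u · (z ⊖ x)) ⊕ (u · ⟦ e ⟧))     ≡⟨ ⊕-assoc x (u · (z ⊖ x)) (u · ⟦ e ⟧) ⟨
  (x ⊕ u · (z ⊖ x)) ⊕ (u · ⟦ e ⟧)       ≡⟨ cong ((x ⊕ u · (z ⊖ x)) ⊕_) (⟦∙⟧ u e) ⟩
  (x ⊕ u · (z ⊖ x)) ⊕ ⟦ u ∙ e ⟧         ∎
  where
  open ≡-Reasoning
  neg : ℤ[i] → ℤ[i]
  neg (a , b) = - a , - b

rotate-next : ∀ x u a s → rotate x u (next a s) ≡ next a (rotate x u s)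
rotate-next x u a s = cong₂ seg (rotate-end x u s) (turn-∙ a u (dir s))

⊖-self : ∀ z → z ⊖ z ≡ 0[i]
⊖-self (a , b) = pair (ℤₚ.+-inverseʳ a) (ℤₚ.+-inverseʳ b)

·-0 : ∀ u → u · 0[i] ≡ 0[i]
·-0 = ∀-unit refl refl refl refl

⊕-identityʳ : ∀ z → z ⊕ 0[i] ≡ z
⊕-identityʳ (a , b) = pair (ℤₚ.+-identityʳ a) (ℤₚ.+-identityʳ b)

rotate-first : ∀ u z e → rotate z u (seg z e) ≡ seg z (u ∙ e)
rotate-first u z e = cong (λ w → seg w (u ∙ e)) (trans (cong (λ w → z ⊕ u · w) (⊖-self z)) (trans (cong (z ⊕_) (·-0 u)) (⊕-identityʳ z)))

quotient : Unit → Unit → Unit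
quotient d one  = d
quotient d i    = -i ∙ d
quotient d -one = -one ∙ d
quotient d -i   = i ∙ d

quotient-∙ : ∀ d e → quotient d e ∙ e ≡ d
quotient-∙ = ∀-unit (∀-unit refl refl refl refl) (∀-unit refl refl refl refl) (∀-unit refl refl refl refl) (∀-unit refl refl refl refl)

⊕⟦⟧ : ∀ z e → z ⊕ ⟦ e ⟧ ≡ z ⊖ ⟦ -one ∙ e ⟧
⊕⟦⟧ z = ∀-unit refl refl refl refl

-one-invol : ∀ e → -one ∙ (-one ∙ e) ≡ e
-one-invol = ∀-unit refl refl refl refl

module Generated (C : Covering) (D : HalfCurve) (anti : Antisymmetric (HalfCurve.turn D))
  (fits : ∀ g → Fits (p0 , g) (HalfCurve.turn D)) (gen : GeneratedBy C D) where

  open CoveringFacts C using (q; oriented; complete; same-turn)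
  open CompleteCurve

  a : ℕ → Sign
  a = HalfCurve.turn D

  x : ℤ[i]
  x = HalfCurve.initialPoint D

  -- This choice makes `h l₀` equal to `q * π x`, so that the even point 0 emits segments of the
  -- same axis as x does in C.
  g : Unit
  g = axis (q Sign.* π x)

  incoming : ∃[ c ] ∃[ k ] end (segmentAt (curve C c) k) ≡ x
  incoming = let c , k , eq = complete (seg (x ⊖ ⟦ e ⟧) e) o in c , k , trans (cong end eq) (⊖-⊕ x ⟦ e ⟧)
    where
    e = axis (opposite (q Sign.* π x))
    o : Oriented q (seg (x ⊖ ⟦ e ⟧) e)
    o = oriented-arriving q x e (hor-axis (opposite (q Sign.* π x)))

  -- The sign of C at x, the only one that the four copies of D leave open. By `same-turn`, any
  -- segment ending at x gives the same value.
  t : Sign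
  t = turn (curve C (proj₁ incoming)) (proj₁ (proj₂ incoming))

  l₀ : Level
  l₀ = p0 , g

  open Embedding t 0ℤ l₀ (0[i] ⊖ x) public

  ι-x : ι x ≡ 0[i]
  ι-x = pair (l (proj₁ x)) (l (proj₂ x))
    where
    l : ∀ a → 1ℤ ℤ.* a ℤ.+ (0ℤ ℤ.- a) ≡ 0ℤ
    l = solve-∀

  orientation≡q : orientation ≡ q
  orientation≡q = trans (cong₂ Sign._*_ (hor-axis (q Sign.* π x)) (π-⊖ 0[i] x)) (trans (Signₚ.*-assoc q (π x) (π x))
    (trans (cong (q Sign.*_) (Signₚ.s*s≡+ (π x))) (Signₚ.*-identityʳ q)))

  ray-dir : Fin 2 → Unit
  ray-dir b = dir (seed₁ l₀ b)

  line : Fin 2 → ℤ → Segment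
  line b = walk (seg x (ray-dir b))

  embed-line-0 : ∀ b → embed (line b 0ℤ) ≡ seed₁ l₀ b
  embed-line-0 b = trans (cong (λ z → seg z (ray-dir b)) ι-x) (seed₁-start b)
    where
    seed₁-start : ∀ b → seg 0[i] (ray-dir b) ≡ seed₁ l₀ b
    seed₁-start 0F = refl
    seed₁-start 1F = refl

  line-orbit : ∀ b → Orbit l₀ (λ k → embed (line b k))
  line-orbit b = embed-orbit (line b) (walk-suc (seg x (ray-dir b))) (subst (Valid l₀) (sym (embed-line-0 b)) (valid-seed₁ t l₀ b))

  line-oriented : ∀ b k → Oriented q (line b k)
  line-oriented b k = subst (λ r → Oriented r (line b k)) orientation≡q (valid⇒oriented (line b k) (line-orbit b .valid k))

  line-turns : ∀ b k → k ≢ 0ℤ → sign (start (line b k)) ≡ extend a k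
  line-turns b = OrbitTurns.turns t a l₀ (λ k → embed (line b k)) anti (fits g) (line-orbit b) ι-x

  rotated : Unit → ℕ → Segment
  rotated u m = rotate x u (HalfCurve.segmentAt D m)

  ε : Unit
  ε = dir (HalfCurve.first D)

  rotated-0 : ∀ d → rotated (quotient d ε) 0 ≡ seg x d
  rotated-0 d = trans (rotate-first (quotient d ε) x ε) (cong (seg x) (quotient-∙ d ε))

  line-ahead : ∀ b m → rotated (quotient (ray-dir b) ε) m ≡ line b (+ m)
  line-ahead b zero    = rotated-0 (ray-dir b)
  line-ahead b (suc m) = trans (rotate-next x (quotient (ray-dir b) ε) (a (suc m)) (HalfCurve.segmentAt D m))
    (cong₂ next (sym (line-turns b (+ suc m) (λ ()))) (line-ahead b m))

  back-dir : Fin 2 → Unit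
  back-dir b = -one ∙ dir (line b -1ℤ)

  flip-next : ∀ a s → seg (end s ⊖ ⟦ i^ a ∙ dir (flip s) ⟧) (i^ a ∙ dir (flip s)) ≡ flip (next a s)
  flip-next a s = trans (cong (λ d → seg (end s ⊖ ⟦ d ⟧) d) (sym (turn-∙ a -one (dir s))))
    (cong (λ z → seg z (-one ∙ (i^ a ∙ dir s))) (sym (⊕⟦⟧ (end s) (i^ a ∙ dir s))))

  -- Reversal negates turns, and so does `extend` at negative indices; hence the part of a line
  -- before x, read away from x, turns as D does.
  line-behind : ∀ b m → line b -[1+ m ] ≡ flip (rotated (quotient (back-dir b) ε) m)
  line-behind b zero = sym (trans (cong flip (rotated-0 (back-dir b)))
    (cong₂ seg (trans (⊕⟦⟧ x (back-dir b)) (cong (λ d → x ⊖ ⟦ d ⟧) (-one-invol (dir (line b -1ℤ))))) (-one-invol (dir (line b -1ℤ)))))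
  line-behind b (suc m) = begin
    backward (line b -[1+ m ])                     ≡⟨ cong (λ r → let e = i^ r ∙ dir s in seg (start s ⊖ ⟦ e ⟧) e) turn≡ ⟩
    seg (start s ⊖ ⟦ i^ (a (suc m)) ∙ dir s ⟧) (i^ (a (suc m)) ∙ dir s)
      ≡⟨ cong (λ r → seg (start r ⊖ ⟦ i^ (a (suc m)) ∙ dir r ⟧) (i^ (a (suc m)) ∙ dir r)) (line-behind b m) ⟩
    _                                              ≡⟨ flip-next (a (suc m)) (rotated u m) ⟩
    flip (next (a (suc m)) (rotated u m))          ≡⟨ cong flip (rotate-next x u (a (suc m)) (HalfCurve.segmentAt D m)) ⟨
    flip (rotated u (suc m))                       ∎
    where
    open ≡-Reasoning
    s = line b -[1+ m ]
    u = quotient (back-dir b) ε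
    turn≡ : opposite (sign (start s)) ≡ a (suc m)
    turn≡ = trans (cong opposite (line-turns b -[1+ m ] (λ ()))) (opp-invol (a (suc m)))

  -- Proved for all k except -1: that pair of segments meets at x, and generation does not say how
  -- the four copies of D are joined there. The orientation of C decides which copies occur
  -- reversed.
  Follows : Fin 2 → ℤ → Set
  Follows b k = ∃[ c ] ∃[ m ] segmentAt (curve C c) m ≡ line b k × segmentAt (curve C c) (ℤ.suc m) ≡ line b (ℤ.suc k)

  not-reversed : ∀ {c k} s → segmentAt (curve C c) k ≡ flip s → ¬ Oriented q s
  not-reversed {c} {k} s eq o = ¬oriented-flip {q} s o (subst (Oriented q) eq (oriented c k))

  follows-ahead : ∀ b m → Follows b (+ m)
  follows-ahead b m = go (proj₂ (gen u))
    where
    u = quotient (ray-dir b) ε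
    go : SubcurveUpToReversal (rotated u) (curve C (proj₁ (gen u))) → Follows b (+ m)
    go (inj₁ (k , f)) = proj₁ (gen u) , k ℤ.+ + m , trans (f m) (line-ahead b m) ,
      trans (cong (segmentAt (curve C (proj₁ (gen u)))) (sym (+suc k m))) (trans (f (suc m)) (line-ahead b (suc m)))
    go (inj₂ (k , f)) = ⊥-elim (not-reversed (line b 0ℤ) (trans (f 0) (cong flip (line-ahead b 0))) (line-oriented b 0ℤ))

  follows-behind : ∀ b m → Follows b -[1+ suc m ]
  follows-behind b m = go (proj₂ (gen u))
    where
    u = quotient (back-dir b) ε
    c₀ = proj₁ (gen u)
    l : ∀ k m → k ℤ.- m ≡ 1ℤ ℤ.+ (k ℤ.- (1ℤ ℤ.+ m))
    l = solve-∀
    go : SubcurveUpToReversal (rotated u) (curve C c₀) → Follows b -[1+ suc m ]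
    go (inj₁ (k , f)) = ⊥-elim (¬oriented-flip {q} (rotated u 0) (subst (Oriented q) (f 0) (oriented c₀ (k ℤ.+ 0ℤ)))
      (subst (Oriented q) (line-behind b 0) (line-oriented b -1ℤ)))
    go (inj₂ (k , f)) = c₀ , k ℤ.- + suc m , trans (f (suc m)) (sym (line-behind b (suc m))) ,
      trans (cong (segmentAt (curve C c₀)) (sym (l k (+ m)))) (trans (f m) (sym (line-behind b m)))

  follows-turn : ∀ b k → Follows b k → ∃[ c ] ∃[ m ]
    end (segmentAt (curve C c) m) ≡ start (line b (ℤ.suc k)) × turn (curve C c) m ≡ sign (start (line b (ℤ.suc k)))
  follows-turn b k (c , m , eq , eq′) = c , m , trans (cong end eq) (sym (cong start line≡)) ,
    trans (turn-cancel _ _ (dir (line b k)) (cong dir (begin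
      next (turn (curve C c) m) (line b k)                    ≡⟨ cong (next (turn (curve C c) m)) eq ⟨
      next (turn (curve C c) m) (segmentAt (curve C c) m)     ≡⟨ connected (curve C c) m ⟨
      segmentAt (curve C c) (ℤ.suc m)                         ≡⟨ eq′ ⟩
      line b (ℤ.suc k)                                        ≡⟨ line≡ ⟩
      next (sign (end (line b k))) (line b k)                 ∎)))
      (cong sign (sym (cong start line≡)))
    where
    open ≡-Reasoning
    line≡ : line b (ℤ.suc k) ≡ forward (line b k)
    line≡ = walk-suc (seg x (ray-dir b)) k

  Turned : ℤ[i] → Set
  Turned z = ∃[ c ] ∃[ m ] end (segmentAt (curve C c) m) ≡ z × turn (curve C c) m ≡ sign z

  turned-line : ∀ b k → k ≢ 0ℤ → Turned (start (line b k))
  turned-line b (+ zero)  k≢0 = ⊥-elim (k≢0 refl)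
  turned-line b (+ suc m) _   = follows-turn b (+ m) (follows-ahead b m)
  -- The vertex where segment k starts is the one between segments k - 1 and k, hence the shift of
  -- the index.
  turned-line b -[1+ m ]  _   = follows-turn b -[1+ suc m ] (follows-behind b m)

  -- By `connected₁` some segment leaving z lies on one of the two model lines through x, whose
  -- halves are the copies of D contained in C.
  turned : ∀ z → z ≢ x → Turned z
  turned z z≢x =
    let b , reach = connected₁ t l₀ (embed s) (oriented⇒valid s (subst (λ r → Oriented r s) (sym orientation≡q) (hor-axis (q Sign.* π z))))
        k , eq    = reach (line-orbit b) (embed-line-0 b)
        line≡     = embed-injective (line b k) s eq
    in subst Turned (cong start line≡) (turned-line b k λ k≡0 → z≢x (trans (sym (cong start line≡)) (cong (λ r → start (line b r)) k≡0)))
    where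
    s = seg z (axis (q Sign.* π z))

  turned-x : Turned x
  turned-x = let c , m , eq = incoming in c , m , eq , sym (cong (σ t l₀) ι-x)

  described : Described C orientation sign
  described = record
    { oriented = λ c k → subst (λ r → Oriented r (segmentAt (curve C c) k)) (sym orientation≡q) (oriented c k)
    ; complete = λ s o → complete s (subst (λ r → Oriented r s) orientation≡q o)
    ; turning  = λ c k → let c′ , m , eq , eq′ = turned-all (end (segmentAt (curve C c) k))
                         in trans (same-turn c k c′ m (sym eq)) eq′ }
    where
    turned-all : ∀ z → Turned z
    turned-all z with z ≟ᵖ x
    ... | yes refl = turned-x
    ... | no z≢x   = turned z z≢x

-- Local isomorphism

κ-⊛ : ∀ m w → m ⊛ κ w ≡ κ (m ⊛ w)
κ-⊛ m (x , y) = pair (l₁ m x y) (ℤₚ.*-distribˡ-+ m y x)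
  where
  l₁ : ∀ m x y → m ℤ.* (x ℤ.- y) ≡ m ℤ.* x ℤ.- m ℤ.* y
  l₁ = solve-∀

⊛-0 : ∀ m → m ⊛ 0[i] ≡ 0[i]
⊛-0 m = pair (ℤₚ.*-zeroʳ m) (ℤₚ.*-zeroʳ m)

dbl : ℤ[i] → ℤ[i]
dbl u = u ⊕ u

dbl^ : ℕ → ℤ[i] → ℤ[i]
dbl^ zero    u = u
dbl^ (suc k) u = dbl (dbl^ k u)

16^ : ℕ → ℤ[i] → ℤ[i]
16^ zero    u = u
16^ (suc k) u = + 16 ⊛ 16^ k u

dbl-⊛ : ∀ m K u → m ⊛ dbl^ K u ≡ dbl^ K (m ⊛ u)
dbl-⊛ m zero    u = refl
dbl-⊛ m (suc K) u = trans (pair (ℤₚ.*-distribˡ-+ m _ _) (ℤₚ.*-distribˡ-+ m _ _)) (cong dbl (dbl-⊛ m K u))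

16^-divisible : ∀ K k u → K ℕ.≤ k → ∃[ u′ ] 16^ k u ≡ dbl^ K u′
16^-divisible zero    k       u _ = 16^ k u , refl
16^-divisible (suc K) (suc k) u (ℕ.s≤s K≤k) with u′ , eq ← 16^-divisible K k u K≤k =
  + 8 ⊛ u′ , trans (cong (+ 16 ⊛_) eq) (trans (pair (l _) (l _)) (cong dbl (dbl-⊛ (+ 8) K u′)))
  where
  l : ∀ x → + 16 ℤ.* x ≡ + 8 ℤ.* x ℤ.+ + 8 ℤ.* x
  l = solve-∀

-- Multiplication by 1 - i.
κ′ : ℤ[i] → ℤ[i]
κ′ (x , y) = x ℤ.+ y , y ℤ.- x

dbl≡κ : ∀ u → dbl u ≡ κ (κ′ u)
dbl≡κ (x , y) = pair (l₁ x y) (l₂ x y)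
  where
  l₁ : ∀ x y → x ℤ.+ x ≡ (x ℤ.+ y) ℤ.- (y ℤ.- x)
  l₁ = solve-∀
  l₂ : ∀ x y → y ℤ.+ y ≡ (y ℤ.- x) ℤ.+ (x ℤ.+ y)
  l₂ = solve-∀

κ′-dbl^ : ∀ K u → κ′ (dbl^ K u) ≡ dbl^ K (κ′ u)
κ′-dbl^ zero    u = refl
κ′-dbl^ (suc K) u = trans (κ′-dbl (dbl^ K u)) (cong dbl (κ′-dbl^ K u))
  where
  l₁ : ∀ x y → (x ℤ.+ x) ℤ.+ (y ℤ.+ y) ≡ (x ℤ.+ y) ℤ.+ (x ℤ.+ y)
  l₁ = solve-∀
  l₂ : ∀ x y → (y ℤ.+ y) ℤ.- (x ℤ.+ x) ≡ (y ℤ.- x) ℤ.+ (y ℤ.- x)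
  l₂ = solve-∀
  κ′-dbl : ∀ u → κ′ (dbl u) ≡ dbl (κ′ u)
  κ′-dbl (x , y) = pair (l₁ x y) (l₂ x y)

κ⁴ : ∀ z → κ (κ (κ (κ z))) ≡ - + 4 ⊛ z
κ⁴ (x , y) = pair (l₁ x y) (l₂ x y)
  where
  l₁ : ∀ x y → ((x ℤ.- y) ℤ.- (y ℤ.+ x) ℤ.- ((y ℤ.+ x) ℤ.+ (x ℤ.- y))) ℤ.- (((y ℤ.+ x) ℤ.+ (x ℤ.- y)) ℤ.+ ((x ℤ.- y) ℤ.- (y ℤ.+ x))) ≡ - + 4 ℤ.* x
  l₁ = solve-∀
  l₂ : ∀ x y → (((y ℤ.+ x) ℤ.+ (x ℤ.- y)) ℤ.+ ((x ℤ.- y) ℤ.- (y ℤ.+ x))) ℤ.+ ((x ℤ.- y) ℤ.- (y ℤ.+ x) ℤ.- ((y ℤ.+ x) ℤ.+ (x ℤ.- y))) ≡ - + 4 ℤ.* y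
  l₂ = solve-∀

κ⁸ : ∀ z → κ (κ (κ (κ (κ (κ (κ (κ z))))))) ≡ + 16 ⊛ z
κ⁸ z = trans (κ⁴ (κ (κ (κ (κ z))))) (trans (cong (- + 4 ⊛_) (κ⁴ z)) (pair (l (proj₁ z)) (l (proj₂ z))))
  where
  l : ∀ x → - + 4 ℤ.* (- + 4 ℤ.* x) ≡ + 16 ℤ.* x
  l = solve-∀

up⁸ : ∀ l → up^ 8 l ≡ l
up⁸ (p , g) = ∀-phase {λ p → up^ 8 (p , g) ≡ (p , g)} (eq p0) (eq p1) (eq p2) (eq p3) p
  where
  eq : ∀ p → (p , -one ∙ (-one ∙ g)) ≡ (p , g)
  eq p = cong (p ,_) (-one-invol g)

π-16 : ∀ z → π (+ 16 ⊛ z) ≡ Sign.+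
π-16 z = trans (cong π (sym (κ⁸ z))) (π-κ (κ (κ (κ (κ (κ (κ (κ z))))))))

module Continuity (t : Sign) where

  σ-⊛ : ∀ j l z → σ t l (odd j ⊛ z) ≡ σ t l z
  σ-⊛ j l z with z ≟ᵖ 0[i]
  ... | yes refl = cong (σ t l) (⊛-0 (odd j))
  ... | no z≢0   = κ-induction (λ l z → σ t l (odd j ⊛ z) ≡ σ t l z)
    (λ l z p → trans (σ-odd t l (odd j ⊛ z) (trans (π-⊛ j z) p))
      (trans (cong (λ a → c l Sign.* opposite a) (par-odd* j (proj₁ z))) (sym (σ-odd t l z p))))
    (λ l w _ eq → trans (cong (σ t l) (κ-⊛ (odd j) w)) (trans (σ-κ t l (odd j ⊛ w)) (trans eq (sym (σ-κ t l w)))))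
    l z z≢0

  -- 16 = (1 + i)⁸, and eight steps restore the phase and change the sign of g twice. The fourth
  -- power, -4, would leave g negated.
  σ-16 : ∀ l z → σ t l (+ 16 ⊛ z) ≡ σ t l z
  σ-16 l z = trans (cong (σ t l) (sym (κ⁸ z))) (trans (σ-κ^ 8 l z) (cong (λ r → σ t r z) (up⁸ l)))
    where
    κ^ : ℕ → ℤ[i] → ℤ[i]
    κ^ zero    z = z
    κ^ (suc n) z = κ (κ^ n z)
    σ-κ^ : ∀ n l z → σ t l (κ^ n z) ≡ σ t (up^ n l) z
    σ-κ^ zero    l z = refl
    σ-κ^ (suc n) l z = trans (σ-κ t l (κ^ n z)) (σ-κ^ n (up l) z)

  σ-16^ : ∀ k l z → σ t l (16^ k z) ≡ σ t l z
  σ-16^ zero    l z = refl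
  σ-16^ (suc k) l z = trans (σ-16 l (16^ k z)) (σ-16^ k l z)

  -- At odd z, adding an even multiple preserves both coordinate parities. Each factor 1 + i of z
  -- costs one more factor 2 = (1 + i)(1 - i) of the perturbation.
  locally-constant : ∀ l z → z ≢ 0[i] → ∃[ K ] ∀ u → σ t l (z ⊕ dbl^ K u) ≡ σ t l z
  locally-constant = κ-induction (λ l z → ∃[ K ] ∀ u → σ t l (z ⊕ dbl^ K u) ≡ σ t l z) odd-case κ-case
    where
    open ≡-Reasoning
    *-even : ∀ {a b} → b ≡ Sign.+ → a Sign.* b ≡ a
    *-even {a} refl = Signₚ.*-identityʳ a
    odd-case : ∀ l z → π z ≡ Sign.- → ∃[ K ] ∀ u → σ t l (z ⊕ dbl^ K u) ≡ σ t l z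
    odd-case l z p = 1 , λ u → begin
      σ t l (z ⊕ dbl u)            ≡⟨ σ-odd t l (z ⊕ dbl u) (trans (π-⊕ z (dbl u)) (trans (*-even (trans (π-⊕ u u) (Signₚ.s*s≡+ (π u)))) p)) ⟩
      c l Sign.* τ (z ⊕ dbl u)     ≡⟨ cong (λ a → c l Sign.* opposite a) (trans (ρ-⊕ z (dbl u)) (*-even (par-double (proj₁ u)))) ⟩
      c l Sign.* τ z               ≡⟨ σ-odd t l z p ⟨
      σ t l z                      ∎
    κ-case : ∀ l w → w ≢ 0[i] → ∃[ K ] (∀ u → σ t (up l) (w ⊕ dbl^ K u) ≡ σ t (up l) w) →
      ∃[ K ] ∀ u → σ t l (κ w ⊕ dbl^ K u) ≡ σ t l (κ w)
    κ-case l w _ (K , const) = suc K , λ u → begin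
      σ t l (κ w ⊕ dbl (dbl^ K u))         ≡⟨ cong (λ v → σ t l (κ w ⊕ v)) (trans (dbl≡κ (dbl^ K u)) (cong κ (κ′-dbl^ K u))) ⟩
      σ t l (κ w ⊕ κ (dbl^ K (κ′ u)))    ≡⟨ cong (σ t l) (κ-⊕ w (dbl^ K (κ′ u))) ⟨
      σ t l (κ (w ⊕ dbl^ K (κ′ u)))      ≡⟨ σ-κ t l (w ⊕ dbl^ K (κ′ u)) ⟩
      σ t (up l) (w ⊕ dbl^ K (κ′ u))     ≡⟨ const (κ′ u) ⟩
      σ t (up l) w                         ≡⟨ σ-κ t l w ⟨
      σ t l (κ w)                          ∎

  -- Keeping z ≠ 0 as a premise allows one bound K for a whole list of vertices, even when one of
  -- them is sent to 0.
  Stable : Level → ℤ[i] → ℕ → Set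
  Stable l z K = z ≢ 0[i] → ∀ k → K ℕ.≤ k → ∀ u → σ t l (z ⊕ 16^ k u) ≡ σ t l z

  stable : ∀ l z → ∃[ K ] Stable l z K
  stable l z with z ≟ᵖ 0[i]
  ... | yes z≡0 = 0 , λ z≢0 → ⊥-elim (z≢0 z≡0)
  ... | no z≢0 with K , const ← locally-constant l z z≢0 = K , λ _ k K≤k u →
    let u′ , eq = 16^-divisible K k u K≤k in trans (cong (λ v → σ t l (z ⊕ v)) eq) (const u′)

  stable-all : ∀ {A : Set} l (f : A → ℤ[i]) (as : List A) → ∃[ K ] All (λ a → Stable l (f a) K) as
  stable-all l f []       = 0 , []
  stable-all l f (a ∷ as) =
    let K , s = stable l (f a) ; K′ , ss = stable-all l f as in K ℕ.⊔ K′ ,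
      (λ z≢0 k K≤ → s z≢0 k (ℕₚ.≤-trans (ℕₚ.m≤m⊔n K K′) K≤)) ∷
      All.map (λ s′ z≢0 k K≤ → s′ z≢0 k (ℕₚ.≤-trans (ℕₚ.m≤n⊔m K K′) K≤)) ss

-- The solution s of 3s + b = 16^k (3v + b), a Gaussian integer that is (1 + i)-adically close to
-- -b/3. The recursion adds 5b because 16 - 1 = 3·5.
shift : ℤ[i] → ℤ[i] → ℕ → ℤ[i]
shift b v zero    = v
shift b v (suc k) = (+ 16 ⊛ shift b v k) ⊕ (+ 5 ⊛ b)

3shift : ∀ b v k → (+ 3 ⊛ shift b v k) ⊕ b ≡ 16^ k ((+ 3 ⊛ v) ⊕ b)
3shift b v zero    = refl
3shift b v (suc k) = trans (pair (l (proj₁ (shift b v k)) (proj₁ b)) (l (proj₂ (shift b v k)) (proj₂ b))) (cong (+ 16 ⊛_) (3shift b v k))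
  where
  l : ∀ s b → + 3 ℤ.* (+ 16 ℤ.* s ℤ.+ + 5 ℤ.* b) ℤ.+ b ≡ + 16 ℤ.* (+ 3 ℤ.* s ℤ.+ b)
  l = solve-∀

-- 3 · offset t g + gi is g i or g (3 + 4i), two odd multiples of g at which σ takes the values - and +.
offset : Sign → Unit → ℤ[i]
offset Sign.- g = g · 0[i]
offset Sign.+ g = g · (1ℤ , 1ℤ)

σ-offset : ∀ t g → σ t (p0 , g) ((+ 3 ⊛ offset t g) ⊕ g · (0ℤ , 1ℤ)) ≡ t
σ-offset Sign.- = ∀-unit refl refl refl refl
σ-offset Sign.+ = ∀-unit refl refl refl refl

π-shift : ∀ b v k → π (shift b v (suc k)) ≡ π b
π-shift b v k = trans (π-⊕ (+ 16 ⊛ shift b v k) (+ 5 ⊛ b)) (cong₂ Sign._*_ (π-16 (shift b v k)) (π-⊛ (+ 2) b))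

3z+i≢0 : ∀ g z → (+ 3 ⊛ z) ⊕ g · (0ℤ , 1ℤ) ≢ 0[i]
3z+i≢0 g (x , y) = ∀-unit {λ g → (+ 3 ⊛ (x , y)) ⊕ g · (0ℤ , 1ℤ) ≢ 0[i]}
    (λ eq → 3y+1≢0 y (cong proj₂ eq)) (λ eq → 3y-1≢0 x (cong proj₁ eq)) (λ eq → 3y-1≢0 y (cong proj₂ eq)) (λ eq → 3y+1≢0 x (cong proj₁ eq)) g
  where
  l₁ : ∀ y → 1ℤ ≡ (- y) ℤ.* + 3 ℤ.+ (+ 3 ℤ.* y ℤ.+ 1ℤ)
  l₁ = solve-∀
  l₂ : ∀ y → 1ℤ ≡ y ℤ.* + 3 ℤ.- (+ 3 ℤ.* y ℤ.+ -1ℤ)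
  l₂ = solve-∀
  3y+1≢0 : ∀ y → + 3 ℤ.* y ℤ.+ 1ℤ ≢ 0ℤ
  3y+1≢0 y eq = from-no (+ 3 ∣? 1ℤ) (divides (- y) (trans (l₁ y) (trans (cong (λ r → (- y) ℤ.* + 3 ℤ.+ r) eq) (ℤₚ.+-identityʳ _))))
  3y-1≢0 : ∀ y → + 3 ℤ.* y ℤ.+ -1ℤ ≢ 0ℤ
  3y-1≢0 y eq = from-no (+ 3 ∣? 1ℤ) (divides y (trans (l₂ y) (trans (cong (λ r → y ℤ.* + 3 ℤ.- r) eq) (ℤₚ.+-identityʳ _))))

cancel-sign : ∀ h a b → (h Sign.* a) Sign.* (a Sign.* b) ≡ h Sign.* b
cancel-sign h a b = trans (Signₚ.*-assoc h a (a Sign.* b)) (cong (h Sign.*_)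
  (trans (sym (Signₚ.*-assoc a a b)) (cong (Sign._* b) (Signₚ.s*s≡+ a))))

module Isomorphism (C : Covering) (D : HalfCurve) (anti : Antisymmetric (HalfCurve.turn D))
  (fits : ∀ g → Fits (p0 , g) (HalfCurve.turn D)) (gen : GeneratedBy C D) where

  module G = Generated C D anti fits gen
  open G using (t; g; x; l₀)
  module F = FourCurves t g
  module E₃ = Embedding t 1ℤ l₀ (g · (0ℤ , 1ℤ))
  open Continuity t

  b : ℤ[i]
  b = g · (0ℤ , 1ℤ)

  member : ∀ B β s → β ∈ B → s ∈ segments β → s ∈ concatMap segments B
  member B β s β∈ s∈ = ∈-concatMap⁺ segments (lose β∈ s∈)

  -- By `ι-shift` the translation turns 3 times a vertex of C into itself plus 16^(K+1) u. Away from
  -- x the sign is stable under this perturbation; at x only the perturbation remains, and its sign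
  -- is that of u, made equal to `t` by `offset`.
  C→E : ∀ B → B < C → ∃[ B′ ] B′ < F.covering × B ≅ B′
  C→E B B<C = map (translateCurve v) B , Transport.translated G.described F.described v q≡ B B<C agree , v , refl
    where
    K = proj₁ (stable-all l₀ (λ s → + 3 ⊛ G.ι (end s)) (concatMap segments B))
    K-stable = proj₂ (stable-all l₀ (λ s → + 3 ⊛ G.ι (end s)) (concatMap segments B))
    -- At least one step of `shift` is taken, so that V has the parity of b whatever the offset, as
    -- `q≡` requires.
    V = shift b (offset t g) (suc K)
    v = V ⊖ x
    q≡ : E₃.orientation Sign.* π v ≡ G.orientation
    q≡ = trans (cong (E₃.orientation Sign.*_) (trans (π-⊖ V x) (cong (Sign._* π x) (π-shift b (offset t g) K))))
      (trans (cancel-sign (h l₀) (π b) (π x)) (cong (h l₀ Sign.*_) (sym (π-⊖ 0[i] x))))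
    u = (+ 3 ⊛ offset t g) ⊕ b
    ι-shift : ∀ z → E₃.ι (z ⊕ v) ≡ (+ 3 ⊛ G.ι z) ⊕ 16^ (suc K) u
    ι-shift z = trans (pair (l (proj₁ z) (proj₁ V) (proj₁ x) (proj₁ b)) (l (proj₂ z) (proj₂ V) (proj₂ x) (proj₂ b)))
      (cong ((+ 3 ⊛ G.ι z) ⊕_) (3shift b (offset t g) (suc K)))
      where
      l : ∀ z V x b → + 3 ℤ.* (z ℤ.+ (V ℤ.- x)) ℤ.+ b ≡ + 3 ℤ.* (1ℤ ℤ.* z ℤ.+ (0ℤ ℤ.- x)) ℤ.+ (+ 3 ℤ.* V ℤ.+ b)
      l = solve-∀
    agree-at : ∀ z → Stable l₀ (+ 3 ⊛ G.ι z) K → E₃.sign (z ⊕ v) ≡ G.sign z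
    agree-at z st = cases (G.ι z ≟ᵖ 0[i])
     where
     open ≡-Reasoning
     at-0 : G.ι z ≡ 0[i] → E₃.sign (z ⊕ v) ≡ G.sign z
     at-0 ι≡0 = begin
      σ t l₀ (E₃.ι (z ⊕ v))                      ≡⟨ cong (σ t l₀) (ι-shift z) ⟩
      σ t l₀ ((+ 3 ⊛ G.ι z) ⊕ 16^ (suc K) u)     ≡⟨ cong (λ w → σ t l₀ (w ⊕ 16^ (suc K) u)) (trans (cong (+ 3 ⊛_) ι≡0) (⊛-0 (+ 3))) ⟩
      σ t l₀ (0[i] ⊕ 16^ (suc K) u)              ≡⟨ cong (σ t l₀) (⊕-identityˡ (16^ (suc K) u)) ⟩
      σ t l₀ (16^ (suc K) u)                     ≡⟨ σ-16^ (suc K) l₀ u ⟩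
      σ t l₀ u                                   ≡⟨ σ-offset t g ⟩
      t                                          ≡⟨ cong (σ t l₀) ι≡0 ⟨
      σ t l₀ (G.ι z)                             ∎
     away : G.ι z ≢ 0[i] → E₃.sign (z ⊕ v) ≡ G.sign z
     away ι≢0 = begin
      σ t l₀ (E₃.ι (z ⊕ v))                      ≡⟨ cong (σ t l₀) (ι-shift z) ⟩
      σ t l₀ ((+ 3 ⊛ G.ι z) ⊕ 16^ (suc K) u)     ≡⟨ st 3ι≢0 (suc K) (ℕₚ.n≤1+n K) u ⟩
      σ t l₀ (+ 3 ⊛ G.ι z)                       ≡⟨ σ-⊛ 1ℤ l₀ (G.ι z) ⟩
      σ t l₀ (G.ι z)                             ∎
      where
      3ι≢0 : + 3 ⊛ G.ι z ≢ 0[i]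
      3ι≢0 eq = ι≢0 (pair (ℤₚ.*-cancelˡ-≡ (+ 3) _ 0ℤ (cong proj₁ eq)) (ℤₚ.*-cancelˡ-≡ (+ 3) _ 0ℤ (cong proj₂ eq)))
     cases : Dec (G.ι z ≡ 0[i]) → E₃.sign (z ⊕ v) ≡ G.sign z
     cases (yes ι≡0) = at-0 ι≡0
     cases (no ι≢0)  = away ι≢0
    agree : ∀ β → β ∈ B → ∀ s → s ∈ segments β → E₃.sign (end s ⊕ v) ≡ G.sign (end s)
    agree β β∈ s s∈ = agree-at (end s) (All.lookup K-stable (member B β s β∈ s∈))

  -- Now V approximates b/3, hence the use of -b. As `ι` never takes the value 0 on E, stability
  -- applies at every vertex and the offset 0 suffices.
  E→C : ∀ B → B < F.covering → ∃[ B′ ] B′ < C × B ≅ B′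
  E→C B B<E = map (translateCurve v) B , Transport.translated F.described G.described v q≡ B B<E agree , v , refl
    where
    K = proj₁ (stable-all l₀ (λ s → E₃.ι (end s)) (concatMap segments B))
    K-stable = proj₂ (stable-all l₀ (λ s → E₃.ι (end s)) (concatMap segments B))
    b⁻ = 0[i] ⊖ b
    V = shift b⁻ 0[i] (suc K)
    v = V ⊕ x
    q≡ : G.orientation Sign.* π v ≡ E₃.orientation
    q≡ = trans (cong₂ (λ r s → (h l₀ Sign.* r) Sign.* s) (π-⊖ 0[i] x)
        (trans (π-⊕ V x) (trans (cong (Sign._* π x) (trans (π-shift b⁻ 0[i] K) (π-⊖ 0[i] b))) (Signₚ.*-comm (π b) (π x)))))
      (cancel-sign (h l₀) (π x) (π b))
    u = (+ 3 ⊛ 0[i]) ⊕ b⁻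
    ι-shift : ∀ z → + 3 ⊛ G.ι (z ⊕ v) ≡ E₃.ι z ⊕ 16^ (suc K) u
    ι-shift z = trans (pair (l (proj₁ z) (proj₁ V) (proj₁ x) (proj₁ b)) (l (proj₂ z) (proj₂ V) (proj₂ x) (proj₂ b)))
      (cong (E₃.ι z ⊕_) (3shift b⁻ 0[i] (suc K)))
      where
      l : ∀ z V x b → + 3 ℤ.* (1ℤ ℤ.* (z ℤ.+ (V ℤ.+ x)) ℤ.+ (0ℤ ℤ.- x)) ≡ (+ 3 ℤ.* z ℤ.+ b) ℤ.+ (+ 3 ℤ.* V ℤ.+ (0ℤ ℤ.- b))
      l = solve-∀
    agree : ∀ β → β ∈ B → ∀ s → s ∈ segments β → G.sign (end s ⊕ v) ≡ E₃.sign (end s)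
    agree β β∈ s s∈ = begin
      σ t l₀ (G.ι (end s ⊕ v))                   ≡⟨ σ-⊛ 1ℤ l₀ (G.ι (end s ⊕ v)) ⟨
      σ t l₀ (+ 3 ⊛ G.ι (end s ⊕ v))             ≡⟨ cong (σ t l₀) (ι-shift (end s)) ⟩
      σ t l₀ (E₃.ι (end s) ⊕ 16^ (suc K) u)      ≡⟨ All.lookup K-stable (member B β s β∈ s∈) (3z+i≢0 g (end s)) (suc K) (ℕₚ.n≤1+n K) u ⟩
      σ t l₀ (E₃.ι (end s))                      ∎
      where open ≡-Reasoning

mainTheorem7 : (C : Covering) → ByCompleteFoldingCurves C → LocalIsomorphismProperty C →
    (D : HalfCurve) → let a = HalfCurve.turn D in
    IsInfiniteFolding a →
    (∀ (n : ℕ) → (a (2 ^ (4 * n)) ≡ Sign.+) × (a (2 ^ (4 * n + 1)) ≡ Sign.+) ×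
    (a (2 ^ (4 * n + 2)) ≡ Sign.-) × (a (2 ^ (4 * n + 3)) ≡ Sign.-)) →
    GeneratedBy C D →
    Σ Covering (λ E → (Fin 4 ↔ Index E) × LocallyIsomorphic C E)
mainTheorem7 C _ _ D folding leads gen = F.covering , ↔-id (Fin 4) , C→E , E→C
  where
  open Isomorphism C D (infiniteFolding⇒antisymmetric (HalfCurve.turn D) folding) (up^-fits (HalfCurve.turn D) leads) gen
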